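{- Let $A\subset\mathbb{Z}^2$ be a finite nonempty set, let $N:=|\operatorname{enc}(A)\setminus A|$ and $E:=\operatorname{Exc}(\operatorname{enc}(A))$. Then the following are equivalent: (1) $A$ is minimal; (2) $|\partial A|=|\partial(\operatorname{enc}(A))|$ and $N\le E$; (3) $\mathbb{Z}^2\setminus A$ is a union of cones and $N\le E$.
   Context: $X$ is the graph with vertex set $\mathbb{Z}^2$ in which $(x,y)$ and $(x',y')$ are adjacent iff $|x-x'|+|y-y'|=1$. For $A\subset\mathbb{Z}^2$, the vertex boundary is $\partial A=\{u\in\mathbb{Z}^2\setminus A:\ u \text{ is adjacent to some } v\in A\}$. A finite set $A$ is minimal if $|\partial A|\le|\partial C|$ for every $C\subset\mathbb{Z}^2$ with $|C|=|A|$. Two sets are congruent if some graph automorphism of $X$ maps one onto the other. For integers $a,b,c,d$ let $B(a,b,c,d)=\{(x,y)\in\mathbb{Z}^2: a\le y-x\le b,\ c\le y+x\le d\}$; a box is a nonempty set of this form. The enclosing box $\operatorname{enc}(A)$ of a finite nonempty set $A$ is the smallest box containing $A$. The excess of a finite set $A$ is $\operatorname{Exc}(A)=\max\{|A|-|C|:\ C\subset\mathbb{Z}^2 \text{ minimal},\ |\partial C|=|\partial A|\}$. A cone is a subset of $\mathbb{Z}^2$ congruent to $\{(x,y): y-x\ge0,\ y+x\ge0\}$. -}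

module Defs where

open import Level using (Level; suc; _⊔_) renaming (zero to lzero)
open import Data.Nat as ℕ using (ℕ)
open import Data.Integer as ℤ using (ℤ; +_; _-_; _+_; ∣_∣)
open import Data.Integer.Properties as ℤP using ()
open import Data.Product using (Σ; ∃; ∃-syntax; _×_; _,_)
open import Data.Product.Properties using (≡-dec)
open import Data.List using (List; []; _∷_; length; filter; concatMap; deduplicate)
open import Relation.Nullary using (¬_; ¬?)
open import Relation.Binary.PropositionalEquality using (_≡_)
open import Relation.Binary using (DecidableEquality)
open import Function using (_⇔_)

Point : Set
Point = ℤ × ℤ

_≟P_ : DecidableEquality Point
_≟P_ = ≡-dec ℤ._≟_ ℤ._≟_

open import Data.List.Membership.DecPropositional _≟P_ public
  using (_∈_; _∉_; _∈?_)

Adj : Point → Point → Set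
Adj (x , y) (x' , y') = ∣ x - x' ∣ ℕ.+ ∣ y - y' ∣ ≡ 1

nbrs : Point → List Point
nbrs (x , y) = (x + + 1 , y) ∷ (x - + 1 , y) ∷ (x , y + + 1) ∷ (x , y - + 1) ∷ []

-- Finite subsets of ℤ² are represented by lists (the set of members);
-- cardinality counts distinct members.
card : List Point → ℕ
card A = length (deduplicate _≟P_ A)

boundary : List Point → List Point
boundary A = filter (λ u → ¬? (u ∈? A)) (concatMap nbrs A)

bsize : List Point → ℕ
bsize A = card (boundary A)

Minimal : List Point → Set
Minimal A = ∀ (C : List Point) → card C ≡ card A → bsize A ℕ.≤ bsize C

InBox : ℤ → ℤ → ℤ → ℤ → Point → Set
InBox a b c d (x , y) = (a ℤ.≤ y - x × y - x ℤ.≤ b) × (c ℤ.≤ y + x × y + x ℤ.≤ d)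

IsEncBox : List Point → ℤ → ℤ → ℤ → ℤ → Set
IsEncBox A a b c d =
  (∀ p → p ∈ A → InBox a b c d p) ×
  (∀ a' b' c' d' → (∀ p → p ∈ A → InBox a' b' c' d' p) →
     ∀ p → InBox a b c d p → InBox a' b' c' d' p)

Enumerates : List Point → (Point → Set) → Set
Enumerates L S = ∀ p → (p ∈ L) ⇔ S p

IsExc : List Point → ℤ → Set
IsExc S e =
  (∃[ C ] (Minimal C × bsize C ≡ bsize S × + card S ≡ e + + card C)) ×
  (∀ C → Minimal C → bsize C ≡ bsize S → + card S - + card C ℤ.≤ e)

record Automorphism : Set where
  field
    f    : Point → Point
    g    : Point → Point
    gf   : ∀ p → g (f p) ≡ p
    fg   : ∀ p → f (g p) ≡ p
    adj  : ∀ p q → Adj p q ⇔ Adj (f p) (f q)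

Cone₀ : Point → Set
Cone₀ (x , y) = (+ 0 ℤ.≤ y - x) × (+ 0 ℤ.≤ y + x)

IsCone : (Point → Set) → Set
IsCone S = Σ Automorphism λ φ →
  ∀ p → S p ⇔ (∃[ q ] (Cone₀ q × Automorphism.f φ q ≡ p))

ComplUnionOfCones : List Point → Set₁
ComplUnionOfCones A = Σ Set λ I → Σ (I → Point → Set) λ K →
  (∀ i → IsCone (K i)) × (∀ p → (p ∉ A) ⇔ (∃[ i ] K i p))

{-# OPTIONS --safe #-}
module Submission where

-- In the coordinates U = y - x, V = y + x the boxes are rectangles and the cones are the four
-- kinds of quadrants.  Removing a point with maximal y never increases the boundary, so the least
-- boundary of an n-point set is nondecreasing in n; hence a set A with |∂A| ≤ |∂ enc A| and N ≤ E
-- is minimal, being at least as large as some minimal set with boundary |∂ enc A|.  If the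
-- complement of A is a union of cones, the points of enc A ∖ A can be removed one at a time, each
-- from the top of such a cone, so |∂A| ≤ |∂ enc A|.
--
-- Conversely let A be minimal.  Suppose a diagonal U = i between two points of A is empty.
-- Sliding one side of A diagonally towards the other in the two possible ways cannot lower the
-- boundary; comparing the two slides shows that, after a possible translation of one side along
-- the diagonal, two points face each other across the gap and are isolated in A.  Local moves then
-- contradict minimality unless A consists of these two points (and then A = enc A).  Otherwise
-- every diagonal of the rectangle enc A meets A, and counting neighbours along the diagonals gives
-- |∂A| ≥ |∂ enc A|; in the case of equality the diagonals of A and of its neighbourhood have no
-- gaps, so no point outside A sees A in all four quadrants.

open import Defs
open import Data.Nat as ℕ using (ℕ; zero; suc; s≤s; z≤n)
import Data.Nat.Properties as ℕP
open import Data.Integer using (ℤ; +_; -[1+_]; _+_; _-_; -_; _≤_; +≤+; -≤+; ∣_∣)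
open import Data.Integer.Properties as ℤP using (≤-trans; ≤-refl; ≤-reflexive)
open import Data.Integer.Tactic.RingSolver using (solve; solve-∀)
import Data.Nat.Tactic.RingSolver as ℕS
open import Data.List using (List; []; _∷_; _++_; length; filter; concatMap; deduplicate; map)
open import Data.List.Properties using (length-++; length-map)
open import Data.List.Membership.Propositional using (find; lose)
open import Data.List.Membership.Propositional.Properties
  using (∈-deduplicate⁺; ∈-deduplicate⁻; ∈-filter⁺; ∈-filter⁻; ∈-++⁺ˡ; ∈-++⁺ʳ; ∈-++⁻; ∈-map⁺; ∈-map⁻; ∈-concatMap⁺; ∈-concatMap⁻; ∈-∃++)
open import Data.List.Relation.Binary.Subset.Propositional using (_⊆_)
open import Data.List.Relation.Unary.All as All using (All)
open import Data.List.Relation.Unary.Any as Any using (Any; here; there)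
open import Data.List.Relation.Unary.AllPairs as AllPairs using ()
open import Data.List.Relation.Unary.Unique.Propositional using (Unique)
import Data.List.Relation.Unary.Unique.Propositional.Properties as UniqueP
open import Data.List.Relation.Unary.Unique.DecPropositional.Properties _≟P_ using (deduplicate-!)
open import Data.Product using (Σ; ∃-syntax; _×_; _,_; proj₁; proj₂)
open import Data.Sum as Sum using (_⊎_; inj₁; inj₂; [_,_]′)
open import Data.Empty using (⊥; ⊥-elim)
open import Relation.Nullary using (¬_; ¬?; Dec; yes; no)
open import Relation.Nullary.Decidable using (decidable-stable; _×-dec_)
open import Relation.Binary.PropositionalEquality hiding (J)
open import Function using (_∘_; id; _⇔_; mk⇔; Equivalence)

-- Linear arithmetic over ℤ

-- Let b(n) be the least boundary of an n-point set. Besides being nondecreasing, b satisfies b(n+1)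
-- ≤ b(n) + 1 for n ≥ 2, and this drives the local moves: from a minimal set one cannot delete j
-- points that are not adjacent to the rest, keep at least two others, and free more than j boundary
-- points. The restriction on n is real, since b(1) = 4 and b(2) = 6, and it is why surviving points
-- have to be exhibited before a deletion. The two-point exception is real as well: two points
-- facing each other diagonally have six boundary points, as many as two adjacent ones. The count
-- along diagonals needs a point of A on each of them, so gaps have to be excluded before anything
-- is counted. Two further constraints come from the definitions: a cone is the image of a quadrant
-- under an arbitrary automorphism, so it is located through graph distances alone; and the excess
-- is a maximum that must be exhibited, so sets of small boundary have to be searched for
-- effectively.

lin0 : ∀ {X Y} k → Y - X ≡ + k → X ≤ Y
lin0 k e = ℤP.0≤i-j⇒j≤i (subst (+ 0 ≤_) (sym e) (+≤+ z≤n))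

-- The arguments are a certificate: `Y - X` is the sum of the slacks of the hypotheses and a
-- nonnegative constant `k`, an identity for the ring solver. Contradictions are derived as
-- `+ 1 ≤ + 0`.
lin1 : ∀ {A B X Y} k → A ≤ B → Y - X ≡ (B - A) + + k → X ≤ Y
lin1 k h e = ℤP.0≤i-j⇒j≤i (subst (+ 0 ≤_) (sym e) (ℤP.+-mono-≤ (ℤP.i≤j⇒0≤j-i h) (+≤+ (z≤n {k}))))

lin2 : ∀ {A B C D X Y} k → A ≤ B → C ≤ D → Y - X ≡ (B - A) + (D - C) + + k → X ≤ Y
lin2 k h h′ e = ℤP.0≤i-j⇒j≤i (subst (+ 0 ≤_) (sym e)
  (ℤP.+-mono-≤ (ℤP.+-mono-≤ (ℤP.i≤j⇒0≤j-i h) (ℤP.i≤j⇒0≤j-i h′)) (+≤+ (z≤n {k}))))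

1≰0 : ¬ (+ 1 ≤ + 0)
1≰0 (+≤+ ())

i+1≰i : ∀ {i} → ¬ (i + + 1 ≤ i)
i+1≰i {i} h = 1≰0 (lin1 0 h (solve (i ∷ [])))

≰⇒+1≤ : ∀ {i j} → ¬ (i ≤ j) → j + + 1 ≤ i
≰⇒+1≤ {i} {j} h = subst (_≤ i) (ℤP.+-comm (+ 1) j) (ℤP.i<j⇒suc[i]≤j (ℤP.≰⇒> h))

≢⇒< : ∀ {i j} → i ≤ j → ¬ (i ≡ j) → i + + 1 ≤ j
≢⇒< {i} {j} h n = ≰⇒+1≤ (λ h′ → n (ℤP.≤-antisym h h′))

-- Cardinalities of finite sets

Disjoint : List Point → List Point → Set
Disjoint A B = ∀ {p} → p ∈ A → p ∈ B → ⊥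

infixl 6 _∖_
infixl 7 _∩_

_∖_ : List Point → List Point → List Point
A ∖ B = filter (λ u → ¬? (u ∈? B)) A

_∩_ : List Point → List Point → List Point
A ∩ B = filter (_∈? B) A

∈-∖⁺ : ∀ {A B p} → p ∈ A → p ∉ B → p ∈ A ∖ B
∈-∖⁺ {A} {B} = ∈-filter⁺ (λ u → ¬? (u ∈? B))

∈-∖⁻ : ∀ {A B p} → p ∈ A ∖ B → p ∈ A × p ∉ B
∈-∖⁻ {A} {B} = ∈-filter⁻ (λ u → ¬? (u ∈? B)) {xs = A}

∈-∩⁺ : ∀ {A B p} → p ∈ A → p ∈ B → p ∈ A ∩ B
∈-∩⁺ {A} {B} = ∈-filter⁺ (_∈? B)

∈-∩⁻ : ∀ {A B p} → p ∈ A ∩ B → p ∈ A × p ∈ B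
∈-∩⁻ {A} {B} = ∈-filter⁻ (_∈? B) {xs = A}

∈-++-elim : ∀ A {B p} {C : Set} → (p ∈ A → C) → (p ∈ B → C) → p ∈ A ++ B → C
∈-++-elim A f g h = [ f , g ]′ (∈-++⁻ A h)

∪-⊆ : ∀ A {B C} → A ⊆ C → B ⊆ C → A ++ B ⊆ C
∪-⊆ A f g = ∈-++-elim A f g

unique-⊆-length : ∀ {A B : List Point} → Unique A → A ⊆ B → length A ℕ.≤ length B
unique-⊆-length {[]} _ _ = z≤n
unique-⊆-length {a ∷ A} {B} (a∉ AllPairs.∷ u) A⊆B with ∈-∃++ (A⊆B (here refl))
... | ys , zs , refl = subst (suc (length A) ℕ.≤_) (sym len)
        (s≤s (unique-⊆-length u sub))
  where
  len : length (ys ++ a ∷ zs) ≡ suc (length (ys ++ zs))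
  len = trans (length-++ ys) (trans (ℕP.+-suc (length ys) (length zs)) (cong suc (sym (length-++ ys))))
  sub : A ⊆ ys ++ zs
  sub {p} h with ∈-++⁻ ys (A⊆B (there h))
  ... | inj₁ q = ∈-++⁺ˡ q
  ... | inj₂ (here refl) = ⊥-elim (All.lookup a∉ h refl)
  ... | inj₂ (there q) = ∈-++⁺ʳ ys q

dedup : List Point → List Point
dedup = deduplicate _≟P_

∈-dedup⁺ : ∀ {A} → A ⊆ dedup A
∈-dedup⁺ = ∈-deduplicate⁺ _≟P_

∈-dedup⁻ : ∀ {A} → dedup A ⊆ A
∈-dedup⁻ {A} = ∈-deduplicate⁻ _≟P_ A

card-mono : ∀ {A B} → A ⊆ B → card A ℕ.≤ card B
card-mono {A} f = unique-⊆-length (deduplicate-! A) (∈-dedup⁺ ∘ f ∘ ∈-dedup⁻)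

card-cong : ∀ {A B} → A ⊆ B → B ⊆ A → card A ≡ card B
card-cong f g = ℕP.≤-antisym (card-mono f) (card-mono g)

card≤length : ∀ A → card A ℕ.≤ length A
card≤length A = unique-⊆-length (deduplicate-! A) ∈-dedup⁻

card-unique : ∀ {A} → Unique A → card A ≡ length A
card-unique {A} u = ℕP.≤-antisym (card≤length A) (unique-⊆-length u ∈-dedup⁺)

card-++-≤ : ∀ A B → card (A ++ B) ℕ.≤ card A ℕ.+ card B
card-++-≤ A B = subst (card (A ++ B) ℕ.≤_) (length-++ (dedup A))
  (unique-⊆-length (deduplicate-! (A ++ B))
    λ h → ∈-++-elim A (∈-++⁺ˡ ∘ ∈-dedup⁺) (∈-++⁺ʳ (dedup A) ∘ ∈-dedup⁺) (∈-dedup⁻ {A ++ B} h))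

card-disjoint-≤ : ∀ A B → Disjoint A B → card A ℕ.+ card B ℕ.≤ card (A ++ B)
card-disjoint-≤ A B d = subst (ℕ._≤ card (A ++ B)) (length-++ (dedup A))
  (unique-⊆-length
    (UniqueP.++⁺ (deduplicate-! A) (deduplicate-! B) (λ (h , k) → d (∈-dedup⁻ {A} h) (∈-dedup⁻ {B} k)))
    (∈-++-elim (dedup A) (∈-dedup⁺ {A ++ B} ∘ ∈-++⁺ˡ ∘ ∈-dedup⁻ {A})
                         (∈-dedup⁺ {A ++ B} ∘ ∈-++⁺ʳ A ∘ ∈-dedup⁻ {B})))

card-disjoint : ∀ A B → Disjoint A B → card (A ++ B) ≡ card A ℕ.+ card B
card-disjoint A B d = ℕP.≤-antisym (card-++-≤ A B) (card-disjoint-≤ A B d)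

-- Bookkeeping for a local move: `Q` is the old boundary, `P` the new one, `L` the points that left
-- the boundary and `M` those that may have entered it.
exchange : ∀ {P L Q M} → Disjoint P L → P ⊆ Q ++ M → L ⊆ Q ++ M →
           card P ℕ.+ card L ℕ.≤ card Q ℕ.+ card M
exchange {P} {L} {Q} {M} d f g =
  ℕP.≤-trans (card-disjoint-≤ P L d) (ℕP.≤-trans (card-mono (∪-⊆ P f g)) (card-++-≤ Q M))

card-∪∩ : ∀ A B → card (A ++ B) ℕ.+ card (A ∩ B) ≡ card A ℕ.+ card B
card-∪∩ A B = begin
  card (A ++ B) ℕ.+ card (A ∩ B)                 ≡⟨ cong (ℕ._+ card (A ∩ B)) (trans (card-cong f g) (card-disjoint (A ∖ B) B (λ h → proj₂ (∈-∖⁻ {A} h)))) ⟩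
  card (A ∖ B) ℕ.+ card B ℕ.+ card (A ∩ B)       ≡⟨ ℕP.+-assoc (card (A ∖ B)) (card B) _ ⟩
  card (A ∖ B) ℕ.+ (card B ℕ.+ card (A ∩ B))     ≡⟨ cong (card (A ∖ B) ℕ.+_) (ℕP.+-comm (card B) _) ⟩
  card (A ∖ B) ℕ.+ (card (A ∩ B) ℕ.+ card B)     ≡⟨ ℕP.+-assoc (card (A ∖ B)) _ _ ⟨
  card (A ∖ B) ℕ.+ card (A ∩ B) ℕ.+ card B       ≡⟨ cong (ℕ._+ card B) (sym (trans (card-cong f′ g′) (card-disjoint (A ∖ B) (A ∩ B) λ h k → proj₂ (∈-∖⁻ {A} h) (proj₂ (∈-∩⁻ {A} k))))) ⟩
  card A ℕ.+ card B ∎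
  where
  open ≡-Reasoning
  f : A ++ B ⊆ (A ∖ B) ++ B
  f {p} h with p ∈? B
  ... | yes k = ∈-++⁺ʳ (A ∖ B) k
  ... | no k = ∈-++-elim A (λ q → ∈-++⁺ˡ (∈-∖⁺ q k)) (⊥-elim ∘ k) h
  g : (A ∖ B) ++ B ⊆ A ++ B
  g = ∪-⊆ (A ∖ B) (∈-++⁺ˡ ∘ proj₁ ∘ ∈-∖⁻ {A}) (∈-++⁺ʳ A)
  f′ : A ⊆ (A ∖ B) ++ (A ∩ B)
  f′ {p} h with p ∈? B
  ... | yes k = ∈-++⁺ʳ (A ∖ B) (∈-∩⁺ h k)
  ... | no k = ∈-++⁺ˡ (∈-∖⁺ h k)
  g′ : (A ∖ B) ++ (A ∩ B) ⊆ A
  g′ = ∪-⊆ (A ∖ B) (proj₁ ∘ ∈-∖⁻ {A}) (proj₁ ∘ ∈-∩⁻ {A})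

card-∖ : ∀ A J → J ⊆ A → card (A ∖ J) ℕ.+ card J ≡ card A
card-∖ A J J⊆A = trans (sym (card-disjoint (A ∖ J) J (λ h → proj₂ (∈-∖⁻ {A} h))))
  (card-cong (∪-⊆ (A ∖ J) (proj₁ ∘ ∈-∖⁻ {A}) J⊆A) f)
  where
  f : A ⊆ (A ∖ J) ++ J
  f {p} h with p ∈? J
  ... | yes k = ∈-++⁺ʳ (A ∖ J) k
  ... | no k = ∈-++⁺ˡ (∈-∖⁺ h k)

card-∷ : ∀ A p → p ∉ A → card (p ∷ A) ≡ suc (card A)
card-∷ A p p∉A = card-disjoint (p ∷ []) A λ { (here refl) → p∉A }

card-map : ∀ {f : Point → Point} → (∀ {p q} → f p ≡ f q → p ≡ q) → ∀ A → card (map f A) ≡ card A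
card-map {f} inj A = trans (card-cong g h) (trans (card-unique (UniqueP.map⁺ inj (deduplicate-! A))) (length-map f (dedup A)))
  where
  g : map f A ⊆ map f (dedup A)
  g k with ∈-map⁻ f k
  ... | q , q∈ , refl = ∈-map⁺ f (∈-dedup⁺ q∈)
  h : map f (dedup A) ⊆ map f A
  h k with ∈-map⁻ f k
  ... | q , q∈ , refl = ∈-map⁺ f (∈-dedup⁻ q∈)

card-pos : ∀ {A p} → p ∈ A → 1 ℕ.≤ card A
card-pos {A} {p} h = card-mono {p ∷ []} {A} λ { (here refl) → h }

card-two : ∀ {A p q} → p ∈ A → q ∈ A → ¬ (p ≡ q) → 2 ℕ.≤ card A
card-two {A} {p} {q} h k n = ℕP.≤-trans
  (ℕP.≤-reflexive (sym (card-∷ (q ∷ []) p λ { (here e) → n e })))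
  (card-mono {p ∷ q ∷ []} {A} λ { (here refl) → h ; (there (here refl)) → k })

card≡0⇒∉ : ∀ {A} → card A ℕ.≤ 0 → ∀ {p} → p ∉ A
card≡0⇒∉ h k with ℕP.≤-trans (card-pos k) h
... | ()

card-pos⇒∃ : ∀ A → 1 ℕ.≤ card A → ∃[ p ] p ∈ A
card-pos⇒∃ (p ∷ A) _ = p , here refl

-- Boundaries and graph automorphisms

Nb : List Point → Point → Set
Nb A p = Any (_∈ A) (nbrs p)

+1-1 : ∀ x → x ≡ x + + 1 - + 1
+1-1 = solve-∀

-1+1 : ∀ x → x ≡ x - + 1 + + 1
-1+1 = solve-∀

nbrs-sym : ∀ {p q} → p ∈ nbrs q → q ∈ nbrs p
nbrs-sym {q = x , y} (here refl) = there (here (cong (_, y) (+1-1 x)))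
nbrs-sym {q = x , y} (there (here refl)) = here (cong (_, y) (-1+1 x))
nbrs-sym {q = x , y} (there (there (here refl))) = there (there (there (here (cong (x ,_) (+1-1 y)))))
nbrs-sym {q = x , y} (there (there (there (here refl)))) = there (there (here (cong (x ,_) (-1+1 y))))

Nb⁺ : ∀ {A p q} → q ∈ A → q ∈ nbrs p → Nb A p
Nb⁺ {A} q∈A h = Any.map (λ { refl → q∈A }) h

Nb⁻ : ∀ {A p} → Nb A p → ∃[ q ] q ∈ nbrs p × q ∈ A
Nb⁻ h = Any.satisfied (go h)
  where
  go : ∀ {A ns} → Any (_∈ A) ns → Any (λ q → q ∈ ns × q ∈ A) ns
  go (here k) = here (here refl , k)
  go (there k) = there (Any.map (λ (a , b) → there a , b) (go k))

Nb-mono : ∀ {A B p} → A ⊆ B → Nb A p → Nb B p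
Nb-mono f = Any.map f

Nb? : ∀ A p → Dec (Nb A p)
Nb? A p = Any.any? (_∈? A) (nbrs p)

∈-N⁺ : ∀ {A p} → Nb A p → p ∈ concatMap nbrs A
∈-N⁺ {A} {p} h with Nb⁻ h
... | q , q∈n , q∈A = ∈-concatMap⁺ nbrs (Any.map (λ { refl → nbrs-sym q∈n }) q∈A)

∈-N⁻ : ∀ {A p} → p ∈ concatMap nbrs A → Nb A p
∈-N⁻ {A} h with find (∈-concatMap⁻ nbrs {xs = A} h)
... | q , q∈A , p∈n = Nb⁺ q∈A (nbrs-sym p∈n)

∂⁺ : ∀ {A p} → p ∉ A → Nb A p → p ∈ boundary A
∂⁺ {A} p∉ h = ∈-∖⁺ (∈-N⁺ h) p∉

∂⁻ : ∀ A {p} → p ∈ boundary A → p ∉ A × Nb A p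
∂⁻ A h with ∈-∖⁻ {concatMap nbrs A} {A} h
... | k , p∉ = p∉ , ∈-N⁻ k

∂-cong : ∀ {A B} → A ⊆ B → B ⊆ A → boundary A ⊆ boundary B
∂-cong {A} f g h with ∂⁻ A h
... | p∉ , n = ∂⁺ (p∉ ∘ g) (Nb-mono f n)

bsize-cong : ∀ {A B} → A ⊆ B → B ⊆ A → bsize A ≡ bsize B
bsize-cong {A} {B} f g = card-cong (∂-cong {A} {B} f g) (∂-cong {B} {A} g f)

Minimal-resp : ∀ A B → card B ≡ card A → bsize B ℕ.≤ bsize A → Minimal A → Minimal B
Minimal-resp A B e h m C c = ℕP.≤-trans h (m C (trans c e))

Minimal-cong : ∀ {A B} → A ⊆ B → B ⊆ A → Minimal A → Minimal B
Minimal-cong {A} {B} f g = Minimal-resp A B (card-cong {B} g f) (ℕP.≤-reflexive (bsize-cong {B} g f))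

i-j≡1⇒j≡i-1 : ∀ i j → i - j ≡ + 1 → j ≡ i - + 1
i-j≡1⇒j≡i-1 i j e = trans (l i j) (cong (λ t → i - t) e)
  where
  l : ∀ i j → j ≡ i - (i - j)
  l = solve-∀

i-j≡-1⇒j≡i+1 : ∀ i j → i - j ≡ -[1+ 0 ] → j ≡ i + + 1
i-j≡-1⇒j≡i+1 i j e = trans (l i j) (cong (λ t → i - t) e)
  where
  l : ∀ i j → j ≡ i - (i - j)
  l = solve-∀

∣i∣≡1 : ∀ i → ∣ i ∣ ≡ 1 → i ≡ + 1 ⊎ i ≡ -[1+ 0 ]
∣i∣≡1 (+ .1) refl = inj₁ refl
∣i∣≡1 -[1+ .0 ] refl = inj₂ refl

sum≡1 : ∀ m n → m ℕ.+ n ≡ 1 → (m ≡ 0 × n ≡ 1) ⊎ (m ≡ 1 × n ≡ 0)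
sum≡1 zero n e = inj₁ (refl , e)
sum≡1 (suc zero) zero e = inj₂ (refl , refl)

adj⇒nbrs : ∀ {p q} → Adj p q → q ∈ nbrs p
adj⇒nbrs {x , y} {x′ , y′} h with sum≡1 ∣ x - x′ ∣ ∣ y - y′ ∣ h
... | inj₁ (e , e′) with ℤP.i-j≡0⇒i≡j x x′ (ℤP.∣i∣≡0⇒i≡0 e) | ∣i∣≡1 (y - y′) e′
... | refl | inj₁ k rewrite i-j≡1⇒j≡i-1 y y′ k = there (there (there (here refl)))
... | refl | inj₂ k rewrite i-j≡-1⇒j≡i+1 y y′ k = there (there (here refl))
adj⇒nbrs {x , y} {x′ , y′} h | inj₂ (e , e′) with ℤP.i-j≡0⇒i≡j y y′ (ℤP.∣i∣≡0⇒i≡0 e′) | ∣i∣≡1 (x - x′) e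
... | refl | inj₁ k rewrite i-j≡1⇒j≡i-1 x x′ k = there (here refl)
... | refl | inj₂ k rewrite i-j≡-1⇒j≡i+1 x x′ k = here refl

x-x : ∀ x → x - x ≡ + 0
x-x = solve-∀

x-[x+1] : ∀ x → x - (x + + 1) ≡ -[1+ 0 ]
x-[x+1] = solve-∀

x-[x-1] : ∀ x → x - (x - + 1) ≡ + 1
x-[x-1] = solve-∀

nbrs⇒adj : ∀ {p q} → q ∈ nbrs p → Adj p q
nbrs⇒adj {x , y} (here refl) rewrite x-[x+1] x | x-x y = refl
nbrs⇒adj {x , y} (there (here refl)) rewrite x-[x-1] x | x-x y = refl
nbrs⇒adj {x , y} (there (there (here refl))) rewrite x-x x | x-[x+1] y = refl
nbrs⇒adj {x , y} (there (there (there (here refl)))) rewrite x-x x | x-[x-1] y = refl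

open Automorphism

aut-nbrs : ∀ φ {p q} → p ∈ nbrs q → f φ p ∈ nbrs (f φ q)
aut-nbrs φ {p} {q} h = adj⇒nbrs (Equivalence.to (adj φ q p) (nbrs⇒adj h))

inv : Automorphism → Automorphism
inv φ = record
  { f = g φ ; g = f φ ; gf = fg φ ; fg = gf φ
  ; adj = λ p q → mk⇔
      (λ h → Equivalence.from (adj φ (g φ p) (g φ q)) (subst₂ Adj (sym (fg φ p)) (sym (fg φ q)) h))
      (λ h → subst₂ Adj (fg φ p) (fg φ q) (Equivalence.to (adj φ (g φ p) (g φ q)) h)) }

infixr 9 _⊙_
_⊙_ : Automorphism → Automorphism → Automorphism
φ ⊙ ψ = record
  { f = f φ ∘ f ψ ; g = g ψ ∘ g φ
  ; gf = λ p → trans (cong (g ψ) (gf φ (f ψ p))) (gf ψ p)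
  ; fg = λ p → trans (cong (f φ) (fg ψ (g φ p))) (fg φ p)
  ; adj = λ p q → mk⇔ (Equivalence.to (adj φ _ _) ∘ Equivalence.to (adj ψ p q))
                      (Equivalence.from (adj ψ p q) ∘ Equivalence.from (adj φ _ _)) }

infixl 6 _⊞_
_⊞_ : Point → Point → Point
(x , y) ⊞ (a , b) = x + a , y + b

≡⇒⇔ : ∀ {m n : ℕ} → m ≡ n → (m ≡ 1) ⇔ (n ≡ 1)
≡⇒⇔ refl = mk⇔ id id

shift : Point → Automorphism
shift (a , b) = record
  { f = _⊞ (a , b) ; g = _⊞ (- a , - b)
  ; gf = λ (x , y) → cong₂ _,_ (l₁ x a) (l₁ y b)
  ; fg = λ (x , y) → cong₂ _,_ (l₂ x a) (l₂ y b)
  ; adj = λ (x , y) (x′ , y′) → ≡⇒⇔ (cong₂ (λ s t → ∣ s ∣ ℕ.+ ∣ t ∣) (l₃ x x′ a) (l₃ y y′ b)) }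
  where
  l₁ : ∀ x a → x + a + - a ≡ x
  l₁ = solve-∀
  l₂ : ∀ x a → x + - a + a ≡ x
  l₂ = solve-∀
  l₃ : ∀ x x′ a → x - x′ ≡ x + a - (x′ + a)
  l₃ = solve-∀

swapA : Automorphism
swapA = record
  { f = λ (x , y) → y , x ; g = λ (x , y) → y , x ; gf = λ _ → refl ; fg = λ _ → refl
  ; adj = λ (x , y) (x′ , y′) → ≡⇒⇔ (ℕP.+-comm ∣ x - x′ ∣ ∣ y - y′ ∣) }

flipA : Automorphism
flipA = record
  { f = λ (x , y) → - x , y ; g = λ (x , y) → - x , y
  ; gf = λ (x , y) → cong (_, y) (ℤP.neg-involutive x) ; fg = λ (x , y) → cong (_, y) (ℤP.neg-involutive x)
  ; adj = λ (x , y) (x′ , y′) → ≡⇒⇔ (cong (ℕ._+ ∣ y - y′ ∣) (trans (sym (ℤP.∣-i∣≡∣i∣ (x - x′))) (cong ∣_∣ (l x x′)))) }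
  where
  l : ∀ x x′ → - (x - x′) ≡ - x - - x′
  l = solve-∀

f-inj : ∀ φ {p q} → f φ p ≡ f φ q → p ≡ q
f-inj φ {p} {q} e = trans (sym (gf φ p)) (trans (cong (g φ) e) (gf φ q))

∈-image⁺ : ∀ φ {A p} → g φ p ∈ A → p ∈ map (f φ) A
∈-image⁺ φ {A} {p} h = subst (_∈ map (f φ) A) (fg φ p) (∈-map⁺ (f φ) h)

∈-image⁻ : ∀ φ {A p} → p ∈ map (f φ) A → g φ p ∈ A
∈-image⁻ φ {A} h with ∈-map⁻ (f φ) h
... | q , q∈ , refl = subst (_∈ A) (sym (gf φ q)) q∈

Nb-image⁺ : ∀ φ {A p} → Nb A (g φ p) → Nb (map (f φ) A) p
Nb-image⁺ φ {A} {p} h with Nb⁻ h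
... | q , q∈n , q∈A = Nb⁺ (∈-map⁺ (f φ) q∈A) (subst (λ t → f φ q ∈ nbrs t) (fg φ p) (aut-nbrs φ q∈n))

Nb-image⁻ : ∀ φ {A p} → Nb (map (f φ) A) p → Nb A (g φ p)
Nb-image⁻ φ {A} {p} h with Nb⁻ h
... | q , q∈n , q∈A = Nb⁺ (∈-image⁻ φ q∈A) (aut-nbrs (inv φ) q∈n)

∂-image⁺ : ∀ φ A {p} → g φ p ∈ boundary A → p ∈ boundary (map (f φ) A)
∂-image⁺ φ A h with ∂⁻ A h
... | p∉ , n = ∂⁺ (p∉ ∘ ∈-image⁻ φ) (Nb-image⁺ φ n)

∂-image⁻ : ∀ φ A {p} → p ∈ boundary (map (f φ) A) → g φ p ∈ boundary A
∂-image⁻ φ A h with ∂⁻ (map (f φ) A) h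
... | p∉ , n = ∂⁺ (p∉ ∘ ∈-image⁺ φ) (Nb-image⁻ φ n)

card-image : ∀ φ A → card (map (f φ) A) ≡ card A
card-image φ = card-map (f-inj φ)

bsize-image : ∀ φ A → bsize (map (f φ) A) ≡ bsize A
bsize-image φ A = trans (card-cong {boundary (map (f φ) A)} (λ h → ∈-image⁺ φ (∂-image⁻ φ A h)) (λ h → ∂-image⁺ φ A (∈-image⁻ φ h)))
  (card-image φ (boundary A))

Minimal-image : ∀ φ A → Minimal A → Minimal (map (f φ) A)
Minimal-image φ A = Minimal-resp A (map (f φ) A) (card-image φ A) (ℕP.≤-reflexive (bsize-image φ A))

-- Adding and removing points

infixr 5 _&_
_&_ : ∀ {P : Point → Set} {p ps} → P p → All P ps → All P (p ∷ ps)
_&_ = All._∷_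

data Absorbs (A M : List Point) (p : Point) : Set where
  in-A : p ∈ A → Absorbs A M p
  by-A : Nb A p → Absorbs A M p
  in-M : p ∈ M → Absorbs A M p

∂-∷-⊆ : ∀ {A w M} → All (Absorbs A M) (nbrs w) → boundary (w ∷ A) ⊆ boundary A ++ M
∂-∷-⊆ {A} {w} {M} a {p} h with ∂⁻ (w ∷ A) h
... | p∉ , n with Nb⁻ n
... | q , q∈n , there q∈A = ∈-++⁺ˡ (∂⁺ (p∉ ∘ there) (Nb⁺ q∈A q∈n))
... | q , q∈n , here refl with All.lookup a (nbrs-sym q∈n)
... | in-A k = ⊥-elim (p∉ (there k))
... | by-A k = ∈-++⁺ˡ (∂⁺ (p∉ ∘ there) k)
... | in-M k = ∈-++⁺ʳ (boundary A) k

add-cost₀ : ∀ A w M → All (Absorbs A M) (nbrs w) → bsize (w ∷ A) ℕ.≤ bsize A ℕ.+ card M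
add-cost₀ A w M a = ℕP.≤-trans (card-mono (∂-∷-⊆ {A} a)) (card-++-≤ (boundary A) M)

-- The saved unit is `w` itself, which was a boundary point of `A` and ceases to be one.
add-cost : ∀ A w M → w ∉ A → Nb A w → All (Absorbs A M) (nbrs w) →
           bsize (w ∷ A) ℕ.+ 1 ℕ.≤ bsize A ℕ.+ card M
add-cost A w M w∉ w∈ a = exchange {boundary (w ∷ A)} {w ∷ []} {boundary A} {M}
  (λ { h (here refl) → proj₁ (∂⁻ (w ∷ A) h) (here refl) })
  (∂-∷-⊆ {A} a) (λ { (here refl) → ∈-++⁺ˡ (∂⁺ w∉ w∈) })

Off : List Point → List Point → Point → Set
Off A J p = All (λ q → q ∉ A ⊎ q ∈ J) (nbrs p)

off⇒¬Nb : ∀ {A J p} → Off A J p → ¬ Nb (A ∖ J) p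
off⇒¬Nb {A} {J} o n with Nb⁻ n
... | q , q∈n , q∈ with ∈-∖⁻ {A} {J} q∈ | All.lookup o q∈n
... | q∈A , q∉J | inj₁ k = k q∈A
... | q∈A , q∉J | inj₂ k = q∉J k

-- A deleted point becomes a boundary point only if one of its neighbours survives; such points are
-- charged to `M`. The points of `lost` had neighbours in `A`, but all of these are deleted.
remove-cost : ∀ A J lost M → All (λ j → j ∈ M ⊎ Off A J j) J →
              All (λ l → l ∉ A × Nb A l × Off A J l) lost →
              bsize (A ∖ J) ℕ.+ card lost ℕ.≤ bsize A ℕ.+ card M
remove-cost A J lost M js ls = exchange {boundary (A ∖ J)} {lost} {boundary A} {M}
  (λ h k → off⇒¬Nb (proj₂ (proj₂ (All.lookup ls k))) (proj₂ (∂⁻ (A ∖ J) h)))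
  sub (λ k → let l∉ , n , _ = All.lookup ls k in ∈-++⁺ˡ (∂⁺ l∉ n))
  where
  sub : boundary (A ∖ J) ⊆ boundary A ++ M
  sub {p} h with ∂⁻ (A ∖ J) h
  ... | p∉ , n with p ∈? A
  ... | no k = ∈-++⁺ˡ (∂⁺ k (Nb-mono (proj₁ ∘ ∈-∖⁻ {A} {J}) n))
  ... | yes k with All.lookup js (decidable-stable (p ∈? J) (λ p∉J → p∉ (∈-∖⁺ k p∉J)))
  ... | inj₁ m = ∈-++⁺ʳ (boundary A) m
  ... | inj₂ o = ⊥-elim (off⇒¬Nb o n)

argmax : (h : Point → ℤ) → ∀ {A p} → p ∈ A → ∃[ q ] q ∈ A × (∀ {r} → r ∈ A → h r ≤ h q)
argmax h {a ∷ []} _ = a , here refl , λ { (here refl) → ≤-refl }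
argmax h {a ∷ b ∷ A} _ with argmax h {b ∷ A} (here refl)
... | q , q∈ , m with h a ℤP.≤? h q
... | yes k = q , there q∈ , λ { (here refl) → k ; (there r) → m r }
... | no k = a , here refl , λ { (here refl) → ≤-refl
                               ; (there r) → ≤-trans (m r) (ℤP.<⇒≤ (ℤP.≰⇒> k)) }

argmin : (h : Point → ℤ) → ∀ {A p} → p ∈ A → ∃[ q ] q ∈ A × (∀ {r} → r ∈ A → h q ≤ h r)
argmin h p∈ with argmax (λ r → - h r) p∈
... | q , q∈ , m = q , q∈ , λ r → ℤP.neg-cancel-≤ (m r)

card-∖-point : ∀ A p → p ∈ A → card (A ∖ (p ∷ [])) ℕ.+ 1 ≡ card A
card-∖-point A p p∈ = card-∖ A (p ∷ []) λ { (here refl) → p∈ }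

-- The neighbour l of p is lost from the boundary and at most p is gained.
peel : ∀ S p l → p ∈ S → l ∈ nbrs p → l ∉ S → (∀ {q} → q ∈ nbrs l → q ∉ S ⊎ q ≡ p) →
       bsize (S ∖ (p ∷ [])) ℕ.≤ bsize S
peel S p l p∈S l∈n l∉S h = ℕP.+-cancelʳ-≤ 1 (bsize (S ∖ (p ∷ []))) (bsize S)
  (remove-cost S (p ∷ []) (l ∷ []) (p ∷ []) (inj₁ (here refl) & All.[])
    ((l∉S , Nb⁺ p∈S (nbrs-sym l∈n) , All.tabulate (λ q → Sum.map₂ here (h q))) & All.[]))

shrink : ∀ S → 1 ℕ.≤ card S → ∃[ p ] p ∈ S × bsize (S ∖ (p ∷ [])) ℕ.≤ bsize S
shrink S c with argmax proj₂ (proj₂ (card-pos⇒∃ S c))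
... | (x , y) , p∈ , m = (x , y) , p∈ , peel S (x , y) (x , y + + 1) p∈ (there (there (here refl)))
        (λ h → i+1≰i (m h)) nb
  where
  nb : ∀ {q} → q ∈ nbrs (x , y + + 1) → q ∉ S ⊎ q ≡ (x , y)
  nb (here refl) = inj₁ λ h → i+1≰i (m h)
  nb (there (here refl)) = inj₁ λ h → i+1≰i (m h)
  nb (there (there (here refl))) = inj₁ λ h → 1≰0 (lin1 1 (m h) (solve (y ∷ [])))
  nb (there (there (there (here refl)))) = inj₂ (cong (x ,_) (sym (+1-1 y)))

trim′ : ∀ n S k → card S ≡ k ℕ.+ n → ∃[ C ] C ⊆ S × card C ≡ k × bsize C ℕ.≤ bsize S
trim′ zero S k e = S , id , trans e (ℕP.+-identityʳ k) , ℕP.≤-refl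
trim′ (suc n) S k e =
  let p , p∈ , b = shrink S (subst (1 ℕ.≤_) (sym (trans e (ℕP.+-suc k n))) (s≤s z≤n))
      C , C⊆ , c , b′ = trim′ n (S ∖ (p ∷ [])) k
        (ℕP.+-cancelʳ-≡ 1 (card (S ∖ (p ∷ []))) (k ℕ.+ n)
          (trans (card-∖-point S p p∈) (trans e (trans (ℕP.+-suc k n) (ℕP.+-comm 1 (k ℕ.+ n))))))
  in C , (λ h → proj₁ (∈-∖⁻ {S} {p ∷ []} (C⊆ h))) , c , ℕP.≤-trans b′ b

trim : ∀ S k → k ℕ.≤ card S → ∃[ C ] C ⊆ S × card C ≡ k × bsize C ℕ.≤ bsize S
trim S k h = trim′ (card S ℕ.∸ k) S k (sym (ℕP.m+[n∸m]≡n h))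

minimal-≤ : ∀ A C → Minimal A → card A ℕ.≤ card C → bsize A ℕ.≤ bsize C
minimal-≤ A C m h with trim C (card A) h
... | C′ , _ , c , b = ℕP.≤-trans (m C′ c) b

minimal-∷ : ∀ A p → Minimal A → p ∉ A → bsize (p ∷ A) ℕ.≤ bsize A → Minimal (p ∷ A)
minimal-∷ A p m p∉ b C c = ℕP.≤-trans b
  (minimal-≤ A C m (subst (card A ℕ.≤_) (sym (trans c (card-∷ A p p∉))) (ℕP.n≤1+n _)))

-- Adding points at small cost

LexTop : List Point → Set
LexTop D = (+ 0 , + 0) ∈ D × (∀ {x y} → (x , y) ∈ D → y ≤ + 0) × (∀ {x} → (x , + 0) ∈ D → x ≤ + 0)

recentre : ∀ A p → ∃[ A′ ] card A′ ≡ card A × bsize A′ ≡ bsize A × (∀ {q} → q ∈ A′ → q ⊞ p ∈ A) × (∀ {q} → q ⊞ p ∈ A → q ∈ A′)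
recentre A p = map (f φ) A , card-image φ A , bsize-image φ A , ∈-image⁻ φ , ∈-image⁺ φ
  where φ = inv (shift p)

0⊞ : ∀ p → p ≡ (+ 0 , + 0) ⊞ p
0⊞ (x , y) = cong₂ _,_ (sym (ℤP.+-identityˡ x)) (sym (ℤP.+-identityˡ y))

lexMax : ∀ {A p} → p ∈ A → ∃[ c ] ∃[ d ] (c , d) ∈ A × (∀ {x y} → (x , y) ∈ A → y ≤ d) × (∀ {x} → (x , d) ∈ A → x ≤ c)
lexMax {A} p∈A with argmax proj₂ p∈A
... | (a , b) , ab∈A , m with argmax proj₁ (∈-filter⁺ (λ r → proj₂ r ℤP.≟ b) ab∈A refl)
... | (c , d) , cd∈ , m′ with ∈-filter⁻ (λ r → proj₂ r ℤP.≟ b) {xs = A} cd∈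
... | cd∈A , refl = c , d , cd∈A , m , λ h → m′ (∈-filter⁺ (λ r → proj₂ r ℤP.≟ b) h refl)

-- With the rightmost point of the top row at the origin, the moves below take place at fixed
-- numerical coordinates.
lexTop : ∀ A {p} → p ∈ A → ∃[ A′ ] card A′ ≡ card A × bsize A′ ≡ bsize A × LexTop A′
lexTop A p∈A =
  let c , d , cd∈A , m , m′ = lexMax p∈A
      A′ , e , e′ , to , from = recentre A (c , d)
  in A′ , e , e′ , from (subst (_∈ A) (0⊞ (c , d)) cd∈A)
     , (λ {x} {y} h → lin1 0 (m (to h)) (l y d))
     , (λ {x} h → lin1 0 (m′ (subst (λ t → (x + c , t) ∈ A) (ℤP.+-identityˡ d) (to h))) (l x c))
  where
  l : ∀ y d → + 0 - y ≡ d - (y + d) + + 0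
  l = solve-∀

≤+1 : ∀ a b → a ℕ.+ 1 ℕ.≤ b ℕ.+ 2 → a ℕ.≤ 1 ℕ.+ b
≤+1 a b h rewrite ℕP.+-comm a 1 | ℕP.+-comm b 2 = ℕ.s≤s⁻¹ h

module _ {D : List Point} (t : LexTop D) where

  private
    o∈ = proj₁ t
    top : ∀ {x y} → (x , y) ∈ D → y ≤ + 0
    top = proj₁ (proj₂ t)
    right : ∀ {x} → (x , + 0) ∈ D → x ≤ + 0
    right = proj₂ (proj₂ t)

  [0,1]∉ : (+ 0 , + 1) ∉ D
  [0,1]∉ h = 1≰0 (top h)

  [1,0]∉ : (+ 1 , + 0) ∉ D
  [1,0]∉ h = 1≰0 (right h)

  [1,1]∉ : (+ 1 , + 1) ∉ D
  [1,1]∉ h = 1≰0 (top h)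

  [-1,1]∉ : (-[1+ 0 ] , + 1) ∉ D
  [-1,1]∉ h = 1≰0 (top h)

  [2,0]∉ : (+ 2 , + 0) ∉ D
  [2,0]∉ h with right h
  ... | +≤+ ()

  [0,2]∉ : (+ 0 , + 2) ∉ D
  [0,2]∉ h with top h
  ... | +≤+ ()

  -- (0,1) brings at most three new boundary points and is itself lost from the boundary, a cost of
  -- 2. Then (1,0) shares the neighbour (1,1) with it, brings at most two and is lost, a cost of 1.
  grow2-lex : ∃[ D′ ] card D′ ≡ 2 ℕ.+ card D × bsize D′ ℕ.≤ 3 ℕ.+ bsize D
  grow2-lex = w₂ ∷ w₁ ∷ D
    , trans (card-∷ (w₁ ∷ D) w₂ (λ { (there h) → [1,0]∉ h })) (cong suc (card-∷ D w₁ [0,1]∉))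
    , arith (bsize (w₂ ∷ w₁ ∷ D)) (bsize (w₁ ∷ D)) (bsize D) s₁ s₂
    where
    arith : ∀ a b c → b ℕ.+ 1 ℕ.≤ c ℕ.+ 3 → a ℕ.+ 1 ℕ.≤ b ℕ.+ 2 → a ℕ.≤ 3 ℕ.+ c
    arith a b c h k rewrite ℕP.+-comm b 1 | ℕP.+-comm c 3 | ℕP.+-comm a 1 | ℕP.+-comm b 2 =
      ℕP.≤-trans (ℕ.s≤s⁻¹ k) h
    w₁ w₂ : Point
    w₁ = + 0 , + 1
    w₂ = + 1 , + 0
    s₁ : bsize (w₁ ∷ D) ℕ.+ 1 ℕ.≤ bsize D ℕ.+ 3
    s₁ = add-cost D w₁ ((+ 1 , + 1) ∷ (-[1+ 0 ] , + 1) ∷ (+ 0 , + 2) ∷ []) [0,1]∉ (there (there (there (here o∈))))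
      (in-M (here refl) & in-M (there (here refl)) & in-M (there (there (here refl))) & in-A o∈ & All.[])
    s₂ : bsize (w₂ ∷ w₁ ∷ D) ℕ.+ 1 ℕ.≤ bsize (w₁ ∷ D) ℕ.+ 2
    s₂ = add-cost (w₁ ∷ D) w₂ ((+ 2 , + 0) ∷ (+ 1 , -[1+ 0 ]) ∷ []) (λ { (there h) → [1,0]∉ h }) (there (here (there o∈)))
      (in-M (here refl) & in-A (there o∈) & by-A (there (here (here refl))) & in-M (there (here refl)) & All.[])

  growRight : Nb D (+ 1 , -[1+ 0 ]) ⊎ (+ 1 , -[1+ 0 ]) ∈ D → ∃[ D′ ] card D′ ≡ 1 ℕ.+ card D × bsize D′ ℕ.≤ 1 ℕ.+ bsize D
  growRight h = (+ 1 , + 0) ∷ D , card-∷ D (+ 1 , + 0) [1,0]∉ , ≤+1 (bsize ((+ 1 , + 0) ∷ D)) (bsize D)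
    (add-cost D (+ 1 , + 0) ((+ 1 , + 1) ∷ (+ 2 , + 0) ∷ []) [1,0]∉ (there (here o∈))
      (in-M (there (here refl)) & in-A o∈ & in-M (here refl) & [ by-A , in-A ]′ h & All.[]))

  growUp : (-[1+ 0 ] , + 0) ∈ D → ∃[ D′ ] card D′ ≡ 1 ℕ.+ card D × bsize D′ ℕ.≤ 1 ℕ.+ bsize D
  growUp h = (+ 0 , + 1) ∷ D , card-∷ D (+ 0 , + 1) [0,1]∉ , ≤+1 (bsize ((+ 0 , + 1) ∷ D)) (bsize D)
    (add-cost D (+ 0 , + 1) ((+ 1 , + 1) ∷ (+ 0 , + 2) ∷ []) [0,1]∉ (there (there (there (here o∈))))
      (in-M (here refl) & by-A (there (there (there (here h)))) & in-M (there (here refl)) & in-A o∈ & All.[]))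

  -- The hypotheses leave the origin without neighbours in `D`, so deleting it creates no boundary
  -- point; (0,1) and (1,0) have the origin as their only neighbour in `D` and are lost.
  isolated-top : (+ 1 , -[1+ 0 ]) ∉ D → (+ 0 , -[1+ 0 ]) ∉ D → (-[1+ 0 ] , + 0) ∉ D →
                 bsize (D ∖ ((+ 0 , + 0) ∷ [])) ℕ.+ 2 ℕ.≤ bsize D
  isolated-top n₁ n₂ n₃ = subst (bsize (D ∖ ((+ 0 , + 0) ∷ [])) ℕ.+ 2 ℕ.≤_) (ℕP.+-identityʳ (bsize D))
    (remove-cost D ((+ 0 , + 0) ∷ []) ((+ 0 , + 1) ∷ (+ 1 , + 0) ∷ []) []
      (inj₂ (inj₁ [1,0]∉ & inj₁ n₃ & inj₁ [0,1]∉ & inj₁ n₂ & All.[]) & All.[])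
      (([0,1]∉ , there (there (there (here o∈))) , inj₁ [1,1]∉ & inj₁ [-1,1]∉ & inj₁ [0,2]∉ & inj₂ (here refl) & All.[])
      & ([1,0]∉ , there (here o∈) , inj₁ [2,0]∉ & inj₂ (here refl) & inj₁ [1,1]∉ & inj₁ n₁ & All.[]) & All.[]))

grow2 : ∀ D → 1 ℕ.≤ card D → ∃[ D′ ] card D′ ≡ 2 ℕ.+ card D × bsize D′ ℕ.≤ 3 ℕ.+ bsize D
grow2 D c =
  let A , e , e′ , t = lexTop D (proj₂ (card-pos⇒∃ D c))
      D′ , c′ , b = grow2-lex {A} t
  in D′ , trans c′ (cong (2 ℕ.+_) e) , ℕP.≤-trans b (ℕP.≤-reflexive (cong (3 ℕ.+_) e′))

-- If one of the three tested points is present, adding a suitable neighbour of the origin costs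
-- only 1. Otherwise the origin is deleted, saving 2, and two points are added at cost 3. Two points
-- are assumed so that something remains after the deletion.
grow-lex : ∀ {D} → LexTop D → 2 ℕ.≤ card D → ∃[ D′ ] card D′ ≡ 1 ℕ.+ card D × bsize D′ ℕ.≤ 1 ℕ.+ bsize D
grow-lex {D} t@(o∈ , _) c with (+ 1 , -[1+ 0 ]) ∈? D | (+ 0 , -[1+ 0 ]) ∈? D | (-[1+ 0 ] , + 0) ∈? D
... | yes h | _ | _ = growRight t (inj₂ h)
... | no _ | yes h | _ = growRight t (inj₁ (there (here h)))
... | no _ | no _ | yes h = growUp t h
... | no n₁ | no n₂ | no n₃ = fin
  where
  D₁ = D ∖ ((+ 0 , + 0) ∷ [])
  fin : ∃[ D′ ] card D′ ≡ 1 ℕ.+ card D × bsize D′ ℕ.≤ 1 ℕ.+ bsize D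
  fin =
    let D′ , c′ , b = grow2 D₁ (ℕP.+-cancelʳ-≤ 1 1 (card D₁) (subst (2 ℕ.≤_) (sym (card-∖-point D (+ 0 , + 0) o∈)) c))
    in D′ , trans c′ (cong suc (trans (ℕP.+-comm 1 (card D₁)) (card-∖-point D (+ 0 , + 0) o∈)))
     , ℕP.≤-trans b (ℕP.≤-trans (ℕP.≤-reflexive (cong suc (ℕP.+-comm 2 (bsize D₁)))) (s≤s (isolated-top {D} t n₁ n₂ n₃)))

grow : ∀ D → 2 ℕ.≤ card D → ∃[ D′ ] card D′ ≡ 1 ℕ.+ card D × bsize D′ ℕ.≤ 1 ℕ.+ bsize D
grow D c =
  let A , e , e′ , t = lexTop D (proj₂ (card-pos⇒∃ D (ℕP.≤-trans (s≤s z≤n) c)))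
      D′ , c′ , b = grow-lex {A} t (subst (2 ℕ.≤_) (sym e) c)
  in D′ , trans c′ (cong suc e) , ℕP.≤-trans b (ℕP.≤-reflexive (cong suc e′))

grow* : ∀ n D → 2 ℕ.≤ card D → ∃[ D′ ] card D′ ≡ n ℕ.+ card D × bsize D′ ℕ.≤ n ℕ.+ bsize D
grow* zero D c = D , refl , ℕP.≤-refl
grow* (suc n) D c =
  let D₁ , c₁ , b₁ = grow* n D c
      D₂ , c₂ , b₂ = grow D₁ (subst (2 ℕ.≤_) (sym c₁) (ℕP.≤-trans c (ℕP.m≤n+m (card D) n)))
  in D₂ , trans c₂ (cong suc c₁) , ℕP.≤-trans b₂ (s≤s b₁)

-- The deleted points can be regrown elsewhere at cost at most 1 each, which gives a competitor of
-- the same cardinality.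
minimal-∖ : ∀ A J → Minimal A → J ⊆ A → 2 ℕ.≤ card (A ∖ J) → bsize A ℕ.≤ card J ℕ.+ bsize (A ∖ J)
minimal-∖ A J m J⊆A c =
  let D , c′ , b = grow* (card J) (A ∖ J) c
  in ℕP.≤-trans (m D (trans c′ (trans (ℕP.+-comm (card J) (card (A ∖ J))) (card-∖ A J J⊆A)))) b

-- Diagonal coordinates and the boundary of a set meeting every diagonal

ℤ-cancelˡ : ∀ c x y → c + x ≡ c + y → x ≡ y
ℤ-cancelˡ c x y e = trans (l c x) (trans (cong (λ t → - c + t) e) (sym (l c y)))
  where
  l : ∀ c x → x ≡ - c + (c + x)
  l = solve-∀

ℤ-cancelʳ : ∀ c x y → x + c ≡ y + c → x ≡ y
ℤ-cancelʳ c x y e = ℤ-cancelˡ c x y (trans (ℤP.+-comm c x) (trans e (ℤP.+-comm y c)))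

U V : Point → ℤ
U (x , y) = y - x
V (x , y) = y + x

up dn lf rt : Point → Point
up (x , y) = x , y + + 1
dn (x , y) = x , y - + 1
lf (x , y) = x - + 1 , y
rt (x , y) = x + + 1 , y

up-dn : ∀ p → up (dn p) ≡ p
up-dn (x , y) = cong (x ,_) (sym (-1+1 y))

dn-up : ∀ p → dn (up p) ≡ p
dn-up (x , y) = cong (x ,_) (sym (+1-1 y))

up-inj : ∀ {p q} → up p ≡ up q → p ≡ q
up-inj {p} {q} e = trans (sym (dn-up p)) (trans (cong dn e) (dn-up q))

lf-rt : ∀ p → lf (rt p) ≡ p
lf-rt (x , y) = cong (_, y) (sym (+1-1 x))

rt-lf : ∀ p → rt (lf p) ≡ p
rt-lf (x , y) = cong (_, y) (sym (-1+1 x))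

U-up : ∀ p → U (up p) ≡ U p + + 1
U-up (x , y) = l x y
  where
  l : ∀ x y → y + + 1 - x ≡ y - x + + 1
  l = solve-∀

V-up : ∀ p → V (up p) ≡ V p + + 1
V-up (x , y) = l x y
  where
  l : ∀ x y → y + + 1 + x ≡ y + x + + 1
  l = solve-∀

U-dn : ∀ p → U (dn p) ≡ U p - + 1
U-dn (x , y) = l x y
  where
  l : ∀ x y → y - + 1 - x ≡ y - x - + 1
  l = solve-∀

V-dn : ∀ p → V (dn p) ≡ V p - + 1
V-dn (x , y) = l x y
  where
  l : ∀ x y → y - + 1 + x ≡ y + x - + 1
  l = solve-∀

U-lf : ∀ p → U (lf p) ≡ U p + + 1
U-lf (x , y) = l x y
  where
  l : ∀ x y → y - (x - + 1) ≡ y - x + + 1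
  l = solve-∀

V-lf : ∀ p → V (lf p) ≡ V p - + 1
V-lf (x , y) = l x y
  where
  l : ∀ x y → y + (x - + 1) ≡ y + x - + 1
  l = solve-∀

U-rt : ∀ p → U (rt p) ≡ U p - + 1
U-rt (x , y) = l x y
  where
  l : ∀ x y → y - (x + + 1) ≡ y - x - + 1
  l = solve-∀

V-rt : ∀ p → V (rt p) ≡ V p + + 1
V-rt (x , y) = l x y
  where
  l : ∀ x y → y + (x + + 1) ≡ y + x + + 1
  l = solve-∀

-1≤+1 : ∀ {i j} → j ≡ i - + 1 → j ≤ i + + 1
-1≤+1 {i} refl = lin0 2 (solve (i ∷ []))

nbU≤ : ∀ {p q} → q ∈ nbrs p → U q ≤ U p + + 1
nbU≤ {p} (here refl) = -1≤+1 {U p} (U-rt p)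
nbU≤ {p} (there (here refl)) = ≤-reflexive (U-lf p)
nbU≤ {p} (there (there (here refl))) = ≤-reflexive (U-up p)
nbU≤ {p} (there (there (there (here refl)))) = -1≤+1 {U p} (U-dn p)

nbV≤ : ∀ {p q} → q ∈ nbrs p → V q ≤ V p + + 1
nbV≤ {p} (here refl) = ≤-reflexive (V-rt p)
nbV≤ {p} (there (here refl)) = -1≤+1 {V p} (V-lf p)
nbV≤ {p} (there (there (here refl))) = ≤-reflexive (V-up p)
nbV≤ {p} (there (there (there (here refl)))) = -1≤+1 {V p} (V-dn p)

Nb-up : ∀ {A p} → p ∈ A → Nb A (up p)
Nb-up {A} {p} h = Nb⁺ h (there (there (there (here (sym (dn-up p))))))
Nb-dn : ∀ {A p} → p ∈ A → Nb A (dn p)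
Nb-dn {A} {p} h = Nb⁺ h (there (there (here (sym (up-dn p)))))
Nb-lf : ∀ {A p} → p ∈ A → Nb A (lf p)
Nb-lf {A} {p} h = Nb⁺ h (here (sym (rt-lf p)))
Nb-rt : ∀ {A p} → p ∈ A → Nb A (rt p)
Nb-rt {A} {p} h = Nb⁺ h (there (here (sym (lf-rt p))))

Nb⇒∈ : ∀ {A p} → Nb A p → p ∈ A ++ boundary A
Nb⇒∈ {A} {p} n with p ∈? A
... | yes h = ∈-++⁺ˡ h
... | no h = ∈-++⁺ʳ A (∂⁺ h n)

card-closure : ∀ A → card (A ++ boundary A) ≡ card A ℕ.+ bsize A
card-closure A = card-disjoint A (boundary A) λ h k → proj₁ (∂⁻ A k) h

double≡ : ∀ d → d + d ≤ + 1 → - (d + d) ≤ + 1 → d ≡ + 0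
double≡ (+ zero) _ _ = refl
double≡ (+ (suc n)) (+≤+ (s≤s h)) _ with subst (ℕ._≤ 0) (ℕP.+-suc n n) h
... | ()
double≡ -[1+ n ] _ (+≤+ (s≤s ()))

-- U and V agree modulo 2, so U is determined by V up to steps of 2.
parity-UV : ∀ p q → V p ≡ V q → U p ≤ U q + + 1 → U q ≤ U p + + 1 → p ≡ q
parity-UV (x , y) (x′ , y′) e h h′ = cong₂ _,_ (ex x x′ y y′ e d0) (ey y y′ d0)
  where
  l : ∀ x x′ y y′ → (y - x) - (y′ - x′) ≡ (y - y′) + (y - y′) + ((y′ + x′) - (y + x))
  l = solve-∀
  two : (y - x) - (y′ - x′) ≡ (y - y′) + (y - y′)
  two = trans (l x x′ y y′) (trans (cong (λ t → (y - y′) + (y - y′) + t) (trans (cong (_- (y + x)) (sym e)) (x-x (y + x)))) (ℤP.+-identityʳ _))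
  k₁ : ∀ u u′ → + 1 - (u - u′) ≡ (u′ + + 1) - u + + 0
  k₁ = solve-∀
  k₂ : ∀ u u′ → + 1 - - (u - u′) ≡ (u + + 1) - u′ + + 0
  k₂ = solve-∀
  d0 : y - y′ ≡ + 0
  d0 = double≡ (y - y′)
    (subst (_≤ + 1) two (lin1 0 h (k₁ (y - x) (y′ - x′))))
    (subst (λ t → - t ≤ + 1) two (lin1 0 h′ (k₂ (y - x) (y′ - x′))))
  ey : ∀ y y′ → y - y′ ≡ + 0 → y ≡ y′
  ey y y′ = ℤP.i-j≡0⇒i≡j y y′
  ex : ∀ x x′ y y′ → y + x ≡ y′ + x′ → y - y′ ≡ + 0 → x ≡ x′
  ex x x′ y y′ e k with ℤP.i-j≡0⇒i≡j y y′ k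
  ... | refl = ℤ-cancelˡ y x x′ e

swapUV : Point → Point
swapUV (x , y) = - x , y

U-swap : ∀ p → U (swapUV p) ≡ V p
U-swap (x , y) = cong (λ t → y + t) (ℤP.neg-involutive x)
V-swap : ∀ p → V (swapUV p) ≡ U p
V-swap (x , y) = refl

parity-VU : ∀ p q → U p ≡ U q → V p ≤ V q + + 1 → V q ≤ V p + + 1 → p ≡ q
parity-VU p q e h h′ = f-inj flipA (parity-UV (swapUV p) (swapUV q)
  (trans (V-swap p) (trans e (sym (V-swap q))))
  (subst₂ (λ s t → s ≤ t + + 1) (sym (U-swap p)) (sym (U-swap q)) h)
  (subst₂ (λ s t → s ≤ t + + 1) (sym (U-swap q)) (sym (U-swap p)) h′))

UV-inj : ∀ p q → U p ≡ U q → V p ≡ V q → p ≡ q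
UV-inj p q e e′ = parity-UV p q e′ (lin0 1 (k e)) (lin0 1 (k (sym e)))
  where
  k : ∀ {i j} → i ≡ j → j + + 1 - i ≡ + 1
  k {i} refl = solve (i ∷ [])

pick : (Φ : ℕ → Point → Set) → (∀ {j j′ p} → Φ j p → Φ j′ p → j ≡ j′) → ∀ n →
       (∀ j → j ℕ.< n → ∃[ p ] Φ j p) → ∃[ L ] card L ≡ n × (∀ {p} → p ∈ L → ∃[ j ] j ℕ.< n × Φ j p)
pick Φ inj zero h = [] , refl , λ ()
pick Φ inj (suc n) h =
  let L , c , g = pick Φ inj n (λ j k → h j (ℕP.m<n⇒m<1+n k))
      p , φ = h n ℕP.≤-refl
      p∉ : p ∉ L
      p∉ k = let j , j<n , φ′ = g k in ℕP.<-irrefl (inj φ′ φ) j<n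
  in p ∷ L , trans (card-∷ L p p∉) (cong suc c)
     , λ { (here refl) → n , ℕP.≤-refl , φ
         ; (there k) → let j , j<n , φ′ = g k in j , ℕP.m<n⇒m<1+n j<n , φ′ }

pigeonhole : (h : Point → ℤ) → ∀ n lo X → (∀ {p} → p ∈ X → lo ≤ h p × h p + + 1 ≤ lo + + n) →
             (∀ {p q} → p ∈ X → q ∈ X → h p ≡ h q → p ≡ q) → card X ℕ.≤ n
pigeonhole h zero lo [] r inj = z≤n
pigeonhole h zero lo (p ∷ X) r inj with r (here refl)
... | h₁ , h₂ = ⊥-elim (absurd (h p) h₁ h₂)
  where
  absurd : ∀ u → lo ≤ u → u + + 1 ≤ lo + + 0 → ⊥
  absurd u h₁ h₂ = 1≰0 (lin2 0 h₁ h₂ (solve (u ∷ lo ∷ [])))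
pigeonhole h (suc n) lo X r inj =
  ℕP.≤-trans (card-mono {X} {F₁ ++ F₂} split) (ℕP.≤-trans (card-++-≤ F₁ F₂)
    (subst (card F₁ ℕ.+ card F₂ ℕ.≤_) (ℕP.+-comm n 1) (ℕP.+-mono-≤ c₁ c₂)))
  where
  top : ℤ
  top = lo + + n
  F₁ F₂ : List Point
  F₁ = filter (λ p → h p + + 1 ℤP.≤? top) X
  F₂ = filter (λ p → h p ℤP.≟ top) X
  split : X ⊆ F₁ ++ F₂
  split {p} p∈ with h p + + 1 ℤP.≤? top
  ... | yes k = ∈-++⁺ˡ (∈-filter⁺ (λ p → h p + + 1 ℤP.≤? top) p∈ k)
  ... | no k = ∈-++⁺ʳ F₁ (∈-filter⁺ (λ p → h p ℤP.≟ top) p∈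
        (ℤP.≤-antisym (sub (h p) (proj₂ (r p∈))) (sub′ (h p) (≰⇒+1≤ k))))
    where
    sub : ∀ u → u + + 1 ≤ lo + + (suc n) → u ≤ top
    sub u k = lin1 0 k (l u lo (+ n))
      where
      l : ∀ u lo n → lo + n - u ≡ lo + (+ 1 + n) - (u + + 1) + + 0
      l = solve-∀
    sub′ : ∀ u → top + + 1 ≤ u + + 1 → top ≤ u
    sub′ u k = lin1 0 k (l u top)
      where
      l : ∀ u t → u - t ≡ u + + 1 - (t + + 1) + + 0
      l = solve-∀
  c₁ : card F₁ ℕ.≤ n
  c₁ = pigeonhole h n lo F₁
    (λ k → let k₁ , k₂ = ∈-filter⁻ (λ p → h p + + 1 ℤP.≤? top) {xs = X} k in proj₁ (r k₁) , k₂)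
    (λ k k′ → inj (proj₁ (∈-filter⁻ (λ p → h p + + 1 ℤP.≤? top) {xs = X} k))
                  (proj₁ (∈-filter⁻ (λ p → h p + + 1 ℤP.≤? top) {xs = X} k′)))
  one : ∀ {p} → p ∈ F₂ → F₂ ⊆ p ∷ []
  one {p} k k′ = let a , b = ∈-filter⁻ (λ p → h p ℤP.≟ top) {xs = X} k
                     a′ , b′ = ∈-filter⁻ (λ p → h p ℤP.≟ top) {xs = X} k′
                 in here (inj a′ a (trans b′ (sym b)))
  c₂ : card F₂ ℕ.≤ 1
  c₂ = c₂′ F₂ refl
    where
    c₂′ : ∀ Y → Y ≡ F₂ → card Y ℕ.≤ 1
    c₂′ [] _ = z≤n
    c₂′ (p ∷ Y) e = subst (λ Z → card Z ℕ.≤ 1) (sym e) (card-mono {F₂} {p ∷ []} (one (subst (p ∈_) e (here refl))))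

IsBot : List Point → Point → Set
IsBot A r = r ∈ A × (∀ {t} → t ∈ A → U t ≡ U r → V r ≤ V t)

IsLeft : List Point → Point → Set
IsLeft A e = Nb A e × (∀ {t} → Nb A t → V t ≡ V e → U e ≤ U t)

-- A point of `A` or of its boundary outside the three families of the count below; each one raises
-- the lower bound by 1.
record Extra (A : List Point) (x : Point) : Set where
  constructor mkExtra
  field
    near    : x ∈ A ⊎ Nb A x
    not-up  : ∀ {r} → r ∈ A → ¬ (up r ≡ x)
    not-bot : ∀ {r} → IsBot A r → ¬ (lf r ≡ x)
    not-lft : ¬ IsLeft A x

Columns : List Point → ℤ → ℕ → Set
Columns A a P = ∀ j → j ℕ.≤ P → ∃[ r ] r ∈ A × U r ≡ a + + j

Rows : List Point → ℤ → ℕ → Set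
Rows A c Q = ∀ j → j ℕ.≤ Q → ∃[ r ] r ∈ A × V r ≡ c + + j

minOn : (k h : Point → ℤ) → ∀ {A p} → p ∈ A → ∃[ q ] q ∈ A × k q ≡ k p × (∀ {t} → t ∈ A → k t ≡ k q → h q ≤ h t)
minOn k h {A} {p} p∈ =
  let q , q∈ , m = argmin h (∈-filter⁺ (λ t → k t ℤP.≟ k p) p∈ refl)
      q∈A , e = ∈-filter⁻ (λ t → k t ℤP.≟ k p) {xs = A} q∈
  in q , q∈A , e , λ t∈ e′ → m (∈-filter⁺ (λ t → k t ℤP.≟ k p) t∈ (trans e′ e))

-- N(A) contains the translate of A by (0,1), a left neighbour of the lowest point of each diagonal
-- U = const, and the point with least U on each diagonal V = const of N(A); these are all different.
module _ (A : List Point) (a c : ℤ) (P Q : ℕ) (cols : Columns A a P) (rows : Rows A c Q) (1≤Q : 1 ℕ.≤ Q) where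

  private
    offset-inj : ∀ c {j j′ : ℕ} {t} → t ≡ c + + j → t ≡ c + + j′ → j ≡ j′
    offset-inj c e e′ = ℤP.+-injective (ℤ-cancelˡ c _ _ (trans (sym e) e′))

    bots : ∃[ L ] card L ≡ suc P × (∀ {r} → r ∈ L → ∃[ j ] j ℕ.< suc P × (IsBot A r × U r ≡ a + + j))
    bots = pick (λ j r → IsBot A r × U r ≡ a + + j) (λ (_ , e) (_ , e′) → offset-inj a e e′) (suc P)
      λ j j<P → let r , r∈ , e = cols j (ℕ.s≤s⁻¹ j<P)
                    q , q∈ , e′ , m = minOn U V r∈
                in q , (q∈ , m) , trans e′ e

    -- The values V = c - 1, ..., c + Q - 1 are reached downwards from the rows of `A`. The last
    -- two, c + Q and c + Q + 1, are reached upwards from rows Q - 1 and Q; with Q = 0 nothing would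
    -- give V = c.
    someRow : ∀ j → j ℕ.< 3 ℕ.+ Q → ∃[ e ] Nb A e × V e ≡ c - + 1 + + j
    someRow j h with j ℕP.≤? Q
    ... | yes k = let r , r∈ , e = rows j k in dn r , Nb-dn r∈ , trans (V-dn r) (trans (cong (_- + 1) e) (l c (+ j)))
      where
      l : ∀ c j → c + j - + 1 ≡ c - + 1 + j
      l = solve-∀
    someRow zero h | no k = ⊥-elim (k z≤n)
    someRow (suc zero) h | no k = ⊥-elim (k 1≤Q)
    someRow (suc (suc j)) (s≤s (s≤s h)) | no k =
      let r , r∈ , e = rows j (ℕ.s≤s⁻¹ h) in up r , Nb-up r∈ , trans (V-up r) (trans (cong (_+ + 1) e) (l c (+ j)))
      where
      l : ∀ c j → c + j + + 1 ≡ c - + 1 + (+ 2 + j)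
      l = solve-∀

    lefts : ∃[ L ] card L ≡ 3 ℕ.+ Q × (∀ {e} → e ∈ L → ∃[ j ] j ℕ.< 3 ℕ.+ Q × (IsLeft A e × V e ≡ c - + 1 + + j))
    lefts = pick (λ j e → IsLeft A e × V e ≡ c - + 1 + + j) (λ (_ , e) (_ , e′) → offset-inj (c - + 1) e e′) (3 ℕ.+ Q)
      λ j j<Q → let r , n , e = someRow j j<Q
                    q , q∈ , e′ , m = minOn V U (∈-N⁺ n)
                in q , (∈-N⁻ q∈ , λ t → m (∈-N⁺ t)) , trans e′ e

    u+1≰u-1 : ∀ {u u′ v} → u′ ≡ u + + 1 → v ≡ u - + 1 → ¬ (u′ ≤ v)
    u+1≰u-1 {u} refl refl h = 1≰0 (lin1 1 h (solve (u ∷ [])))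

    up≢left : ∀ {s e} → s ∈ A → IsLeft A e → ¬ (up s ≡ e)
    up≢left {s} s∈ (_ , m) refl = u+1≰u-1 {U s} (U-up s) (U-rt s) (m (Nb-rt s∈) (trans (V-rt s) (sym (V-up s))))

    lf≢left : ∀ {s e} → s ∈ A → IsLeft A e → ¬ (lf s ≡ e)
    lf≢left {s} s∈ (_ , m) refl = u+1≰u-1 {U s} (U-lf s) (U-dn s) (m (Nb-dn s∈) (trans (V-dn s) (sym (V-lf s))))

    up≢bot : ∀ {s r} → s ∈ A → IsBot A r → ¬ (up s ≡ lf r)
    up≢bot {s} {r} s∈ (_ , m) e = absurd (U-up s) (U-lf r) (V-up s) (V-lf r) (cong U e) (cong V e) (m s∈)
      where
      absurd : ∀ {u u′ v v′ us ur vs vr} → u ≡ us + + 1 → u′ ≡ ur + + 1 → v ≡ vs + + 1 → v′ ≡ vr - + 1 →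
               u ≡ u′ → v ≡ v′ → (us ≡ ur → vr ≤ vs) → ⊥
      absurd {us = us} {ur} {vs} {vr} refl refl refl refl eu ev m = 1≰0 (lin1 1 (m (ℤ-cancelʳ (+ 1) us ur eu)) k)
        where
        k : + 0 - + 1 ≡ vs - vr + + 1
        k = sym (trans (l vs vr) (trans (cong (λ t → t - (vr - + 1) + (-[1+ 0 ])) ev) (l′ vr)))
          where
          l : ∀ s r → s - r + + 1 ≡ s + + 1 - (r - + 1) + (-[1+ 0 ])
          l = solve-∀
          l′ : ∀ r → (r - + 1) - (r - + 1) + (-[1+ 0 ]) ≡ + 0 - + 1
          l′ = solve-∀

  boundary-count : ∀ X → (∀ {x} → x ∈ X → Extra A x) → suc P ℕ.+ (3 ℕ.+ Q ℕ.+ card X) ℕ.≤ bsize A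
  boundary-count X ex = ℕP.+-cancelˡ-≤ (card A) _ _ (subst₂ ℕ._≤_ total (card-closure A) (card-mono {P₁ ++ (P₂ ++ (P₃ ++ X))} sub))
    where
    open Extra
    P₁ P₂ P₃ : List Point
    P₁ = map up A
    P₂ = map lf (proj₁ bots)
    P₃ = proj₁ lefts
    bot : ∀ {p} → p ∈ P₂ → ∃[ r ] IsBot A r × p ≡ lf r
    bot k = let r , r∈ , e = ∈-map⁻ lf k
                _ , _ , b , _ = proj₂ (proj₂ bots) r∈
            in r , b , e
    lft : ∀ {p} → p ∈ P₃ → IsLeft A p
    lft k = let _ , _ , b , _ = proj₂ (proj₂ lefts) k in b
    d₃ : Disjoint P₃ X
    d₃ k x = not-lft (ex x) (lft k)
    d₂ : Disjoint P₂ (P₃ ++ X)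
    d₂ k k′ = let r , b , e = bot k in
      ∈-++-elim P₃ (λ l → lf≢left (proj₁ b) (lft l) (sym e)) (λ x → not-bot (ex x) b (sym e)) k′
    d₁ : Disjoint P₁ (P₂ ++ (P₃ ++ X))
    d₁ k k′ = let s , s∈ , e = ∈-map⁻ up k in
      ∈-++-elim P₂ (λ l → let r , b , e′ = bot l in up≢bot s∈ b (trans (sym e) e′))
        (∈-++-elim P₃ (λ l → up≢left s∈ (lft l) (sym e)) (λ x → not-up (ex x) s∈ (sym e))) k′
    lf-inj : ∀ {p q} → lf p ≡ lf q → p ≡ q
    lf-inj {p} {q} e = trans (sym (rt-lf p)) (trans (cong rt e) (rt-lf q))
    total : card (P₁ ++ (P₂ ++ (P₃ ++ X))) ≡ card A ℕ.+ (suc P ℕ.+ (3 ℕ.+ Q ℕ.+ card X))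
    total = trans (card-disjoint P₁ (P₂ ++ (P₃ ++ X)) d₁) (cong₂ ℕ._+_ (card-map up-inj A)
      (trans (card-disjoint P₂ (P₃ ++ X) d₂) (cong₂ ℕ._+_ (trans (card-map lf-inj (proj₁ bots)) (proj₁ (proj₂ bots)))
        (trans (card-disjoint P₃ X d₃) (cong (ℕ._+ card X) (proj₁ (proj₂ lefts)))))))
    sub : P₁ ++ (P₂ ++ (P₃ ++ X)) ⊆ A ++ boundary A
    sub = ∪-⊆ P₁ (λ k → let s , s∈ , e = ∈-map⁻ up k in subst (_∈ A ++ boundary A) (sym e) (Nb⇒∈ (Nb-up s∈)))
      (∪-⊆ P₂ (λ k → let r , b , e = bot k in subst (_∈ A ++ boundary A) (sym e) (Nb⇒∈ (Nb-lf (proj₁ b))))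
        (∪-⊆ P₃ (λ k → Nb⇒∈ (proj₁ (lft k))) (λ x → [ ∈-++⁺ˡ , Nb⇒∈ ]′ (near (ex x)))))

Within : List Point → ℤ → ℕ → ℤ → ℕ → Set
Within A a P c Q = ∀ {p} → p ∈ A → (a ≤ U p × U p ≤ a + + P) × (c ≤ V p × V p ≤ c + + Q)

-- In a full box the three families of the count exhaust the box and its boundary: a point with U >
-- a and V > c lies above a point of the box, and on the remaining strips U ≤ a and V ≤ c one
-- coordinate determines the point, since U and V have equal parity.
box-bsize : ∀ S a c P Q → Within S a P c Q →
            (∀ {p} → (a ≤ U p × U p ≤ a + + P) × (c ≤ V p × V p ≤ c + + Q) → p ∈ S) →
            bsize S ℕ.≤ suc P ℕ.+ (3 ℕ.+ Q)
box-bsize S a c P Q wi full = ℕP.+-cancelˡ-≤ (card S) _ _ (subst (ℕ._≤ card S ℕ.+ (suc P ℕ.+ (3 ℕ.+ Q))) (card-closure S)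
  (ℕP.≤-trans (card-mono {E} cover) (ℕP.≤-trans (card-++-≤ (map up S) (X₂ ++ X₃))
    (ℕP.+-mono-≤ (ℕP.≤-reflexive (card-map up-inj S)) (ℕP.≤-trans (card-++-≤ X₂ X₃) (ℕP.+-mono-≤ c₂ c₃))))))
  where
  E X₂ X₃ : List Point
  E = S ++ boundary S
  X₃ = filter (λ e → U e ℤP.≤? a) E
  X₂ = filter (λ e → V e ℤP.≤? c) (filter (λ e → a + + 1 ℤP.≤? U e) E)
  grow₁ : ∀ {a u w} → a ≤ u → u ≤ w + + 1 → a - + 1 ≤ w
  grow₁ {a} {u} {w} h k = lin2 0 h k (solve (a ∷ u ∷ w ∷ []))
  grow₂ : ∀ {b u w} → u ≤ b → w ≤ u + + 1 → w ≤ b + + 1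
  grow₂ {b} {u} {w} h k = lin2 0 h k (solve (b ∷ u ∷ w ∷ []))
  range : ∀ {e} → e ∈ E → ((a - + 1 ≤ U e) × (U e ≤ a + + P + + 1)) × ((c - + 1 ≤ V e) × (V e ≤ c + + Q + + 1))
  range {e} = ∈-++-elim S
    (λ k → let (h₁ , h₂) , (h₃ , h₄) = wi k in
      (grow₁ h₁ (+1≤ _) , ≤-trans h₂ (+1≤ _)) , (grow₁ h₃ (+1≤ _) , ≤-trans h₄ (+1≤ _)))
    (λ k → let q , q∈n , q∈S = Nb⁻ (proj₂ (∂⁻ S k))
               (h₁ , h₂) , (h₃ , h₄) = wi q∈S
           in (grow₁ h₁ (nbU≤ q∈n) , grow₂ h₂ (nbU≤ (nbrs-sym q∈n))) , (grow₁ h₃ (nbV≤ q∈n) , grow₂ h₄ (nbV≤ (nbrs-sym q∈n))))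
    where
    +1≤ : ∀ i → i ≤ i + + 1
    +1≤ i = ℤP.i≤i+j i (+ 1)
  dec₁ : ∀ {a u} → a + + 1 ≤ u → a ≤ u - + 1
  dec₁ {a} {u} h = lin1 0 h (solve (a ∷ u ∷ []))
  dec₂ : ∀ {b u} → u ≤ b + + 1 → u - + 1 ≤ b
  dec₂ {b} {u} h = lin1 0 h (solve (b ∷ u ∷ []))
  cover : E ⊆ map up S ++ (X₂ ++ X₃)
  cover {e} k with U e ℤP.≤? a | V e ℤP.≤? c
  ... | yes h | _ = ∈-++⁺ʳ (map up S) (∈-++⁺ʳ X₂ (∈-filter⁺ (λ e → U e ℤP.≤? a) k h))
  ... | no h | yes h′ = ∈-++⁺ʳ (map up S) (∈-++⁺ˡ (∈-filter⁺ (λ e → V e ℤP.≤? c) (∈-filter⁺ (λ e → a + + 1 ℤP.≤? U e) k (≰⇒+1≤ h)) h′))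
  ... | no h | no h′ = ∈-++⁺ˡ (subst (_∈ map up S) (up-dn e) (∈-map⁺ up (full {dn e}
        ((subst (a ≤_) (sym (U-dn e)) (dec₁ (≰⇒+1≤ h)) , subst (_≤ a + + P) (sym (U-dn e)) (dec₂ (proj₂ (proj₁ (range k)))))
        , (subst (c ≤_) (sym (V-dn e)) (dec₁ (≰⇒+1≤ h′)) , subst (_≤ c + + Q) (sym (V-dn e)) (dec₂ (proj₂ (proj₂ (range k)))))))))
  near : ∀ {a u u′} → u ≤ a → a - + 1 ≤ u′ → u ≤ u′ + + 1
  near {a} {u} {u′} h k = lin2 0 h k (solve (a ∷ u ∷ u′ ∷ []))
  c₃ : card X₃ ℕ.≤ 3 ℕ.+ Q
  c₃ = pigeonhole V (3 ℕ.+ Q) (c - + 1) X₃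
    (λ {p} k → let k₁ , _ = ∈-filter⁻ (λ e → U e ℤP.≤? a) {xs = E} k
                   _ , (h₁ , h₂) = range k₁
               in h₁ , l (V p) c (+ Q) h₂)
    (λ {p} {q} k k′ e → let k₁ , h = ∈-filter⁻ (λ e → U e ℤP.≤? a) {xs = E} k
                            k₁′ , h′ = ∈-filter⁻ (λ e → U e ℤP.≤? a) {xs = E} k′
                        in parity-UV p q e (near h (proj₁ (proj₁ (range k₁′)))) (near h′ (proj₁ (proj₁ (range k₁)))))
    where
    l : ∀ v c q → v ≤ c + q + + 1 → v + + 1 ≤ c - + 1 + (+ 3 + q)
    l v c q h = lin1 0 h (solve (v ∷ c ∷ q ∷ []))
  c₂ : card X₂ ℕ.≤ suc P
  c₂ = pigeonhole U (suc P) (a + + 1) X₂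
    (λ {p} k → let k₁ , _ = ∈-filter⁻ (λ e → V e ℤP.≤? c) {xs = filter (λ e → a + + 1 ℤP.≤? U e) E} k
                   k₂ , h = ∈-filter⁻ (λ e → a + + 1 ℤP.≤? U e) {xs = E} k₁
                   (_ , h₂) , _ = range k₂
               in h , l (U p) a (+ P) h₂)
    (λ {p} {q} k k′ e → let k₁ , h = ∈-filter⁻ (λ e → V e ℤP.≤? c) {xs = filter (λ e → a + + 1 ℤP.≤? U e) E} k
                            k₁′ , h′ = ∈-filter⁻ (λ e → V e ℤP.≤? c) {xs = filter (λ e → a + + 1 ℤP.≤? U e) E} k′
                            k₂ , _ = ∈-filter⁻ (λ e → a + + 1 ℤP.≤? U e) {xs = E} k₁
                            k₂′ , _ = ∈-filter⁻ (λ e → a + + 1 ℤP.≤? U e) {xs = E} k₁′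
                        in parity-VU p q e (near h (proj₁ (proj₂ (range k₂′)))) (near h′ (proj₁ (proj₂ (range k₂)))))
    where
    l : ∀ v c q → v ≤ c + q + + 1 → v + + 1 ≤ c + + 1 + (+ 1 + q)
    l v c q h = lin1 0 h (solve (v ∷ c ∷ q ∷ []))

-- Sliding the two sides of an empty diagonal

rtA dnA : Automorphism
rtA = record { f = rt ; g = lf ; gf = lf-rt ; fg = rt-lf
  ; adj = λ (x , y) (x′ , y′) → ≡⇒⇔ (cong (λ t → ∣ t ∣ ℕ.+ ∣ y - y′ ∣) (l x x′)) }
  where
  l : ∀ x x′ → x - x′ ≡ x + + 1 - (x′ + + 1)
  l = solve-∀
dnA = record { f = dn ; g = up ; gf = up-dn ; fg = dn-up
  ; adj = λ (x , y) (x′ , y′) → ≡⇒⇔ (cong (λ t → ∣ x - x′ ∣ ℕ.+ ∣ t ∣) (l y y′)) }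
  where
  l : ∀ x x′ → x - x′ ≡ x - + 1 - (x′ - + 1)
  l = solve-∀

Sep : List Point → List Point → Set
Sep L R = ∀ {p q} → p ∈ L → q ∈ R → U p + + 2 ≤ U q

sep⇒disjoint : ∀ {L R} → Sep L R → Disjoint L R
sep⇒disjoint s {p} h k = l (U p) (s h k)
  where
  l : ∀ u → u + + 2 ≤ u → ⊥
  l u h = 1≰0 (lin1 1 h (solve (u ∷ [])))

sep-∂ˡ : ∀ {L R} → Sep L R → ∀ {p} → p ∈ R → Nb L p → ⊥
sep-∂ˡ s {p} p∈ n = let q , q∈n , q∈L = Nb⁻ n in l (U p) (U q) (s q∈L p∈) (nbU≤ (nbrs-sym q∈n))
  where
  l : ∀ u w → w + + 2 ≤ u → u ≤ w + + 1 → ⊥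
  l u w h k = 1≰0 (lin2 0 h k (solve (u ∷ w ∷ [])))

sep-∂ʳ : ∀ {L R} → Sep L R → ∀ {p} → p ∈ L → Nb R p → ⊥
sep-∂ʳ s {p} p∈ n = let q , q∈n , q∈R = Nb⁻ n in l (U p) (U q) (s p∈ q∈R) (nbU≤ q∈n)
  where
  l : ∀ u w → u + + 2 ≤ w → w ≤ u + + 1 → ⊥
  l u w h k = 1≰0 (lin2 0 h k (solve (u ∷ w ∷ [])))

∂-++-⊆ : ∀ L R → boundary (L ++ R) ⊆ boundary L ++ boundary R
∂-++-⊆ L R h =
  let p∉ , n = ∂⁻ (L ++ R) h
      q , q∈n , q∈ = Nb⁻ n
  in ∈-++-elim L (λ k → ∈-++⁺ˡ (∂⁺ (p∉ ∘ ∈-++⁺ˡ) (Nb⁺ k q∈n)))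
                 (λ k → ∈-++⁺ʳ (boundary L) (∂⁺ (p∉ ∘ ∈-++⁺ʳ L) (Nb⁺ k q∈n))) q∈

bsize-sep : ∀ L R → Sep L R → bsize (L ++ R) ℕ.+ card (boundary L ∩ boundary R) ≡ bsize L ℕ.+ bsize R
bsize-sep L R s = trans (cong (ℕ._+ card (boundary L ∩ boundary R))
    (card-cong {boundary (L ++ R)} {boundary L ++ boundary R} (∂-++-⊆ L R) back))
  (card-∪∩ (boundary L) (boundary R))
  where
  back : boundary L ++ boundary R ⊆ boundary (L ++ R)
  back = ∪-⊆ (boundary L)
    (λ h → let p∉ , n = ∂⁻ L h in ∂⁺ (∈-++-elim L p∉ (λ k → sep-∂ˡ s k n)) (Nb-mono ∈-++⁺ˡ n))
    (λ h → let p∉ , n = ∂⁻ R h in ∂⁺ (∈-++-elim L (λ k → sep-∂ʳ s k n) p∉) (Nb-mono (∈-++⁺ʳ L) n))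

-- Without separation a boundary point of one set may also be swallowed by the other; these overlaps
-- are savings in addition to the shared boundary points.
bsize-++ : ∀ L R → Disjoint L R → bsize (L ++ R) ℕ.+ (card (boundary L ∩ R) ℕ.+ card (L ∩ boundary R) ℕ.+ card (boundary L ∩ boundary R))
           ℕ.≤ bsize L ℕ.+ bsize R
bsize-++ L R d = begin
  bsize (L ++ R) ℕ.+ (α ℕ.+ β ℕ.+ κ) ≤⟨ ℕP.+-monoˡ-≤ (α ℕ.+ β ℕ.+ κ) (ℕP.≤-trans (card-mono {boundary (L ++ R)} {X ++ Y} sub) (card-++-≤ X Y)) ⟩
  card X ℕ.+ card Y ℕ.+ (α ℕ.+ β ℕ.+ κ) ≡⟨ ar (card X) (card Y) α β κ ⟩
  (card X ℕ.+ (α ℕ.+ κ)) ℕ.+ (card Y ℕ.+ β) ≤⟨ ℕP.+-mono-≤ hX hY ⟩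
  bsize L ℕ.+ bsize R ∎
  where
  open ℕP.≤-Reasoning
  B C X Y : List Point
  B = boundary L
  C = boundary R
  X = B ∖ (R ++ C)
  Y = C ∖ L
  α β κ : ℕ
  α = card (B ∩ R)
  β = card (L ∩ C)
  κ = card (B ∩ C)
  ar : ∀ x y α β κ → x ℕ.+ y ℕ.+ (α ℕ.+ β ℕ.+ κ) ≡ (x ℕ.+ (α ℕ.+ κ)) ℕ.+ (y ℕ.+ β)
  ar = ℕS.solve-∀
  sub : boundary (L ++ R) ⊆ X ++ Y
  sub {p} h with p ∈? C | ∂⁻ (L ++ R) h
  ... | yes k | p∉ , _ = ∈-++⁺ʳ X (∈-∖⁺ k (p∉ ∘ ∈-++⁺ˡ))
  ... | no k | p∉ , _ = ∈-++-elim B (λ b → ∈-++⁺ˡ (∈-∖⁺ b (∈-++-elim R (p∉ ∘ ∈-++⁺ʳ L) k))) (⊥-elim ∘ k) (∂-++-⊆ L R h)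
  hX : card X ℕ.+ (α ℕ.+ κ) ℕ.≤ card B
  hX = ℕP.≤-trans (ℕP.+-monoʳ-≤ (card X) (card-disjoint-≤ (B ∩ R) (B ∩ C)
        (λ h k → proj₁ (∂⁻ R (proj₂ (∈-∩⁻ {B} k))) (proj₂ (∈-∩⁻ {B} h)))))
    (ℕP.≤-trans (card-disjoint-≤ X (B ∩ R ++ B ∩ C)
        (λ h → ∈-++-elim (B ∩ R) (λ k → proj₂ (∈-∖⁻ {B} h) (∈-++⁺ˡ (proj₂ (∈-∩⁻ {B} k))))
                                 (λ k → proj₂ (∈-∖⁻ {B} h) (∈-++⁺ʳ R (proj₂ (∈-∩⁻ {B} k))))))
      (card-mono {X ++ (B ∩ R ++ B ∩ C)} {B} (∪-⊆ X (proj₁ ∘ ∈-∖⁻ {B}) (∪-⊆ (B ∩ R) (proj₁ ∘ ∈-∩⁻ {B}) (proj₁ ∘ ∈-∩⁻ {B})))))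
  hY : card Y ℕ.+ β ℕ.≤ card C
  hY = ℕP.≤-trans (card-disjoint-≤ Y (L ∩ C) (λ h k → proj₂ (∈-∖⁻ {C} h) (proj₁ (∈-∩⁻ {L} k))))
    (card-mono {Y ++ L ∩ C} {C} (∪-⊆ Y (proj₁ ∘ ∈-∖⁻ {C}) (proj₂ ∘ ∈-∩⁻ {L})))

card-move : ∀ φ L R → Disjoint L R → Disjoint L (map (f φ) R) → card (L ++ map (f φ) R) ≡ card (L ++ R)
card-move φ L R d d′ = trans (card-disjoint L (map (f φ) R) d′)
  (trans (cong (card L ℕ.+_) (card-image φ R)) (sym (card-disjoint L R d)))

-- The boundaries of the two sides keep their sizes under `φ`, so for separated sides a smaller
-- total boundary is the same as more shared boundary points.
contacts-max : ∀ φ L R → Minimal (L ++ R) → Sep L R → Sep L (map (f φ) R) →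
  card (boundary L ∩ boundary (map (f φ) R)) ℕ.≤ card (boundary L ∩ boundary R)
contacts-max φ L R m s s′ = ar (bsize (L ++ R)) (bsize (L ++ map (f φ) R)) _ _ (bsize L) (bsize R) _
  (m (L ++ map (f φ) R) (card-move φ L R (sep⇒disjoint s) (sep⇒disjoint s′)))
  (bsize-sep L R s) (bsize-sep L (map (f φ) R) s′) (bsize-image φ R)
  where
  ar : ∀ b b′ k k′ l r r′ → b ℕ.≤ b′ → b ℕ.+ k ≡ l ℕ.+ r → b′ ℕ.+ k′ ≡ l ℕ.+ r′ → r′ ≡ r → k′ ℕ.≤ k
  ar b b′ k k′ l r r′ h e e′ refl = ℕP.+-cancelˡ-≤ b k′ k
    (ℕP.≤-trans (ℕP.+-monoˡ-≤ k′ h) (ℕP.≤-reflexive (trans e′ (sym e))))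

contacts-minimal : ∀ φ L R → Minimal (L ++ R) → Sep L R → Sep L (map (f φ) R) →
  card (boundary L ∩ boundary R) ℕ.≤ card (boundary L ∩ boundary (map (f φ) R)) → Minimal (L ++ map (f φ) R)
contacts-minimal φ L R m s s′ h = Minimal-resp (L ++ R) (L ++ map (f φ) R)
  (card-move φ L R (sep⇒disjoint s) (sep⇒disjoint s′))
  (ar (bsize (L ++ R)) (bsize (L ++ map (f φ) R)) _ _ (bsize L) (bsize R) _ h
    (bsize-sep L R s) (bsize-sep L (map (f φ) R) s′) (bsize-image φ R)) m
  where
  ar : ∀ b b′ k k′ l r r′ → k ℕ.≤ k′ → b ℕ.+ k ≡ l ℕ.+ r → b′ ℕ.+ k′ ≡ l ℕ.+ r′ → r′ ≡ r → b′ ℕ.≤ b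
  ar b b′ k k′ l r r′ h e e′ refl = ℕP.+-cancelʳ-≤ k′ b′ b
    (ℕP.≤-trans (ℕP.≤-reflexive (trans e′ (sym e))) (ℕP.+-monoʳ-≤ b h))

slide-bound : ∀ φ L R → Minimal (L ++ R) → Sep L R → Disjoint L (map (f φ) R) →
  card (boundary L ∩ map (f φ) R) ℕ.+ card (L ∩ boundary (map (f φ) R)) ℕ.+ card (boundary L ∩ boundary (map (f φ) R))
  ℕ.≤ card (boundary L ∩ boundary R)
slide-bound φ L R m s d = ar (bsize (L ++ R)) (bsize (L ++ map (f φ) R)) _ _ (bsize L) (bsize R) _
  (m (L ++ map (f φ) R) (card-move φ L R (sep⇒disjoint s) d))
  (bsize-sep L R s) (bsize-++ L (map (f φ) R) d) (bsize-image φ R)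
  where
  ar : ∀ b b′ k k′ l r r′ → b ℕ.≤ b′ → b ℕ.+ k ≡ l ℕ.+ r → b′ ℕ.+ k′ ℕ.≤ l ℕ.+ r′ → r′ ≡ r → k′ ℕ.≤ k
  ar b b′ k k′ l r r′ h e e′ refl = ℕP.+-cancelˡ-≤ b k′ k
    (ℕP.≤-trans (ℕP.+-monoˡ-≤ k′ h) (ℕP.≤-trans e′ (ℕP.≤-reflexive (sym e))))

-- Translating R so that its extreme point sits two steps beyond the extreme point of L creates a common boundary point.
contact : ∀ L R {l r} → l ∈ L → r ∈ R → Minimal (L ++ R) → Sep L R → ∃[ z ] z ∈ boundary L × z ∈ boundary R
contact L R l∈ r∈ m s with argmax U l∈ | argmin U r∈
... | (x , y) , p∈ , mp | (x′ , y′) , q∈ , mq =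
  let z , z∈ = card-pos⇒∃ (boundary L ∩ boundary R) (ℕP.≤-trans (card-pos (∈-∩⁺ {boundary L} up∈L up∈R)) (contacts-max φ L R m s s′))
  in z , ∈-∩⁻ {boundary L} z∈
  where
  φ = shift (x - + 1 - x′ , y + + 1 - y′)
  R′ = map (f φ) R
  far : ∀ {t} → t ∈ R′ → U (x , y) + + 2 ≤ U t
  far k = let (a , b) , t∈ , e = ∈-map⁻ (f φ) k in
    subst (λ t → U (x , y) + + 2 ≤ U t) (sym e) (lin1 0 (mq t∈) (l x y x′ y′ a b))
    where
    l : ∀ x y x′ y′ a b → b + (y + + 1 - y′) - (a + (x - + 1 - x′)) - (y - x + + 2) ≡ b - a - (y′ - x′) + + 0
    l = solve-∀
  s′ : Sep L R′
  s′ {p} {q} h k = ≤-trans (ℤP.+-monoˡ-≤ (+ 2) (mp h)) (far k)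
  q′∈ : lf (up (x , y)) ∈ R′
  q′∈ = subst (_∈ R′) (cong₂ _,_ (l₁ x x′) (l₂ y y′)) (∈-map⁺ (f φ) q∈)
    where
    l₁ : ∀ x x′ → x′ + (x - + 1 - x′) ≡ x - + 1
    l₁ = solve-∀
    l₂ : ∀ y y′ → y′ + (y + + 1 - y′) ≡ y + + 1
    l₂ = solve-∀
  up∈L : up (x , y) ∈ boundary L
  up∈L = ∂⁺ (λ h → i+1≰i {U (x , y)} (subst (_≤ U (x , y)) (U-up (x , y)) (mp h))) (Nb-up p∈)
  up∈R : up (x , y) ∈ boundary R′
  up∈R = ∂⁺ (λ h → k (U (x , y)) (subst (U (x , y) + + 2 ≤_) (U-up (x , y)) (far h))) (Nb⁺ q′∈ (there (here refl)))
    where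
    k : ∀ u → u + + 2 ≤ u + + 1 → ⊥
    k u h = 1≰0 (lin1 0 h (solve (u ∷ [])))

-- Here `k` counts the contacts; `a`, `b`, `x` and `a′`, `b′`, `y` count the overlaps created by the
-- two slides, and `o` the contacts counted twice. Together the hypotheses give 2k + o + x + y ≤ 2k,
-- so there is no slack anywhere.
slide-arith : ∀ a b x a′ b′ y k o → a ℕ.+ b ℕ.+ x ℕ.≤ k → a′ ℕ.+ b′ ℕ.+ y ℕ.≤ k → k ℕ.≤ a ℕ.+ a′ → k ℕ.+ o ℕ.≤ b ℕ.+ b′ →
  (o ℕ.+ x ℕ.+ y ℕ.≤ 0) × (k ℕ.≤ a ℕ.+ b) × (k ℕ.≤ a′ ℕ.+ b′)
slide-arith a b x a′ b′ y k o h₁ h₂ h₃ h₄ = z , ℕP.+-cancelʳ-≤ k k (a ℕ.+ b) p , ℕP.+-cancelˡ-≤ k k (a′ ℕ.+ b′) q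
  where
  open ℕP.≤-Reasoning
  e₁ : ∀ k o x y → k ℕ.+ k ℕ.+ (o ℕ.+ x ℕ.+ y) ≡ k ℕ.+ (k ℕ.+ o) ℕ.+ (x ℕ.+ y)
  e₁ = ℕS.solve-∀
  e₂ : ∀ a b a′ b′ x y → (a ℕ.+ a′) ℕ.+ (b ℕ.+ b′) ℕ.+ (x ℕ.+ y) ≡ (a ℕ.+ b ℕ.+ x) ℕ.+ (a′ ℕ.+ b′ ℕ.+ y)
  e₂ = ℕS.solve-∀
  e₃ : ∀ a b a′ b′ → (a ℕ.+ a′) ℕ.+ (b ℕ.+ b′) ≡ (a ℕ.+ b) ℕ.+ (a′ ℕ.+ b′)
  e₃ = ℕS.solve-∀
  z : o ℕ.+ x ℕ.+ y ℕ.≤ 0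
  z = ℕP.+-cancelˡ-≤ (k ℕ.+ k) _ _ (begin
    k ℕ.+ k ℕ.+ (o ℕ.+ x ℕ.+ y) ≡⟨ e₁ k o x y ⟩
    k ℕ.+ (k ℕ.+ o) ℕ.+ (x ℕ.+ y) ≤⟨ ℕP.+-monoˡ-≤ (x ℕ.+ y) (ℕP.+-mono-≤ h₃ h₄) ⟩
    (a ℕ.+ a′) ℕ.+ (b ℕ.+ b′) ℕ.+ (x ℕ.+ y) ≡⟨ e₂ a b a′ b′ x y ⟩
    (a ℕ.+ b ℕ.+ x) ℕ.+ (a′ ℕ.+ b′ ℕ.+ y) ≤⟨ ℕP.+-mono-≤ h₁ h₂ ⟩
    k ℕ.+ k ≡⟨ ℕP.+-identityʳ (k ℕ.+ k) ⟨
    k ℕ.+ k ℕ.+ 0 ∎)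
  kk : k ℕ.+ k ℕ.≤ (a ℕ.+ b) ℕ.+ (a′ ℕ.+ b′)
  kk = begin
    k ℕ.+ k ≤⟨ ℕP.+-mono-≤ h₃ (ℕP.≤-trans (ℕP.m≤m+n k o) h₄) ⟩
    (a ℕ.+ a′) ℕ.+ (b ℕ.+ b′) ≡⟨ e₃ a b a′ b′ ⟩
    (a ℕ.+ b) ℕ.+ (a′ ℕ.+ b′) ∎
  p : k ℕ.+ k ℕ.≤ (a ℕ.+ b) ℕ.+ k
  p = ℕP.≤-trans kk (ℕP.+-monoʳ-≤ (a ℕ.+ b) (ℕP.≤-trans (ℕP.m≤m+n (a′ ℕ.+ b′) y) h₂))
  q : k ℕ.+ k ℕ.≤ k ℕ.+ (a′ ℕ.+ b′)
  q = ℕP.≤-trans kk (ℕP.+-monoˡ-≤ (a′ ℕ.+ b′) (ℕP.≤-trans (ℕP.m≤m+n (a ℕ.+ b) x) h₁))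

sum≤0 : ∀ a b c → a ℕ.+ b ℕ.+ c ℕ.≤ 0 → a ℕ.≤ 0 × b ℕ.≤ 0 × c ℕ.≤ 0
sum≤0 zero zero zero _ = z≤n , z≤n , z≤n

sum≥1 : ∀ a b → 1 ℕ.≤ a ℕ.+ b → 1 ℕ.≤ a ⊎ 1 ℕ.≤ b
sum≥1 zero b h = inj₂ h
sum≥1 (suc a) b h = inj₁ (s≤s z≤n)

module Slides (i : ℤ) (L R : List Point) (hL : ∀ {p} → p ∈ L → U p + + 1 ≤ i) (hR : ∀ {p} → p ∈ R → i + + 1 ≤ U p)
              (min : Minimal (L ++ R)) where

  sep : Sep L R
  sep {p} {q} h k = l (U p) (U q) (hL h) (hR k)
    where
    l : ∀ u w → u + + 1 ≤ i → i + + 1 ≤ w → u + + 2 ≤ w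
    l u w h k = lin2 0 h k (solve (u ∷ w ∷ i ∷ []))

  B C K R⁺ R⁻ : List Point
  B = boundary L
  C = boundary R
  K = B ∩ C
  -- Both slides lower U by 1; they change V by +1 and -1 respectively.
  R⁺ = map rt R
  R⁻ = map dn R

  B≤i : ∀ {z} → z ∈ B → U z ≤ i
  B≤i {z} h = let q , q∈n , q∈L = Nb⁻ (proj₂ (∂⁻ L h)) in l (U z) (U q) (hL q∈L) (nbU≤ (nbrs-sym q∈n))
    where
    l : ∀ u w → w + + 1 ≤ i → u ≤ w + + 1 → u ≤ i
    l u w h k = ≤-trans k h

  C≥i : ∀ {z} → z ∈ C → i ≤ U z
  C≥i {z} h = let q , q∈n , q∈R = Nb⁻ (proj₂ (∂⁻ R h)) in l (U z) (U q) (hR q∈R) (nbU≤ q∈n)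
    where
    l : ∀ u w → i + + 1 ≤ w → w ≤ u + + 1 → i ≤ u
    l u w h k = lin2 0 h k (solve (u ∷ w ∷ i ∷ []))

  ≥i⇒∉L : ∀ {z} → i ≤ U z → z ∉ L
  ≥i⇒∉L {z} h k = i+1≰i {U z} (≤-trans (hL k) h)

  ≤i⇒∉R : ∀ {z} → U z ≤ i → z ∉ R
  ≤i⇒∉R {z} h k = i+1≰i {i} (≤-trans (hR k) h)

  nbR : ∀ {z} → Nb R z → U z ≤ i → lf z ∈ R ⊎ up z ∈ R
  nbR {z} n h with Nb⁻ n
  ... | _ , here refl , k = ⊥-elim (l (U z) (subst (i + + 1 ≤_) (U-rt z) (hR k)) h)
    where
    l : ∀ u → i + + 1 ≤ u - + 1 → u ≤ i → ⊥
    l u h k = 1≰0 (lin2 1 h k (solve (u ∷ i ∷ [])))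
  ... | _ , there (here refl) , k = inj₁ k
  ... | _ , there (there (here refl)) , k = inj₂ k
  ... | _ , there (there (there (here refl))) , k = ⊥-elim (l (U z) (subst (i + + 1 ≤_) (U-dn z) (hR k)) h)
    where
    l : ∀ u → i + + 1 ≤ u - + 1 → u ≤ i → ⊥
    l u h k = 1≰0 (lin2 1 h k (solve (u ∷ i ∷ [])))

  nbL : ∀ {z} → Nb L z → i ≤ U z → rt z ∈ L ⊎ dn z ∈ L
  nbL {z} n h with Nb⁻ n
  ... | _ , here refl , k = inj₁ k
  ... | _ , there (here refl) , k = ⊥-elim (l (U z) (subst (λ t → t + + 1 ≤ i) (U-lf z) (hL k)) h)
    where
    l : ∀ u → u + + 1 + + 1 ≤ i → i ≤ u → ⊥
    l u h k = 1≰0 (lin2 1 h k (solve (u ∷ i ∷ [])))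
  ... | _ , there (there (here refl)) , k = ⊥-elim (l (U z) (subst (λ t → t + + 1 ≤ i) (U-up z) (hL k)) h)
    where
    l : ∀ u → u + + 1 + + 1 ≤ i → i ≤ u → ⊥
    l u h k = 1≰0 (lin2 1 h k (solve (u ∷ i ∷ [])))
  ... | _ , there (there (there (here refl))) , k = inj₂ k

  private
    i≤step : ∀ u → i + + 1 ≤ u + + 1 → i ≤ u
    i≤step u h = lin1 0 h (solve (u ∷ i ∷ []))

    disj⁺ : Disjoint L R⁺
    disj⁺ {p} h k = ≥i⇒∉L (i≤step (U p) (subst (i + + 1 ≤_) (U-lf p) (hR (∈-image⁻ rtA k)))) h

    disj⁻ : Disjoint L R⁻
    disj⁻ {p} h k = ≥i⇒∉L (i≤step (U p) (subst (i + + 1 ≤_) (U-up p) (hR (∈-image⁻ dnA k)))) h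

  a⁺ a⁻ b⁺ b⁻ c⁺ c⁻ : List Point
  a⁺ = B ∩ R⁺
  a⁻ = B ∩ R⁻
  b⁺ = L ∩ boundary R⁺
  b⁻ = L ∩ boundary R⁻
  -- These maps carry the overlaps in `L` back to contact points on the diagonal U = i, where the
  -- two slides can be compared.
  c⁺ = map lf b⁺
  c⁻ = map up b⁻

  private
    -- A contact has a neighbour of `R` on its left or above it, so one of the slides brings `R`
    -- onto it.
    K⊆a : K ⊆ a⁺ ++ a⁻
    K⊆a {z} h = let b , c = ∈-∩⁻ {B} h in
      [ (λ k → ∈-++⁺ˡ (∈-∩⁺ b (∈-image⁺ rtA k))) , (λ k → ∈-++⁺ʳ a⁺ (∈-∩⁺ b (∈-image⁺ dnA k))) ]′
        (nbR (proj₂ (∂⁻ R c)) (B≤i b))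

  ∈c⁺ : ∀ {z} → z ∈ C → rt z ∈ L → z ∈ c⁺
  ∈c⁺ {z} c k = subst (_∈ c⁺) (lf-rt z) (∈-map⁺ lf (∈-∩⁺ {L} {boundary R⁺} k (∂-image⁺ rtA R (subst (_∈ C) (sym (lf-rt z)) c))))

  ∈c⁻ : ∀ {z} → z ∈ C → dn z ∈ L → z ∈ c⁻
  ∈c⁻ {z} c k = subst (_∈ c⁻) (up-dn z) (∈-map⁺ up (∈-∩⁺ {L} {boundary R⁻} k (∂-image⁺ dnA R (subst (_∈ C) (sym (up-dn z)) c))))

  private
    K⊆c : K ⊆ c⁺ ++ c⁻
    K⊆c {z} h = let b , c = ∈-∩⁻ {B} h in
      [ (λ k → ∈-++⁺ˡ (∈c⁺ c k)) , (λ k → ∈-++⁺ʳ c⁺ (∈c⁻ c k)) ]′ (nbL (proj₂ (∂⁻ L b)) (C≥i c))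

    k≤β : card K ℕ.+ card (c⁺ ∩ c⁻) ℕ.≤ card b⁺ ℕ.+ card b⁻
    k≤β = ℕP.≤-trans (ℕP.+-monoˡ-≤ (card (c⁺ ∩ c⁻)) (card-mono K⊆c)) (ℕP.≤-reflexive (trans (card-∪∩ c⁺ c⁻)
      (cong₂ ℕ._+_ (card-image (inv rtA) b⁺) (card-image (inv dnA) b⁻))))

    arith-facts : (card (c⁺ ∩ c⁻) ℕ.+ card (B ∩ boundary R⁺) ℕ.+ card (B ∩ boundary R⁻) ℕ.≤ 0) × (card K ℕ.≤ card a⁺ ℕ.+ card b⁺) × (card K ℕ.≤ card a⁻ ℕ.+ card b⁻)
    arith-facts = slide-arith (card a⁺) (card b⁺) (card (B ∩ boundary R⁺)) (card a⁻) (card b⁻) (card (B ∩ boundary R⁻)) (card K) (card (c⁺ ∩ c⁻))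
      (slide-bound rtA L R min sep disj⁺) (slide-bound dnA L R min sep disj⁻)
      (ℕP.≤-trans (card-mono K⊆a) (card-++-≤ a⁺ a⁻)) k≤β

    zeros : card (c⁺ ∩ c⁻) ℕ.≤ 0 × card (B ∩ boundary R⁺) ℕ.≤ 0 × card (B ∩ boundary R⁻) ℕ.≤ 0
    zeros = sum≤0 (card (c⁺ ∩ c⁻)) (card (B ∩ boundary R⁺)) (card (B ∩ boundary R⁻)) (proj₁ arith-facts)

  -- Such a point would be counted in both `c⁺` and `c⁻`, for which the slides together leave no
  -- slack.
  not-both : ∀ {z} → z ∈ C → rt z ∈ L → dn z ∈ L → ⊥
  not-both {z} c h k = card≡0⇒∉ {c⁺ ∩ c⁻} (proj₁ zeros) {z} (∈-∩⁺ {c⁺} {c⁻} (∈c⁺ c h) (∈c⁻ c k))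

  no-share⁺ : ∀ {z} → z ∈ B → lf z ∈ C → ⊥
  no-share⁺ {z} b c = card≡0⇒∉ {B ∩ boundary R⁺} (proj₁ (proj₂ zeros)) {z} (∈-∩⁺ {B} {boundary R⁺} b (∂-image⁺ rtA R c))

  no-share⁻ : ∀ {z} → z ∈ B → up z ∈ C → ⊥
  no-share⁻ {z} b c = card≡0⇒∉ {B ∩ boundary R⁻} (proj₂ (proj₂ zeros)) {z} (∈-∩⁺ {B} {boundary R⁻} b (∂-image⁺ dnA R c))

  -- The points `up x` and `lf x` on the empty diagonal touch both `x` and its partner. Applied to
  -- them, the exclusions above clear the two points next to `x` on its own diagonal and, through
  -- `isolated₁` and `isolated₂`, the neighbours of `x` in `L`.
  module Coincidence {x} (x∈ : x ∈ L) (x′∈ : lf (up x) ∈ R) where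

    private
      Ux : U x + + 1 ≡ i
      Ux = ℤP.≤-antisym (hL x∈) (i≤step (U x + + 1) (subst (i + + 1 ≤_) (trans (U-lf (up x)) (cong (_+ + 1) (U-up x))) (hR x′∈)))
      up∈C : up x ∈ C
      up∈C = ∂⁺ (≤i⇒∉R (≤-reflexive (trans (U-up x) Ux))) (Nb⁺ x′∈ (there (here refl)))
      lf∈C : lf x ∈ C
      lf∈C = ∂⁺ (≤i⇒∉R (≤-reflexive (trans (U-lf x) Ux))) (Nb⁺ x′∈ (there (there (here refl))))

    free₁ : rt (up x) ∉ L
    free₁ h = not-both up∈C h (subst (_∈ L) (sym (dn-up x)) x∈)

    free₂ : dn (lf x) ∉ L
    free₂ h = not-both lf∈C (subst (_∈ L) (sym (rt-lf x)) x∈) h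

    isolated₁ : ¬ Nb L (rt (up x))
    isolated₁ n = no-share⁺ (∂⁺ free₁ n) (subst (_∈ C) (sym (lf-rt (up x))) up∈C)

    isolated₂ : ¬ Nb L (dn (lf x))
    isolated₂ n = no-share⁻ (∂⁺ free₂ n) (subst (_∈ C) (sym (up-dn (lf x))) lf∈C)

  -- The translation by (1,1), which maps every diagonal U = const to itself.
  ψ : Automorphism
  ψ = rtA ⊙ inv dnA

  R² : List Point
  R² = map (f ψ) R

  -- Without a coincidence, the neighbours of a contact in `L` and in `R` lie opposite each other,
  -- horizontally (`type₁`) or vertically (`type₂`). Since neither slide has slack, both kinds
  -- occur.
  module NoCoincidence (no-co : ∀ {x} → x ∈ L → lf (up x) ∉ R) (1≤k : 1 ℕ.≤ card K) where

    private
      ∈R⇒i≤ : ∀ {z} → lf z ∈ R → i ≤ U z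
      ∈R⇒i≤ {z} h = i≤step (U z) (subst (i + + 1 ≤_) (U-lf z) (hR h))

      ∈R⇒i≤′ : ∀ {z} → up z ∈ R → i ≤ U z
      ∈R⇒i≤′ {z} h = i≤step (U z) (subst (i + + 1 ≤_) (U-up z) (hR h))

      type₁-a : ∀ {z} → z ∈ a⁺ → ∃[ x ] x ∈ L × lf (lf x) ∈ R
      type₁-a {z} h =
        let b , k = ∈-∩⁻ {B} h
            lz = ∈-image⁻ rtA k
        in [ (λ r → rt z , r , subst (λ t → lf t ∈ R) (sym (lf-rt z)) lz)
           , (λ d → ⊥-elim (no-co d (subst (λ t → lf t ∈ R) (sym (up-dn z)) lz))) ]′ (nbL (proj₂ (∂⁻ L b)) (∈R⇒i≤ {z} lz))

      type₂-a : ∀ {z} → z ∈ a⁻ → ∃[ x ] x ∈ L × up (up x) ∈ R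
      type₂-a {z} h =
        let b , k = ∈-∩⁻ {B} h
            uz = ∈-image⁻ dnA k
        in [ (λ r → ⊥-elim (no-co r (subst (λ t → up t ∈ R) (sym (lf-rt z)) uz)))
           , (λ d → dn z , d , subst (λ t → up t ∈ R) (sym (up-dn z)) uz) ]′ (nbL (proj₂ (∂⁻ L b)) (∈R⇒i≤′ {z} uz))

      type₁-b : ∀ {w} → w ∈ b⁺ → ∃[ x ] x ∈ L × lf (lf x) ∈ R
      type₁-b {w} h =
        let l , k = ∈-∩⁻ {L} {boundary R⁺} h
            c = ∂-image⁻ rtA R k
        in [ (λ r → w , l , r) , (λ r → ⊥-elim (no-co l r)) ]′
             (nbR (proj₂ (∂⁻ R c)) (subst (_≤ i) (sym (U-lf w)) (hL l)))

      type₂-b : ∀ {w} → w ∈ b⁻ → ∃[ x ] x ∈ L × up (up x) ∈ R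
      type₂-b {w} h =
        let l , k = ∈-∩⁻ {L} {boundary R⁻} h
            c = ∂-image⁻ dnA R k
        in [ (λ r → ⊥-elim (no-co l r)) , (λ r → w , l , r) ]′
             (nbR (proj₂ (∂⁻ R c)) (subst (_≤ i) (sym (U-up w)) (hL l)))

    type₁ : ∃[ x ] x ∈ L × lf (lf x) ∈ R
    type₁ = [ (λ h → type₁-a (proj₂ (card-pos⇒∃ a⁺ h))) , (λ h → type₁-b (proj₂ (card-pos⇒∃ b⁺ h))) ]′
      (sum≥1 (card a⁺) (card b⁺) (ℕP.≤-trans 1≤k (proj₁ (proj₂ arith-facts))))

    type₂ : ∃[ x ] x ∈ L × up (up x) ∈ R
    type₂ = [ (λ h → type₂-a (proj₂ (card-pos⇒∃ a⁻ h))) , (λ h → type₂-b (proj₂ (card-pos⇒∃ b⁻ h))) ]′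
      (sum≥1 (card a⁻) (card b⁻) (ℕP.≤-trans 1≤k (proj₂ (proj₂ arith-facts))))

    private
      U-ψ : ∀ z → U (dn (lf z)) ≡ U z
      U-ψ z = trans (U-dn (lf z)) (trans (cong (_- + 1) (U-lf z)) (sym (+1-1 (U z))))

    hR² : ∀ {p} → p ∈ R² → i + + 1 ≤ U p
    hR² {p} h = subst (i + + 1 ≤_) (U-ψ p) (hR (∈-image⁻ ψ h))

    sep² : Sep L R²
    sep² {p} {q} h k = subst (U p + + 2 ≤_) (U-ψ q) (sep h (∈-image⁻ ψ k))

    private
      K² : List Point
      K² = B ∩ boundary R²

      a⊆ : a⁺ ⊆ K²
      a⊆ {z} h =
        let b , k = ∈-∩⁻ {B} h
            lz = ∈-image⁻ rtA k
        in ∈-∩⁺ b (∂-image⁺ ψ R (∂⁺ (≤i⇒∉R (subst (_≤ i) (sym (U-ψ z)) (B≤i b))) (Nb-dn lz)))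

      b⊆ : map up b⁺ ⊆ K²
      b⊆ {z} h =
        let w , w∈ , e = ∈-map⁻ up h
            l , k = ∈-∩⁻ {L} {boundary R⁺} w∈
            c = ∂-image⁻ rtA R k
        in subst (_∈ K²) (sym e) (∈-∩⁺ {B} {boundary R²}
             (∂⁺ (≥i⇒∉L (subst (i ≤_) (trans (U-lf w) (sym (U-up w))) (C≥i c))) (Nb-up l))
             (∂-image⁺ ψ R (subst (_∈ C) (sym (dn-up (lf w))) c)))

      ab-disj : Disjoint a⁺ (map up b⁺)
      ab-disj {z} h k =
        let w , w∈ , e = ∈-map⁻ up k
        in no-co (proj₁ (∈-∩⁻ {L} {boundary R⁺} w∈)) (subst (λ t → lf t ∈ R) e (∈-image⁻ rtA (proj₂ (∈-∩⁻ {B} h))))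

    -- `a⁺` and the shifted `b⁺` are disjoint sets of contacts of `L` with `R²`, and together they
    -- are at least as many as the old contacts.
    minimal² : Minimal (L ++ R²)
    minimal² = contacts-minimal ψ L R min sep sep² (ℕP.≤-trans (proj₁ (proj₂ arith-facts))
      (ℕP.≤-trans (ℕP.≤-reflexive (cong (card a⁺ ℕ.+_) (sym (card-image (inv dnA) b⁺))))
        (ℕP.≤-trans (card-disjoint-≤ a⁺ (map up b⁺) ab-disj) (card-mono {a⁺ ++ map up b⁺} {K²} (∪-⊆ a⁺ a⊆ b⊆)))))

    private
      y+3≢y+1 : ∀ y → ¬ (y + + 1 + + 1 + + 1 ≡ y + + 1)
      y+3≢y+1 y e = 1≰0 (lin1 1 (≤-reflexive e) (solve (y ∷ [])))

      -- The `type₂` pair supplies it: its point in `L` or, if that is `x` itself, the image of the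
      -- opposite point.
      third : ∀ x x₂ → x ∈ L → lf (up x) ∈ R² → x₂ ∈ L → up (up x₂) ∈ R → ∃[ t ] t ∈ L ++ R² × ¬ (t ≡ x) × ¬ (t ≡ lf (up x))
      third x x₂ x∈ co x₂∈ r₂ with x₂ ≟P x
      ... | no n = x₂ , ∈-++⁺ˡ x₂∈ , n , λ e → sep⇒disjoint sep² x₂∈ (subst (_∈ R²) (sym e) co)
      ... | yes refl = rt (up (up (up x))) , ∈-++⁺ʳ L q∈
          , (λ e → sep⇒disjoint sep² x∈ (subst (_∈ R²) e q∈)) , λ e → y+3≢y+1 (proj₂ x) (cong proj₂ e)
        where
        q∈ : rt (up (up (up x))) ∈ R²
        q∈ = ∈-map⁺ (f ψ) r₂

    coincidence² : ∃[ x ] x ∈ L × lf (up x) ∈ R² × (∃[ t ] t ∈ L ++ R² × ¬ (t ≡ x) × ¬ (t ≡ lf (up x)))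
    coincidence² =
      let x , x∈ , r = type₁
          x₂ , x₂∈ , r₂ = type₂
          co = ∈-image⁺ ψ {R} {lf (up x)} (subst (_∈ R) (sym (dn-up (lf (lf x)))) r)
      in x , x∈ , co , third x x₂ x∈ co x₂∈ r₂

-- Two points facing each other across an empty diagonal

-- Regrowing as many points as `J` has costs at most their number, whereas deleting them frees
-- strictly more boundary points and creates none.
squeeze : ∀ A J lost → Minimal A → J ⊆ A → 2 ℕ.≤ card (A ∖ J) → card J ℕ.< card lost →
          All (Off A J) J → All (λ l → l ∉ A × Nb A l × Off A J l) lost → ⊥
squeeze A J lost m J⊆A two lt js ls = ℕP.<-irrefl refl (begin-strict
  bsize A                          ≤⟨ minimal-∖ A J m J⊆A two ⟩
  card J ℕ.+ bsize (A ∖ J)         <⟨ ℕP.+-monoˡ-< (bsize (A ∖ J)) lt ⟩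
  card lost ℕ.+ bsize (A ∖ J)      ≡⟨ ℕP.+-comm (card lost) (bsize (A ∖ J)) ⟩
  bsize (A ∖ J) ℕ.+ card lost      ≤⟨ remove-cost A J lost [] (All.map inj₂ js) ls ⟩
  bsize A ℕ.+ 0                    ≡⟨ ℕP.+-identityʳ (bsize A) ⟩
  bsize A                          ∎)
  where open ℕP.≤-Reasoning

-- With a third point this configuration, two points facing each other across the empty diagonal U = 1, is impossible.
record Facing (A : List Point) : Set where
  field
    min : Minimal A
    o∈  : (+ 0 , + 0) ∈ A
    w∈  : (-[1+ 0 ] , + 1) ∈ A
    gap : ∀ {p} → p ∈ A → U p + + 1 ≤ + 1 ⊎ + 1 + + 1 ≤ U p

open Facing

module _ {A : List Point} (F : Facing A) where

  private
    low? : ∀ p → Dec (U p + + 1 ≤ + 1)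
    low? p = U p + + 1 ℤP.≤? + 1
    high? : ∀ p → Dec (+ 1 + + 1 ≤ U p)
    high? p = + 1 + + 1 ℤP.≤? U p
    L R : List Point
    L = filter low? A
    R = filter high? A
    A⊆ : A ⊆ L ++ R
    A⊆ h = [ (λ k → ∈-++⁺ˡ (∈-filter⁺ low? h k)) , (λ k → ∈-++⁺ʳ L (∈-filter⁺ high? h k)) ]′ (gap F h)
    ⊆A : L ++ R ⊆ A
    ⊆A = ∪-⊆ L (proj₁ ∘ ∈-filter⁻ low? {xs = A}) (proj₁ ∘ ∈-filter⁻ high? {xs = A})
    module S = Slides (+ 1) L R (λ h → proj₂ (∈-filter⁻ low? {xs = A} h)) (λ h → proj₂ (∈-filter⁻ high? {xs = A} h)) (Minimal-cong {A} {L ++ R} A⊆ ⊆A (min F))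
    module I = S.Coincidence {+ 0 , + 0} (∈-filter⁺ low? (o∈ F) (+≤+ (s≤s z≤n))) (∈-filter⁺ high? (w∈ F) (+≤+ (s≤s (s≤s z≤n))))

  [1,1]∉A : (+ 1 , + 1) ∉ A
  [1,1]∉A h = I.free₁ (∈-filter⁺ low? h (+≤+ (s≤s z≤n)))

  [-1,-1]∉A : (-[1+ 0 ] , -[1+ 0 ]) ∉ A
  [-1,-1]∉A h = I.free₂ (∈-filter⁺ low? h (+≤+ (s≤s z≤n)))

  [1,0]∉A : (+ 1 , + 0) ∉ A
  [1,0]∉A h = I.isolated₁ (there (there (there (here (∈-filter⁺ low? h (+≤+ z≤n))))))

  [0,-1]∉A : (+ 0 , -[1+ 0 ]) ∉ A
  [0,-1]∉A h = I.isolated₂ (here (∈-filter⁺ low? h (+≤+ z≤n)))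

  [0,1]∉A : (+ 0 , + 1) ∉ A
  [0,1]∉A h with gap F h
  ... | inj₁ (+≤+ (s≤s ()))
  ... | inj₂ (+≤+ (s≤s ()))

  [-1,0]∉A : (-[1+ 0 ] , + 0) ∉ A
  [-1,0]∉A h with gap F h
  ... | inj₁ (+≤+ (s≤s ()))
  ... | inj₂ (+≤+ (s≤s ()))

-- (x,y) ↦ (y-1,x+1) exchanges the two facing points and the sides of the gap; (x,y) ↦ (-y,-x) fixes
-- both points and reverses the direction along the gap.
mirrorLR mirrorUD : Automorphism
mirrorLR = shift (-[1+ 0 ] , + 1) ⊙ swapA
mirrorUD = flipA ⊙ swapA ⊙ flipA

facingLR : ∀ {A} → Facing A → Facing (map (f mirrorLR) A)
facingLR {A} F = record
  { min = Minimal-image mirrorLR A (min F)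
  ; o∈ = ∈-image⁺ mirrorLR (w∈ F)
  ; w∈ = ∈-image⁺ mirrorLR (o∈ F)
  ; gap = λ {(x , y)} h → Sum.swap (Sum.map (λ k → lin1 0 k (l₁ x y)) (λ k → lin1 0 k (l₂ x y)) (gap F (∈-image⁻ mirrorLR h))) }
  where
  l₁ : ∀ x y → y - x - (+ 1 + + 1) ≡ + 1 - ((x + + 1) - (y + -[1+ 0 ]) + + 1) + + 0
  l₁ = solve-∀
  l₂ : ∀ x y → + 1 - (y - x + + 1) ≡ (x + + 1) - (y + -[1+ 0 ]) - (+ 1 + + 1) + + 0
  l₂ = solve-∀

facingUD : ∀ {A} → Facing A → Facing (map (f mirrorUD) A)
facingUD {A} F = record
  { min = Minimal-image mirrorUD A (min F)
  ; o∈ = ∈-image⁺ mirrorUD (o∈ F)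
  ; w∈ = ∈-image⁺ mirrorUD (w∈ F)
  ; gap = λ {(x , y)} h → subst (λ u → u + + 1 ≤ + 1 ⊎ + 1 + + 1 ≤ u) (l x y) (gap F (∈-image⁻ mirrorUD h)) }
  where
  l : ∀ x y → - x - (- y) ≡ y - x
  l = solve-∀

Third : List Point → Set
Third A = ∃[ t ] t ∈ A × ¬ (t ≡ (+ 0 , + 0)) × ¬ (t ≡ (-[1+ 0 ] , + 1))

thirdLR : ∀ {A} → Third A → Third (map (f mirrorLR) A)
thirdLR (t , t∈ , n , n′) = f mirrorLR t , ∈-map⁺ (f mirrorLR) t∈
  , (λ e → n′ (trans (sym (gf mirrorLR t)) (cong (g mirrorLR) e)))
  , (λ e → n (trans (sym (gf mirrorLR t)) (cong (g mirrorLR) e)))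

facing-∷ : ∀ {A p} → Facing A → p ∉ A → U p + + 1 ≤ + 1 → bsize (p ∷ A) ℕ.≤ bsize A → Facing (p ∷ A)
facing-∷ {A} {p} F p∉ u b = record
  { min = minimal-∷ A p (min F) p∉ b ; o∈ = there (o∈ F) ; w∈ = there (w∈ F)
  ; gap = λ { (here refl) → inj₁ u ; (there h) → gap F h } }

-- Otherwise adding (1,0) would trade the boundary point (1,0) for (1,1) at no cost. The enlarged
-- set would be minimal with the same facing pair, yet contain the forbidden (1,0).
not-both-absorbed : ∀ {A} → Facing A → Absorbs A ((+ 1 , + 1) ∷ []) (+ 2 , + 0) → Absorbs A ((+ 1 , + 1) ∷ []) (+ 1 , -[1+ 0 ]) → ⊥
not-both-absorbed {A} F a₁ a₂ = [1,0]∉A (facing-∷ F ([1,0]∉A F) (+≤+ z≤n)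
    (ℕP.+-cancelʳ-≤ 1 (bsize (y ∷ A)) (bsize A)
      (add-cost A y ((+ 1 , + 1) ∷ []) ([1,0]∉A F) (there (here (o∈ F)))
        (a₁ & in-A (o∈ F) & in-M (here refl) & a₂ & All.[]))))
  (here refl)
  where
  y : Point
  y = + 1 , + 0

-- Otherwise deleting (0,0) frees two boundary points.
left-witness : ∀ {A} → Facing A → Third A →
  ∃[ e ] e ∈ A × (e ≡ (+ 2 , + 0) ⊎ e ≡ (+ 1 , -[1+ 0 ]) ⊎ e ≡ (+ 0 , -[1+ 1 ]))
left-witness {A} F (t , t∈ , t≢o , t≢w) with (+ 2 , + 0) ∈? A | (+ 1 , -[1+ 0 ]) ∈? A | (+ 0 , -[1+ 1 ]) ∈? A
... | yes h | _ | _ = _ , h , inj₁ refl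
... | no _ | yes h | _ = _ , h , inj₂ (inj₁ refl)
... | no _ | no _ | yes h = _ , h , inj₂ (inj₂ refl)
... | no n₁ | no n₂ | no n₃ = ⊥-elim (squeeze A J ((+ 1 , + 0) ∷ (+ 0 , -[1+ 0 ]) ∷ []) (min F)
    (λ { (here refl) → o∈ F })
    (card-two (∈-∖⁺ {A} {J} t∈ (λ { (here e) → t≢o e })) (∈-∖⁺ {A} {J} (w∈ F) (λ { (here ()) })) t≢w)
    (s≤s (s≤s z≤n))
    ((inj₁ ([1,0]∉A F) & inj₁ ([-1,0]∉A F) & inj₁ ([0,1]∉A F) & inj₁ ([0,-1]∉A F) & All.[]) & All.[])
    (([1,0]∉A F , there (here (o∈ F)) , inj₁ n₁ & inj₂ (here refl) & inj₁ ([1,1]∉A F) & inj₁ n₂ & All.[])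
    & ([0,-1]∉A F , there (there (here (o∈ F))) , inj₁ n₂ & inj₁ ([-1,-1]∉A F) & inj₂ (here refl) & inj₁ n₃ & All.[])
    & All.[]))
  where
  J : List Point
  J = (+ 0 , + 0) ∷ []

left-outside : ∀ {A} → Facing A → Third A → ∃[ e ] e ∈ A × U e ≡ -[1+ 1 ]
left-outside F t = let e , e∈ , c = left-witness F t in e , e∈ , at c
  where
  at : ∀ {e} → e ≡ (+ 2 , + 0) ⊎ e ≡ (+ 1 , -[1+ 0 ]) ⊎ e ≡ (+ 0 , -[1+ 1 ]) → U e ≡ -[1+ 1 ]
  at (inj₁ refl) = refl
  at (inj₂ (inj₁ refl)) = refl
  at (inj₂ (inj₂ refl)) = refl

right-outside : ∀ {A} → Facing A → Third A → ∃[ e ] e ∈ A × U e ≡ + 4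
right-outside F t = let e , e∈ , c = left-witness (facingLR F) (thirdLR t) in g mirrorLR e , ∈-image⁻ mirrorLR e∈ , at c
  where
  at : ∀ {e} → e ≡ (+ 2 , + 0) ⊎ e ≡ (+ 1 , -[1+ 0 ]) ⊎ e ≡ (+ 0 , -[1+ 1 ]) → U (g mirrorLR e) ≡ + 4
  at (inj₁ refl) = refl
  at (inj₂ (inj₁ refl)) = refl
  at (inj₂ (inj₂ refl)) = refl

module _ {A : List Point} (F : Facing A) where

  private
    G : Facing (map (f mirrorLR) A)
    G = facingLR F
    mir : ∀ {p} → p ∉ map (f mirrorLR) A → g mirrorLR p ∉ A
    mir n h = n (∈-image⁺ mirrorLR h)

  [-2,1]∉A : (-[1+ 1 ] , + 1) ∉ A
  [-2,1]∉A = mir {+ 0 , -[1+ 0 ]} ([0,-1]∉A G)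
  [-1,2]∉A : (-[1+ 0 ] , + 2) ∉ A
  [-1,2]∉A = mir {+ 1 , + 0} ([1,0]∉A G)
  [0,2]∉A : (+ 0 , + 2) ∉ A
  [0,2]∉A = mir {+ 1 , + 1} ([1,1]∉A G)
  [-2,0]∉A : (-[1+ 1 ] , + 0) ∉ A
  [-2,0]∉A = mir { -[1+ 0 ] , -[1+ 0 ]} ([-1,-1]∉A G)

  -- The common neighbours of the facing pair are freed whenever both of its points are deleted; the
  -- larger deletions below start from these two.
  middle : ∀ {J} → (+ 0 , + 0) ∈ J → (-[1+ 0 ] , + 1) ∈ J → ∀ {ls} → All (λ l → l ∉ A × Nb A l × Off A J l) ls →
           All (λ l → l ∉ A × Nb A l × Off A J l) ((+ 0 , + 1) ∷ (-[1+ 0 ] , + 0) ∷ ls)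
  middle o w ls =
      ([0,1]∉A F , there (here (w∈ F)) , inj₁ ([1,1]∉A F) & inj₂ w & inj₁ [0,2]∉A & inj₂ o & All.[])
    & ([-1,0]∉A F , here (o∈ F) , inj₂ o & inj₁ [-2,0]∉A & inj₂ w & inj₁ ([-1,-1]∉A F) & All.[])
    & ls

  pair-off : ∀ {J} → All (Off A J) ((+ 0 , + 0) ∷ (-[1+ 0 ] , + 1) ∷ [])
  pair-off = (inj₁ ([1,0]∉A F) & inj₁ ([-1,0]∉A F) & inj₁ ([0,1]∉A F) & inj₁ ([0,-1]∉A F) & All.[])
           & (inj₁ ([0,1]∉A F) & inj₁ [-2,1]∉A & inj₁ [-1,2]∉A & inj₁ ([-1,0]∉A F) & All.[]) & All.[]

∉-U : ∀ {e : Point} {u J} → U e ≡ u → All (λ j → ¬ (U j ≡ u)) J → e ∉ J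
∉-U e a h = All.lookup a h e

-- Otherwise deleting (0,0) and (-1,1) frees three boundary points.
upper-shared : ∀ {A} → Facing A → Third A → (+ 2 , + 0) ∈ A ⊎ (+ 1 , -[1+ 0 ]) ∈ A
upper-shared {A} F t with (+ 2 , + 0) ∈? A | (+ 1 , -[1+ 0 ]) ∈? A
... | yes h | _ = inj₁ h
... | no _ | yes h = inj₂ h
... | no n₁ | no n₂ = ⊥-elim (squeeze A J ((+ 0 , + 1) ∷ (-[1+ 0 ] , + 0) ∷ (+ 1 , + 0) ∷ []) (min F)
    (λ { (here refl) → o∈ F ; (there (here refl)) → w∈ F })
    two (s≤s (s≤s (s≤s z≤n)))
    (pair-off F)
    (middle F (here refl) (there (here refl))
      (([1,0]∉A F , there (here (o∈ F)) , inj₁ n₁ & inj₂ (here refl) & inj₁ ([1,1]∉A F) & inj₁ n₂ & All.[]) & All.[])))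
  where
  J : List Point
  J = (+ 0 , + 0) ∷ (-[1+ 0 ] , + 1) ∷ []
  two : 2 ℕ.≤ card (A ∖ J)
  two = let e , e∈ , ue = left-outside F t
            r , r∈ , ur = right-outside F t
        in card-two (∈-∖⁺ {A} {J} e∈ (∉-U {e} ue ((λ ()) & (λ ()) & All.[]))) (∈-∖⁺ {A} {J} r∈ (∉-U {r} ur ((λ ()) & (λ ()) & All.[])))
             (λ eq → no-eq (trans (sym ue) (trans (cong U eq) ur)))
    where
    no-eq : ¬ (-[1+ 1 ] ≡ + 4)
    no-eq ()

thirdUD : ∀ {A} → Third A → Third (map (f mirrorUD) A)
thirdUD (t , t∈ , n , n′) = f mirrorUD t , ∈-map⁺ (f mirrorUD) t∈
  , (λ e → n (trans (sym (gf mirrorUD t)) (cong (g mirrorUD) e)))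
  , (λ e → n′ (trans (sym (gf mirrorUD t)) (cong (g mirrorUD) e)))

lower-shared : ∀ {A} → Facing A → Third A → (+ 0 , -[1+ 1 ]) ∈ A ⊎ (+ 1 , -[1+ 0 ]) ∈ A
lower-shared F t = Sum.map (∈-image⁻ mirrorUD) (∈-image⁻ mirrorUD) (upper-shared (facingUD F) (thirdUD t))

-- If it is absent, (2,0) and (0,-2) are both present. Every neighbour of (1,-1) then already
-- touches `A`, so adding it is free and leads to the configuration excluded by `not-both-absorbed`.
[1,-1]∈A : ∀ {A} → Facing A → Third A → (+ 1 , -[1+ 0 ]) ∈ A
[1,-1]∈A {A} F t with (+ 1 , -[1+ 0 ]) ∈? A | upper-shared F t | lower-shared F t
... | yes h | _ | _ = h
... | no _ | inj₂ h | _ = h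
... | no _ | inj₁ _ | inj₂ h = h
... | no n | inj₁ a | inj₁ b = ⊥-elim (not-both-absorbed (facing-∷ F n (-≤+) cost) (in-A (there a)) (in-A (here refl)))
  where
  h : Point
  h = + 1 , -[1+ 0 ]
  cost : bsize (h ∷ A) ℕ.≤ bsize A
  cost = subst (bsize (h ∷ A) ℕ.≤_) (ℕP.+-identityʳ (bsize A)) (add-cost₀ A h []
    (by-A (there (there (here a))) & by-A (there (there (here (o∈ F)))) & by-A (here a) & by-A (there (here b)) & All.[]))

-- Because (1,-1) belongs to `A`, neither (2,0) nor (0,-2) can lie in or touch `A`. Hence (1,-1) is
-- isolated, and deleting it along with the pair removes three points but frees four boundary
-- points.
facing⇒⊥ : ∀ {A} → Facing A → Third A → ⊥
facing⇒⊥ {A} F t = squeeze A J ((+ 0 , + 1) ∷ (-[1+ 0 ] , + 0) ∷ (+ 1 , + 0) ∷ (+ 0 , -[1+ 0 ]) ∷ []) (min F)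
    (λ { (here refl) → e∈ ; (there (here refl)) → o∈ F ; (there (there (here refl))) → w∈ F })
    two (s≤s (s≤s (s≤s (s≤s z≤n))))
    (e-off & pair-off F)
    (middle F (there (here refl)) (there (there (here refl)))
      (([1,0]∉A F , there (here (o∈ F)) , inj₁ [2,0]∉′ & inj₂ (there (here refl)) & inj₁ ([1,1]∉A F) & inj₂ (here refl) & All.[])
      & ([0,-1]∉A F , there (there (here (o∈ F))) , inj₂ (here refl) & inj₁ ([-1,-1]∉A F) & inj₂ (there (here refl)) & inj₁ [0,-2]∉ & All.[])
      & All.[]))
  where
  e : Point
  e = + 1 , -[1+ 0 ]
  J : List Point
  J = e ∷ (+ 0 , + 0) ∷ (-[1+ 0 ] , + 1) ∷ []
  e∈ : e ∈ A
  e∈ = [1,-1]∈A F t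
  [2,0]∉′ : (+ 2 , + 0) ∉ A
  [2,0]∉′ h = not-both-absorbed F (in-A h) (in-A e∈)
  ¬nb : ¬ Nb A (+ 2 , + 0)
  ¬nb h = not-both-absorbed F (by-A h) (in-A e∈)
  e∈′ : e ∈ map (f mirrorUD) A
  e∈′ = ∈-image⁺ mirrorUD e∈
  [0,-2]∉ : (+ 0 , -[1+ 1 ]) ∉ A
  [0,-2]∉ h = not-both-absorbed (facingUD F) (in-A (∈-image⁺ mirrorUD h)) (in-A e∈′)
  ¬nb′ : ¬ Nb A (+ 0 , -[1+ 1 ])
  ¬nb′ h = not-both-absorbed (facingUD F) (by-A (Nb-image⁺ mirrorUD h)) (in-A e∈′)
  [2,-1]∉ : (+ 2 , -[1+ 0 ]) ∉ A
  [2,-1]∉ h = ¬nb (there (there (there (here h))))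
  [1,-2]∉ : (+ 1 , -[1+ 1 ]) ∉ A
  [1,-2]∉ h = ¬nb′ (here h)
  e-off : ∀ {J} → Off A J e
  e-off = inj₁ [2,-1]∉ & inj₁ ([0,-1]∉A F) & inj₁ ([1,0]∉A F) & inj₁ [1,-2]∉ & All.[]
  -- The deletion must leave two points. One lies on U = 4; the other is found on U = -4, since
  -- otherwise deleting (1,-1) alone would free (2,-1) and (1,-2).
  far : ∃[ q ] q ∈ A × U q ≡ -[1+ 3 ]
  far with (+ 3 , -[1+ 0 ]) ∈? A | (+ 2 , -[1+ 1 ]) ∈? A | (+ 1 , -[1+ 2 ]) ∈? A
  ... | yes h | _ | _ = _ , h , refl
  ... | no _ | yes h | _ = _ , h , refl
  ... | no _ | no _ | yes h = _ , h , refl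
  ... | no n₁ | no n₂ | no n₃ = ⊥-elim (squeeze A (e ∷ []) ((+ 2 , -[1+ 0 ]) ∷ (+ 1 , -[1+ 1 ]) ∷ []) (min F)
      (λ { (here refl) → e∈ })
      (card-two (∈-∖⁺ {A} {e ∷ []} (o∈ F) (λ { (here ()) })) (∈-∖⁺ {A} {e ∷ []} (w∈ F) (λ { (here ()) })) (λ ()))
      (s≤s (s≤s z≤n))
      (e-off & All.[])
      (([2,-1]∉ , there (here e∈) , inj₁ n₁ & inj₂ (here refl) & inj₁ [2,0]∉′ & inj₁ n₂ & All.[])
      & ([1,-2]∉ , there (there (here e∈)) , inj₁ n₂ & inj₁ [0,-2]∉ & inj₂ (here refl) & inj₁ n₃ & All.[]) & All.[]))
  two : 2 ℕ.≤ card (A ∖ J)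
  two = let q , q∈ , uq = far
            r , r∈ , ur = right-outside F t
        in card-two (∈-∖⁺ {A} {J} q∈ (∉-U {q} uq ((λ ()) & (λ ()) & (λ ()) & All.[]))) (∈-∖⁺ {A} {J} r∈ (∉-U {r} ur ((λ ()) & (λ ()) & (λ ()) & All.[])))
             (λ eq → no-eq (trans (sym uq) (trans (cong U eq) ur)))
    where
    no-eq : ¬ (-[1+ 3 ] ≡ + 4)
    no-eq ()

-- Diagonals met by a minimal set

facing-at : ∀ A i x → Minimal A → (∀ {p} → p ∈ A → U p + + 1 ≤ i ⊎ i + + 1 ≤ U p) → x ∈ A → U x + + 1 ≡ i → lf (up x) ∈ A →
            (∃[ t ] t ∈ A × ¬ (t ≡ x) × ¬ (t ≡ lf (up x))) → ⊥
facing-at A i x@(a , b) m split x∈ refl x′∈ (t , t∈ , n , n′) = facing⇒⊥ {A′} F third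
  where
  φ = inv (shift x)
  A′ = map (f φ) A
  w-eq : lf (up x) ≡ (-[1+ 0 ] , + 1) ⊞ x
  w-eq = cong₂ _,_ (ℤP.+-comm a -[1+ 0 ]) (ℤP.+-comm b (+ 1))
  l₁ : ∀ x y a b → + 1 - (y - x + + 1) ≡ b - a + + 1 - ((y + b) - (x + a) + + 1) + + 0
  l₁ = solve-∀
  l₂ : ∀ x y a b → y - x - (+ 1 + + 1) ≡ (y + b) - (x + a) - (b - a + + 1 + + 1) + + 0
  l₂ = solve-∀
  F : Facing A′
  F = record
    { min = Minimal-image φ A m
    ; o∈ = ∈-image⁺ φ (subst (_∈ A) (0⊞ x) x∈)
    ; w∈ = ∈-image⁺ φ (subst (_∈ A) w-eq x′∈)
    ; gap = λ {(u , v)} h → Sum.map (λ k → lin1 0 k (l₁ u v a b)) (λ k → lin1 0 k (l₂ u v a b)) (split (∈-image⁻ φ h)) }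
  back : ∀ {q} → f φ t ≡ q → t ≡ q ⊞ x
  back {q} e = trans (sym (gf φ t)) (cong (g φ) e)
  third : Third A′
  third = f φ t , ∈-map⁺ (f φ) t∈ , (λ e → n (trans (back e) (sym (0⊞ x)))) , (λ e → n′ (trans (back e) (sym w-eq)))

Pair : List Point → (Point → Point) → Set
Pair A step = ∃[ x ] x ∈ A × step x ∈ A × (∀ {r} → r ∈ A → r ≡ x ⊎ r ≡ step x)

-- A coincidence across the gap leaves no room for a third point. If there is none, translating one
-- side by (1,1) produces a coincidence that does come with a third point, which is impossible.
gap⇒pair : ∀ A i {p q} → Minimal A → (∀ {r} → r ∈ A → ¬ (U r ≡ i)) → p ∈ A → U p + + 1 ≤ i → q ∈ A → i + + 1 ≤ U q →
           Pair A (lf ∘ up)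
gap⇒pair A i {p} {q} m empty p∈ up≤ q∈ uq≥ = go (Any.any? (λ x → lf (up x) ∈? R) L)
  where
  low? : ∀ p → Dec (U p + + 1 ≤ i)
  low? p = U p + + 1 ℤP.≤? i
  high? : ∀ p → Dec (i + + 1 ≤ U p)
  high? p = i + + 1 ℤP.≤? U p
  L R : List Point
  L = filter low? A
  R = filter high? A
  hL₀ : ∀ {p} → p ∈ L → U p + + 1 ≤ i
  hL₀ h = proj₂ (∈-filter⁻ low? {xs = A} h)
  hR₀ : ∀ {p} → p ∈ R → i + + 1 ≤ U p
  hR₀ h = proj₂ (∈-filter⁻ high? {xs = A} h)
  A⊆ : A ⊆ L ++ R
  A⊆ {r} h with low? r
  ... | yes k = ∈-++⁺ˡ (∈-filter⁺ low? h k)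
  ... | no k = ∈-++⁺ʳ L (∈-filter⁺ high? h (≢⇒< (l (U r) (≰⇒+1≤ k)) (λ e → empty h (sym e))))
    where
    l : ∀ u → i + + 1 ≤ u + + 1 → i ≤ u
    l u h = lin1 0 h (solve (u ∷ i ∷ []))
  L⊆A : L ⊆ A
  L⊆A = proj₁ ∘ ∈-filter⁻ low? {xs = A}
  R⊆A : R ⊆ A
  R⊆A = proj₁ ∘ ∈-filter⁻ high? {xs = A}
  m′ : Minimal (L ++ R)
  m′ = Minimal-cong {A} {L ++ R} A⊆ (∪-⊆ L L⊆A R⊆A) m
  sep₀ : Sep L R
  sep₀ = Slides.sep i L R hL₀ hR₀ m′
  touch : ∃[ z ] z ∈ boundary L × z ∈ boundary R
  touch = contact L R (∈-filter⁺ low? p∈ up≤) (∈-filter⁺ high? q∈ uq≥) m′ sep₀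
  z : Point
  z = proj₁ touch
  hL : ∀ {p} → p ∈ L → U p + + 1 ≤ U z
  hL {p} h = let r , r∈n , r∈R = Nb⁻ (proj₂ (∂⁻ R (proj₂ (proj₂ touch)))) in l (U p) (U r) (U z) (sep₀ h r∈R) (nbU≤ r∈n)
    where
    l : ∀ u w k → u + + 2 ≤ w → w ≤ k + + 1 → u + + 1 ≤ k
    l u w k h h′ = lin2 0 h h′ (solve (u ∷ w ∷ k ∷ []))
  hR : ∀ {p} → p ∈ R → U z + + 1 ≤ U p
  hR {p} h = let r , r∈n , r∈L = Nb⁻ (proj₂ (∂⁻ L (proj₁ (proj₂ touch)))) in l (U p) (U r) (U z) (sep₀ r∈L h) (nbU≤ (nbrs-sym r∈n))
    where
    l : ∀ u w k → w + + 2 ≤ u → k ≤ w + + 1 → k + + 1 ≤ u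
    l u w k h h′ = lin2 0 h h′ (solve (u ∷ w ∷ k ∷ []))
  module S = Slides (U z) L R hL hR m′
  co-U : ∀ {x} {R′ : List Point} → x ∈ L → lf (up x) ∈ R′ → (∀ {p} → p ∈ R′ → U z + + 1 ≤ U p) → U x + + 1 ≡ U z
  co-U {x} x∈ x′∈ h = ℤP.≤-antisym (hL x∈) (l (U x) (U z) (subst (U z + + 1 ≤_) (trans (U-lf (up x)) (cong (_+ + 1) (U-up x))) (h x′∈)))
    where
    l : ∀ u k → k + + 1 ≤ u + + 1 + + 1 → k ≤ u + + 1
    l u k h = lin1 0 h (solve (u ∷ k ∷ []))
  pair : ∀ x → x ∈ L → lf (up x) ∈ R → Pair A (lf ∘ up)
  pair x x∈ x′∈ = x , L⊆A x∈ , R⊆A x′∈ , λ {r} h → dec r h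
    where
    dec : ∀ r → r ∈ A → r ≡ x ⊎ r ≡ lf (up x)
    dec r h with r ≟P x | r ≟P lf (up x)
    ... | yes e | _ = inj₁ e
    ... | no _ | yes e = inj₂ e
    ... | no n | no n′ = ⊥-elim (facing-at A (U z) x m (λ k → ∈-++-elim L (inj₁ ∘ hL) (inj₂ ∘ hR) (A⊆ k)) (L⊆A x∈)
                                  (co-U x∈ x′∈ hR) (R⊆A x′∈) (r , h , n , n′))
  go : Dec (Any (λ x → lf (up x) ∈ R) L) → Pair A (lf ∘ up)
  go (yes h) = let x , x∈ , x′∈ = find h in pair x x∈ x′∈
  go (no h) =
    let x , x∈ , x′∈ , third = N.coincidence²
    in ⊥-elim (facing-at (L ++ S.R²) (U z) x N.minimal² (∈-++-elim L (inj₁ ∘ hL) (inj₂ ∘ N.hR²)) (∈-++⁺ˡ x∈)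
         (co-U x∈ x′∈ N.hR²) (∈-++⁺ʳ L x′∈) third)
    where
    module N = S.NoCoincidence (λ x∈ k → h (lose x∈ k)) (card-pos (∈-∩⁺ {boundary L} (proj₁ (proj₂ touch)) (proj₂ (proj₂ touch))))

gap⇒pairV : ∀ A i {p q} → Minimal A → (∀ {r} → r ∈ A → ¬ (V r ≡ i)) → p ∈ A → V p + + 1 ≤ i → q ∈ A → i + + 1 ≤ V q →
            Pair A (rt ∘ up)
gap⇒pairV A i {p} {q} m empty p∈ vp q∈ vq =
  let x , x∈ , x′∈ , all = gap⇒pair (map swapUV A) i {swapUV p} {swapUV q} (Minimal-image flipA A m)
        (λ {r} h e → empty (∈-image⁻ flipA h) (trans (sym (U-swap′ r)) e))
        (∈-map⁺ swapUV p∈) (subst (λ t → t + + 1 ≤ i) (sym (U-swap p)) vp)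
        (∈-map⁺ swapUV q∈) (subst (i + + 1 ≤_) (sym (U-swap q)) vq)
  in swapUV x , ∈-image⁻ flipA x∈ , subst (_∈ A) (st x) (∈-image⁻ flipA x′∈)
     , λ {r} h → Sum.map (back r x) (λ e → trans (back r (lf (up x)) e) (st x)) (all (∈-map⁺ swapUV h))
  where
  U-swap′ : ∀ r → U r ≡ V (swapUV r)
  U-swap′ r = sym (V-swap r)
  back : ∀ r y → swapUV r ≡ y → r ≡ swapUV y
  back r y e = trans (sym (gf flipA r)) (cong swapUV e)
  st : ∀ x → swapUV (lf (up x)) ≡ rt (up (swapUV x))
  st (x , y) = cong (_, y + + 1) (l x)
    where
    l : ∀ x → - (x - + 1) ≡ - x + + 1
    l = solve-∀

Hull : List Point → Point → Set
Hull A p = ((∃[ r ] r ∈ A × U r ≤ U p) × (∃[ r ] r ∈ A × U p ≤ U r)) × ((∃[ r ] r ∈ A × V r ≤ V p) × (∃[ r ] r ∈ A × V p ≤ V r))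

-- Covers the degenerate minimal sets, a single point and a facing pair, which fill their enclosing
-- boxes. The bound 2 on the extents is for confining minimal sets to a ball later on.
Small : List Point → Set
Small A = (∀ {p} → Hull A p → p ∈ A) × (∀ {r s} → r ∈ A → s ∈ A → U r ≤ U s + + 2 × V r ≤ V s + + 2)

record Gapless (A : List Point) (a c : ℤ) (P Q : ℕ) : Set where
  field
    within : Within A a P c Q
    cols   : Columns A a P
    rows   : Rows A c Q
    1≤P    : 1 ℕ.≤ P
    1≤Q    : 1 ℕ.≤ Q

i≤i+2 : ∀ i → i ≤ i + + 2
i≤i+2 i = ℤP.i≤i+j i (+ 2)

pair⇒small : ∀ A → Pair A (lf ∘ up) → Small A
pair⇒small A (x , x∈ , x′∈ , all) = full , λ r∈ s∈ → diam (all r∈) (all s∈)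
  where
  U′ : U (lf (up x)) ≡ U x + + 2
  U′ = trans (U-lf (up x)) (trans (cong (_+ + 1) (U-up x)) (ℤP.+-assoc (U x) (+ 1) (+ 1)))
  V′ : V (lf (up x)) ≡ V x
  V′ = trans (V-lf (up x)) (trans (cong (_- + 1) (V-up x)) (sym (+1-1 (V x))))
  diam : ∀ {r s} → r ≡ x ⊎ r ≡ lf (up x) → s ≡ x ⊎ s ≡ lf (up x) → U r ≤ U s + + 2 × V r ≤ V s + + 2
  diam (inj₁ refl) (inj₁ refl) = i≤i+2 (U x) , i≤i+2 (V x)
  diam (inj₁ refl) (inj₂ refl) rewrite U′ | V′ = ≤-trans (i≤i+2 (U x)) (i≤i+2 (U x + + 2)) , i≤i+2 (V x)
  diam (inj₂ refl) (inj₁ refl) rewrite U′ | V′ = ≤-refl , i≤i+2 (V x)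
  diam (inj₂ refl) (inj₂ refl) rewrite U′ | V′ = i≤i+2 (U x + + 2) , i≤i+2 (V x)
  Umin : ∀ {r} → r ∈ A → U x ≤ U r
  Umin h with all h
  ... | inj₁ refl = ≤-refl
  ... | inj₂ refl = subst (U x ≤_) (sym U′) (i≤i+2 (U x))
  Umax : ∀ {r} → r ∈ A → U r ≤ U x + + 2
  Umax h with all h
  ... | inj₁ refl = i≤i+2 (U x)
  ... | inj₂ refl = ≤-reflexive U′
  Veq : ∀ {r} → r ∈ A → V r ≡ V x
  Veq h with all h
  ... | inj₁ refl = refl
  ... | inj₂ refl = V′
  full : ∀ {p} → Hull A p → p ∈ A
  full {p} (((r₁ , r₁∈ , h₁) , (r₂ , r₂∈ , h₂)) , ((r₃ , r₃∈ , h₃) , (r₄ , r₄∈ , h₄))) with U p ℤP.≤? U x + + 1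
  ... | yes k = subst (_∈ A) (sym (parity-UV p x Vp k (≤-trans lo (ℤP.i≤i+j (U p) (+ 1))))) x∈
    where
    Vp : V p ≡ V x
    Vp = ℤP.≤-antisym (≤-trans h₄ (≤-reflexive (Veq r₄∈))) (≤-trans (≤-reflexive (sym (Veq r₃∈))) h₃)
    lo : U x ≤ U p
    lo = ≤-trans (Umin r₁∈) h₁
  ... | no k = subst (_∈ A) (sym (UV-inj p (lf (up x)) (ℤP.≤-antisym (≤-trans h₂ (≤-trans (Umax r₂∈) (≤-reflexive (sym U′))))
                 (≤-trans (≤-reflexive (trans U′ (sym (ℤP.+-assoc (U x) (+ 1) (+ 1))))) (≰⇒+1≤ k))) (trans Vp (sym V′)))) x′∈
    where
    Vp : V p ≡ V x
    Vp = ℤP.≤-antisym (≤-trans h₄ (≤-reflexive (Veq r₄∈))) (≤-trans (≤-reflexive (sym (Veq r₃∈))) h₃)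

hull-swap : ∀ {A p} → Hull A p → Hull (map swapUV A) (swapUV p)
hull-swap {A} {p} (((r₁ , r₁∈ , h₁) , (r₂ , r₂∈ , h₂)) , ((r₃ , r₃∈ , h₃) , (r₄ , r₄∈ , h₄))) =
  ((_ , ∈-map⁺ swapUV r₃∈ , subst₂ _≤_ (sym (U-swap r₃)) (sym (U-swap p)) h₃) , (_ , ∈-map⁺ swapUV r₄∈ , subst₂ _≤_ (sym (U-swap p)) (sym (U-swap r₄)) h₄))
  , ((_ , ∈-map⁺ swapUV r₁∈ , subst₂ _≤_ (sym (V-swap r₁)) (sym (V-swap p)) h₁) , (_ , ∈-map⁺ swapUV r₂∈ , subst₂ _≤_ (sym (V-swap p)) (sym (V-swap r₂)) h₂))

small-swap : ∀ A → Small (map swapUV A) → Small A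
small-swap A (full , diam) =
  (λ {p} h → subst (_∈ A) (gf flipA p) (∈-image⁻ flipA (full (hull-swap {A} {p} h))))
  , λ {r} {s} r∈ s∈ → let h , k = diam (∈-map⁺ swapUV r∈) (∈-map⁺ swapUV s∈)
                      in subst₂ (λ a b → a ≤ b + + 2) (V-swap r) (V-swap s) k , subst₂ (λ a b → a ≤ b + + 2) (U-swap r) (U-swap s) h

pairV⇒small : ∀ A → Pair A (rt ∘ up) → Small A
pairV⇒small A (x , x∈ , x′∈ , all) = small-swap A (pair⇒small (map swapUV A)
  (swapUV x , ∈-map⁺ swapUV x∈ , subst (_∈ map swapUV A) (st x) (∈-map⁺ swapUV x′∈)
  , λ {r} h → Sum.map (back r x) (λ e → trans (back r (rt (up x)) e) (st x)) (all (∈-image⁻ flipA h))))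
  where
  back : ∀ r y → swapUV r ≡ y → r ≡ swapUV y
  back r y e = trans (sym (gf flipA r)) (cong swapUV e)
  st : ∀ x → swapUV (rt (up x)) ≡ lf (up (swapUV x))
  st (x , y) = cong (_, y + + 1) (l x)
    where
    l : ∀ x → - (x + + 1) ≡ - x - + 1
    l = solve-∀

range : (h : Point → ℤ) → ∀ A {p} → p ∈ A → ∃[ a ] ∃[ P ] (∀ {r} → r ∈ A → a ≤ h r × h r ≤ a + + P) ×
        (∃[ r ] r ∈ A × h r ≡ a) × (∃[ r ] r ∈ A × h r ≡ a + + P)
range h A p∈ =
  let q , q∈ , mn = argmin h p∈
      s , s∈ , mx = argmax h p∈
      e = eq (h q) (h s) (mn s∈)
  in h q , ∣ h s - h q ∣ , (λ k → mn k , subst (h _ ≤_) (sym e) (mx k)) , (q , q∈ , refl) , (s , s∈ , sym e)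
  where
  eq : ∀ a b → a ≤ b → a + + ∣ b - a ∣ ≡ b
  eq a b k = trans (cong (λ t → a + t) (ℤP.0≤i⇒+∣i∣≡i (ℤP.i≤j⇒0≤j-i k))) (l a b)
    where
    l : ∀ a b → a + (b - a) ≡ b
    l = solve-∀

occupied : (h : Point → ℤ) → ∀ A a n → (∀ j → j ℕ.≤ n → ∃[ r ] r ∈ A × h r ≡ a + + j) ⊎ (∃[ j ] j ℕ.≤ n × (∀ {r} → r ∈ A → ¬ (h r ≡ a + + j)))
occupied h A a n with Any.any? (λ r → h r ℤP.≟ a + + n) A
... | no k = inj₂ (n , ℕP.≤-refl , λ r∈ e → k (lose r∈ e))
occupied h A a zero | yes k = inj₁ λ { zero z≤n → find k }
occupied h A a (suc n) | yes k with occupied h A a n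
... | inj₂ (j , j≤ , e) = inj₂ (j , ℕP.m≤n⇒m≤1+n j≤ , e)
... | inj₁ all = inj₁ λ j j≤ → [ (λ lt → all j (ℕ.s≤s⁻¹ lt)) , (λ { refl → find k }) ]′ (ℕP.m≤n⇒m<n∨m≡n j≤)

interior-gap : (h : Point → ℤ) → ∀ A a P → (∃[ r ] r ∈ A × h r ≡ a) → (∃[ r ] r ∈ A × h r ≡ a + + P) →
  ∀ j → j ℕ.≤ P → (∀ {r} → r ∈ A → ¬ (h r ≡ a + + j)) →
  (∃[ r ] r ∈ A × h r + + 1 ≤ a + + j) × (∃[ r ] r ∈ A × a + + j + + 1 ≤ h r)
interior-gap h A a P (r , r∈ , e) (s , s∈ , e′) j j≤ empty =
  (r , r∈ , ≢⇒< (subst (_≤ a + + j) (sym e) (ℤP.i≤i+j a (+ j))) (empty r∈))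
  , (s , s∈ , ≢⇒< (subst (a + + j ≤_) (sym e′) (ℤP.+-monoʳ-≤ a (+≤+ j≤))) (λ k → empty s∈ (sym k)))

structure : ∀ A {p} → p ∈ A → Minimal A → (∃[ a ] ∃[ c ] ∃[ P ] ∃[ Q ] Gapless A a c P Q) ⊎ Small A
structure A p∈ m =
  let a , P , inU , minU , maxU = range U A p∈
      c , Q , inV , minV , maxV = range V A p∈
  in go a P inU minU maxU c Q inV minV maxV (occupied U A a P) (occupied V A c Q)
  where
  flat : ∀ a P c Q → (∀ {r} → r ∈ A → a ≤ U r × U r ≤ a + + P) → (∀ {r} → r ∈ A → c ≤ V r × V r ≤ c + + Q) →
         Columns A a P → Rows A c Q → (∃[ a ] ∃[ c ] ∃[ P ] ∃[ Q ] Gapless A a c P Q) ⊎ Small A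
  flat a (suc P) c (suc Q) inU inV cols rows =
    inj₁ (a , c , suc P , suc Q , record { within = λ h → inU h , inV h ; cols = cols ; rows = rows ; 1≤P = s≤s z≤n ; 1≤Q = s≤s z≤n })
  flat a zero c zero inU inV cols rows = inj₂
    ( (λ {p} (((r₁ , r₁∈ , h₁) , (r₂ , r₂∈ , h₂)) , ((r₃ , r₃∈ , h₃) , (r₄ , r₄∈ , h₄))) →
         subst (_∈ A) (UV-inj r₁ p (ℤP.≤-antisym h₁ (one h₂ (proj₂ (inU r₂∈)) (proj₁ (inU r₁∈))))
           (ℤP.≤-antisym (one ≤-refl (proj₂ (inV r₁∈)) (≤-trans (proj₁ (inV r₃∈)) h₃)) (one h₄ (proj₂ (inV r₄∈)) (proj₁ (inV r₁∈))))) r₁∈)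
    , λ r∈ s∈ → ≤-trans (proj₂ (inU r∈)) (two (proj₁ (inU s∈))) , ≤-trans (proj₂ (inV r∈)) (two (proj₁ (inV s∈))) )
    where
    one : ∀ {i j k l} → i ≤ j → j ≤ k + + 0 → k ≤ l → i ≤ l
    one {k = k} h₁ h₂ h₃ = ≤-trans h₁ (≤-trans h₂ (subst (_≤ _) (sym (ℤP.+-identityʳ k)) h₃))
    two : ∀ {k l} → k ≤ l → k + + 0 ≤ l + + 2
    two {k} {l} h = ≤-trans (subst (_≤ l) (sym (ℤP.+-identityʳ k)) h) (i≤i+2 l)
  -- On a single diagonal V = c, consecutive values of U cannot both occur, by parity.
  flat a (suc P) c zero inU inV cols rows =
    let r , r∈ , e = cols 0 z≤n
        s , s∈ , e′ = cols 1 (s≤s z≤n)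
        r≡s = parity-UV r s (ℤP.≤-antisym (ww (proj₂ (inV r∈)) (proj₁ (inV s∈))) (ww (proj₂ (inV s∈)) (proj₁ (inV r∈))))
                (subst₂ (λ i j → i ≤ j + + 1) (sym e) (sym e′) (lin0 2 (l₁ a))) (subst₂ (λ i j → i ≤ j + + 1) (sym e′) (sym e) (lin0 0 (l₂ a)))
    in ⊥-elim (absurd a (trans (sym e) (trans (cong U r≡s) e′)))
    where
    l₁ : ∀ a → a + + 1 + + 1 - (a + + 0) ≡ + 2
    l₁ = solve-∀
    l₂ : ∀ a → a + + 0 + + 1 - (a + + 1) ≡ + 0
    l₂ = solve-∀
    ww : ∀ {i j} → i ≤ c + + 0 → c ≤ j → i ≤ j
    ww {i} {j} h k = ≤-trans (subst (i ≤_) (ℤP.+-identityʳ c) h) k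
    absurd : ∀ a → ¬ (a + + 0 ≡ a + + 1)
    absurd a e = 1≰0 (lin1 0 (≤-reflexive (sym e)) (solve (a ∷ [])))
  flat a zero c (suc Q) inU inV cols rows =
    let r , r∈ , e = rows 0 z≤n
        s , s∈ , e′ = rows 1 (s≤s z≤n)
        r≡s = parity-VU r s (ℤP.≤-antisym (ww (proj₂ (inU r∈)) (proj₁ (inU s∈))) (ww (proj₂ (inU s∈)) (proj₁ (inU r∈))))
                (subst₂ (λ i j → i ≤ j + + 1) (sym e) (sym e′) (lin0 2 (l₁ c))) (subst₂ (λ i j → i ≤ j + + 1) (sym e′) (sym e) (lin0 0 (l₂ c)))
    in ⊥-elim (absurd c (trans (sym e) (trans (cong V r≡s) e′)))
    where
    l₁ : ∀ a → a + + 1 + + 1 - (a + + 0) ≡ + 2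
    l₁ = solve-∀
    l₂ : ∀ a → a + + 0 + + 1 - (a + + 1) ≡ + 0
    l₂ = solve-∀
    ww : ∀ {i j} → i ≤ a + + 0 → a ≤ j → i ≤ j
    ww {i} {j} h k = ≤-trans (subst (i ≤_) (ℤP.+-identityʳ a) h) k
    absurd : ∀ a → ¬ (a + + 0 ≡ a + + 1)
    absurd a e = 1≰0 (lin1 0 (≤-reflexive (sym e)) (solve (a ∷ [])))
  go : ∀ a P → (∀ {r} → r ∈ A → a ≤ U r × U r ≤ a + + P) → (∃[ r ] r ∈ A × U r ≡ a) → (∃[ r ] r ∈ A × U r ≡ a + + P) →
       ∀ c Q → (∀ {r} → r ∈ A → c ≤ V r × V r ≤ c + + Q) → (∃[ r ] r ∈ A × V r ≡ c) → (∃[ r ] r ∈ A × V r ≡ c + + Q) →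
       Columns A a P ⊎ (∃[ j ] j ℕ.≤ P × (∀ {r} → r ∈ A → ¬ (U r ≡ a + + j))) →
       Rows A c Q ⊎ (∃[ j ] j ℕ.≤ Q × (∀ {r} → r ∈ A → ¬ (V r ≡ c + + j))) →
       (∃[ a ] ∃[ c ] ∃[ P ] ∃[ Q ] Gapless A a c P Q) ⊎ Small A
  go a P inU minU maxU c Q inV minV maxV (inj₂ (j , j≤ , empty)) _ =
    let (r , r∈ , hr) , (s , s∈ , hs) = interior-gap U A a P minU maxU j j≤ empty
    in inj₂ (pair⇒small A (gap⇒pair A (a + + j) m empty r∈ hr s∈ hs))
  go a P inU minU maxU c Q inV minV maxV (inj₁ _) (inj₂ (j , j≤ , empty)) =
    let (r , r∈ , hr) , (s , s∈ , hs) = interior-gap V A c Q minV maxV j j≤ empty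
    in inj₂ (pairV⇒small A (gap⇒pairV A (c + + j) m empty r∈ hr s∈ hs))
  go a P inU minU maxU c Q inV minV maxV (inj₁ cols) (inj₁ rows) = flat a P c Q inU inV cols rows

-- Sets attaining the diagonal bound

record Tight (A : List Point) (a c : ℤ) (P Q : ℕ) : Set where
  field
    gapless : Gapless A a c P Q
    bound   : bsize A ℕ.≤ suc P ℕ.+ (3 ℕ.+ Q)
  open Gapless gapless public

TightSet : List Point → Set
TightSet A = ∃[ a ] ∃[ c ] ∃[ P ] ∃[ Q ] Tight A a c P Q

U-swapA : ∀ p → U (f swapA p) ≡ - U p
U-swapA (x , y) = l x y
  where
  l : ∀ x y → x - y ≡ - (y - x)
  l = solve-∀

V-swapA : ∀ p → V (f swapA p) ≡ V p
V-swapA (x , y) = ℤP.+-comm x y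

-- The count behind the lower bound treats the directions differently, but the bound is symmetric.
-- Each reflection therefore extracts new information from equality.
tight-flip : ∀ A → TightSet A → TightSet (map swapUV A)
tight-flip A (a , c , P , Q , T) = c , a , Q , P , record
  { gapless = record
    { within = λ {p} h → let hu , hv = within (∈-image⁻ flipA h) in
        (subst (λ t → c ≤ t × t ≤ c + + Q) (V-swap p) hv) , (subst (λ t → a ≤ t × t ≤ a + + P) (U-swap p) hu)
    ; cols = λ j j≤ → let r , r∈ , e = rows j j≤ in swapUV r , ∈-map⁺ swapUV r∈ , trans (U-swap r) e
    ; rows = λ j j≤ → let r , r∈ , e = cols j j≤ in swapUV r , ∈-map⁺ swapUV r∈ , trans (V-swap r) e
    ; 1≤P = 1≤Q ; 1≤Q = 1≤P }
  ; bound = subst₂ ℕ._≤_ (sym (bsize-image flipA A)) (l P Q) bound }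
  where
  open Tight T
  l : ∀ P Q → 1 ℕ.+ P ℕ.+ (3 ℕ.+ Q) ≡ 1 ℕ.+ Q ℕ.+ (3 ℕ.+ P)
  l = ℕS.solve-∀

tight-swap : ∀ A → TightSet A → TightSet (map (f swapA) A)
tight-swap A (a , c , P , Q , T) = - (a + + P) , c , P , Q , record
  { gapless = record
    { within = λ {p} h → let (h₁ , h₂) , hv = within (∈-image⁻ swapA h) in
          ( lin1 0 (subst (_≤ a + + P) (U-swapA p) h₂) (l₁ (U p) (a + + P))
          , lin1 0 (subst (a ≤_) (U-swapA p) h₁) (l₂ (U p) a (+ P)))
        , subst (λ t → c ≤ t × t ≤ c + + Q) (V-swapA p) hv
    ; cols = λ j j≤ → let r , r∈ , e = cols (P ℕ.∸ j) (ℕP.m∸n≤m P j) in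
        f swapA r , ∈-map⁺ (f swapA) r∈ , trans (U-swapA r) (trans (cong -_ e) (trans (l₃ a (+ (P ℕ.∸ j)) (+ j)) (cong (λ t → - (a + t) + + j) (cong +_ (ℕP.m∸n+n≡m j≤)))))
    ; rows = λ j j≤ → let r , r∈ , e = rows j j≤ in f swapA r , ∈-map⁺ (f swapA) r∈ , trans (V-swapA r) e
    ; 1≤P = 1≤P ; 1≤Q = 1≤Q }
  ; bound = subst (ℕ._≤ suc P ℕ.+ (3 ℕ.+ Q)) (sym (bsize-image swapA A)) bound }
  where
  open Tight T
  l₁ : ∀ u b → u - - b ≡ b - - u + + 0
  l₁ = solve-∀
  l₂ : ∀ u a p → - (a + p) + p - u ≡ - u - a + + 0
  l₂ = solve-∀
  l₃ : ∀ a i j → - (a + i) ≡ - (a + (i + j)) + j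
  l₃ = solve-∀

between : ∀ a P u → a ≤ u → u ≤ a + + P → ∃[ j ] j ℕ.≤ P × u ≡ a + + j
between a P u h k = ∣ u - a ∣ , ℤP.drop‿+≤+ (subst (_≤ + P) (sym e) (lin1 0 k (l₂ a u (+ P)))) , trans (l₁ a u) (cong (λ t → a + t) (sym e))
  where
  e : + ∣ u - a ∣ ≡ u - a
  e = ℤP.0≤i⇒+∣i∣≡i (ℤP.i≤j⇒0≤j-i h)
  l₁ : ∀ a u → u ≡ a + (u - a)
  l₁ = solve-∀
  l₂ : ∀ a u p → p - (u - a) ≡ a + p - u + + 0
  l₂ = solve-∀

column : ∀ {A} → TightSet A → ∀ {r s u} → r ∈ A → U r ≤ u → s ∈ A → u ≤ U s → ∃[ t ] t ∈ A × U t ≡ u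
column (a , c , P , Q , T) {u = u} r∈ h s∈ k =
  let j , j≤ , e = between a P u (≤-trans (proj₁ (proj₁ (within r∈))) h) (≤-trans k (proj₂ (proj₁ (within s∈))))
      t , t∈ , e′ = cols j j≤
  in t , t∈ , trans e′ (sym e)
  where open Tight T

row : ∀ {A} → TightSet A → ∀ {r s v} → r ∈ A → V r ≤ v → s ∈ A → v ≤ V s → ∃[ t ] t ∈ A × V t ≡ v
row (a , c , P , Q , T) {v = v} r∈ h s∈ k =
  let j , j≤ , e = between c Q v (≤-trans (proj₁ (proj₂ (within r∈))) h) (≤-trans k (proj₂ (proj₂ (within s∈))))
      t , t∈ , e′ = rows j j≤
  in t , t∈ , trans e′ (sym e)
  where open Tight T

no-extra : ∀ {A x} → TightSet A → ¬ Extra A x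
no-extra {A} {x} (a , c , P , Q , T) ex = ℕP.<-irrefl refl (begin-strict
  suc P ℕ.+ (3 ℕ.+ Q)                     <⟨ ℕP.+-monoʳ-< (suc P) (ℕP.≤-reflexive (ℕP.+-comm 1 (3 ℕ.+ Q))) ⟩
  suc P ℕ.+ (3 ℕ.+ Q ℕ.+ 1)               ≤⟨ boundary-count A a c P Q cols rows 1≤Q (x ∷ []) (λ { (here refl) → ex }) ⟩
  bsize A                                 ≤⟨ bound ⟩
  suc P ℕ.+ (3 ℕ.+ Q)                     ∎)
  where
  open Tight T
  open ℕP.≤-Reasoning

-- All points of the three families touch `A`, so a point of `A` without a neighbour in `A` would be
-- extra.
tight⇒Nb : ∀ {A x} → TightSet A → x ∈ A → Nb A x
tight⇒Nb {A} {x} T x∈ with Nb? A x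
... | yes n = n
... | no n = ⊥-elim (no-extra {A} {x} T (mkExtra (inj₁ x∈)
    (λ r∈ e → n (subst (Nb A) e (Nb-up r∈))) (λ b e → n (subst (Nb A) e (Nb-lf (proj₁ b)))) (λ l → n (proj₁ l))))

-- Otherwise `lf r` would be extra: `dn (lf r)` is missing, `r` is not lowest on its diagonal
-- because of `s`, and `dn r` also touches `A`, with the same V as `lf r` and smaller U.
column-run : ∀ {A r s} → TightSet A → r ∈ A → dn (lf r) ∉ A → s ∈ A → U s ≡ U r → V s + + 1 ≤ V r → ⊥
column-run {A} {r} {s} T r∈ gap s∈ e lt = no-extra {A} {lf r} T (mkExtra (inj₂ (Nb-lf r∈))
  (λ {t} t∈ e′ → gap (subst (_∈ A) (trans (sym (dn-up t)) (cong dn e′)) t∈))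
  (λ {t} b e′ → bot (trans (sym (rt-lf t)) (trans (cong rt e′) (rt-lf r))) b)
  (λ (_ , m) → l (U r) (subst₂ _≤_ (U-lf r) (U-dn r) (m (Nb-dn r∈) (trans (V-dn r) (sym (V-lf r)))))))
  where
  bot : ∀ {t} → t ≡ r → IsBot A t → ⊥
  bot refl (_ , m) = i+1≰i {V s} (≤-trans lt (m s∈ e))
  l : ∀ u → u + + 1 ≤ u - + 1 → ⊥
  l u h = 1≰0 (lin1 1 h (solve (u ∷ [])))

UV-dnlf : ∀ p → U (dn (lf p)) ≡ U p × V (dn (lf p)) ≡ V p - + 2
UV-dnlf p = trans (U-dn (lf p)) (trans (cong (_- + 1) (U-lf p)) (sym (+1-1 (U p))))
          , trans (V-dn (lf p)) (trans (cong (_- + 1) (V-lf p)) (l (V p)))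
  where
  l : ∀ v → v - + 1 - + 1 ≡ v - + 2
  l = solve-∀

-- The first point of `A` at or above `p` on the diagonal is at least two units of V above `p`, by
-- parity. Its predecessor is missing, so `column-run` forbids points of `A` further down.
one-sided : ∀ {A p r s} → TightSet A → p ∉ A → r ∈ A → U r ≡ U p → V p ≤ V r → s ∈ A → U s ≡ U p → V s ≤ V p → ⊥
one-sided {A} {p} {r} {s} T p∉ r∈ er hr s∈ es hs =
  let q , q∈ , mn = argmin V {F} {r} (∈-filter⁺ above? (∈-filter⁺ same? r∈ er) hr)
      q∈′ , hq = ∈-filter⁻ above? {xs = filter same? A} q∈
      q∈A , eq = ∈-filter⁻ same? {xs = A} q∈′
      hq′ = far q q∈A eq hq
      e₁ , e₂ = UV-dnlf q
  in column-run {A} {q} {s} T q∈A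
       (λ k → l₂ (V q) (subst (V q ≤_) e₂ (mn (∈-filter⁺ above? (∈-filter⁺ same? k (trans e₁ eq)) (subst (V p ≤_) (sym e₂) (l₃ (V p) (V q) hq′))))))
       s∈ (trans es (sym eq)) (l₁ (V s) (V p) (V q) hs hq′)
  where
  same? : ∀ t → Dec (U t ≡ U p)
  same? t = U t ℤP.≟ U p
  above? : ∀ t → Dec (V p ≤ V t)
  above? t = V p ℤP.≤? V t
  F : List Point
  F = filter above? (filter same? A)
  l₁ : ∀ s p q → s ≤ p → p + + 1 + + 1 ≤ q → s + + 1 ≤ q
  l₁ s p q h k = lin2 1 h k (solve (s ∷ p ∷ q ∷ []))
  l₂ : ∀ q → q ≤ q - + 2 → ⊥
  l₂ q h = 1≰0 (lin1 1 h (solve (q ∷ [])))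
  l₃ : ∀ p q → p + + 1 + + 1 ≤ q → p ≤ q - + 2
  l₃ p q h = lin1 0 h (solve (p ∷ q ∷ []))
  far : ∀ q → q ∈ A → U q ≡ U p → V p ≤ V q → V p + + 1 + + 1 ≤ V q
  far q q∈ e h with V q ℤP.≤? V p + + 1
  ... | no k = ≰⇒+1≤ k
  ... | yes k = ⊥-elim (p∉ (subst (_∈ A) (parity-VU q p e k (≤-trans h (ℤP.i≤i+j (V q) (+ 1)))) q∈))

-- After the reflection, the diagonals U = const are those on which the count takes the extreme
-- point touching `A`, and `e` is not extreme because of `t`. The absence of `dn e` and `lf e`
-- excludes the other two families, so `e` would be extra.
closure-run : ∀ {A e t} → TightSet A → Nb A e → dn e ∉ A → lf e ∉ A → Nb A t → U t ≡ U e → V t + + 1 ≤ V e → ⊥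
closure-run {A} {e} {t} T ne d∉ l∉ nt eq lt = no-extra {map swapUV A} {swapUV e} (tight-flip A T) (mkExtra
  (inj₂ (img ne))
  (λ {r} r∈ e′ → d∉ (subst (_∈ A) (gf flipA (dn e)) (∈-image⁻ flipA (subst (_∈ map swapUV A) (trans (sym (dn-up r)) (cong dn e′)) r∈))))
  (λ {r} b e′ → l∉ (subst (_∈ A) (st r e′) (∈-image⁻ flipA (proj₁ b))))
  (λ (_ , m) → i+1≰i {V t} (≤-trans lt (subst₂ _≤_ (U-swap e) (U-swap t) (m (img nt) (trans (V-swap t) (trans eq (sym (V-swap e)))))))))
  where
  img : ∀ {q} → Nb A q → Nb (map swapUV A) (swapUV q)
  img {q} n = Nb-image⁺ flipA (subst (Nb A) (sym (gf flipA q)) n)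
  st : ∀ r → lf r ≡ swapUV e → swapUV r ≡ lf e
  st r e′ = trans (cong swapUV (trans (sym (rt-lf r)) (cong rt e′))) (cong (_, proj₂ e) (l (proj₁ e)))
    where
    l : ∀ x → - (- x + + 1) ≡ x - + 1
    l = solve-∀

halve : ∀ d → ∃[ k ] (d ≡ k ℕ.+ k ⊎ d ≡ suc (k ℕ.+ k))
halve zero = 0 , inj₁ refl
halve (suc d) with halve d
... | k , inj₁ e = k , inj₂ (cong suc e)
... | k , inj₂ e = suc k , inj₁ (cong suc (trans e (sym (ℕP.+-suc k k))))

-- The lowest points of consecutive diagonals U = const (of the parity of p) cannot jump over p,
-- since the diagonals of N(A) have no gaps.
module _ {A : List Point} {p : Point} (T : TightSet A)
         (col-above : ∀ {r} → r ∈ A → U r ≡ U p → V p + + 1 ≤ V r)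
         (row-right : ∀ {r} → r ∈ A → V r ≡ V p → U p + + 1 ≤ U r)
         {east : Point} (east∈ : east ∈ A) (east≥ : U p ≤ U east) where

  private
    Low : ℕ → Point → Set
    Low k r = U r + + (k ℕ.+ k) ≡ U p × V r + + 1 ≤ V p

    ≤U : ∀ {k r} → U r + + (k ℕ.+ k) ≡ U p → U r ≤ U p
    ≤U {k} {r} e = subst (U r ≤_) e (ℤP.i≤i+j (U r) (+ (k ℕ.+ k)))

    -- By `none` and `row-right`, the part of `A` two diagonals on lies entirely above the level of
    -- `p`, while `w` lies below it. Neither lower neighbour of `dn q` belongs to `A`, yet `up w`
    -- touches `A` further down on the diagonal in between, against `closure-run`.
    jump : ∀ k w q → w ∈ A → Low (suc k) w → (∀ {r} → r ∈ A → ¬ Low k r) → q ∈ A → U q ≡ U w + + 2 →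
           (∀ {t} → t ∈ A → U t ≡ U q → V q ≤ V t) → ⊥
    jump k w q w∈ (ew , lw) none q∈ Uq lowest = closure-run {A} {dn q} {up w} T (Nb-dn q∈) below₁ below₂ (Nb-up w∈)
        (trans (U-up w) (trans (l₁ (U w)) (trans (cong (_- + 1) (sym Uq)) (sym (U-dn q)))))
        (subst₂ _≤_ (cong (_+ + 1) (sym (V-up w))) (sym (V-dn q)) (l₂ (V w) (V p) (V q) Vw (above q∈ Uq)))
      where
      l₁ : ∀ u → u + + 1 ≡ u + + 2 - + 1
      l₁ = solve-∀
      l₂ : ∀ w p q → w + + 1 + + 1 ≤ p → p + + 1 ≤ q → w + + 1 + + 1 ≤ q - + 1
      l₂ w p q h k = lin2 0 h k (solve (w ∷ p ∷ q ∷ []))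
      U₂ : U w + + 2 + + (k ℕ.+ k) ≡ U p
      U₂ = trans (ℤP.+-assoc (U w) (+ 2) (+ (k ℕ.+ k))) (trans (cong (λ n → U w + + n) (cong suc (sym (ℕP.+-suc k k)))) ew)
      above : ∀ {r} → r ∈ A → U r ≡ U w + + 2 → V p + + 1 ≤ V r
      above {r} r∈ e = ≢⇒< (weak r∈ e) (λ ev → i+1≰i {U p} (≤-trans (row-right r∈ (sym ev)) (≤U {k} {r} (trans (cong (_+ + (k ℕ.+ k)) e) U₂))))
        where
        weak : ∀ {r} → r ∈ A → U r ≡ U w + + 2 → V p ≤ V r
        weak {r} r∈ e with V p ℤP.≤? V r
        ... | yes h = h
        ... | no h = ⊥-elim (none r∈ (trans (cong (_+ + (k ℕ.+ k)) e) U₂ , ≰⇒+1≤ h))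
      -- The point of the diagonal of `w` at the level of `p`. It is kept out of `A` by `row-right`,
      -- so that `one-sided` applies at it.
      m : Point
      m = proj₁ p + + suc k , proj₂ p - + suc k
      Um : U m ≡ U w
      Um = trans (l₃ (proj₁ p) (proj₂ p) (+ suc k)) (trans (cong (_- (+ suc k + + suc k)) (sym ew)) (l₄ (U w) (+ suc k)))
        where
        l₃ : ∀ x y k → y - k - (x + k) ≡ y - x - (k + k)
        l₃ = solve-∀
        l₄ : ∀ w k → w + (k + k) - (k + k) ≡ w
        l₄ = solve-∀
      Vm : V m ≡ V p
      Vm = l₃ (proj₁ p) (proj₂ p) (+ suc k)
        where
        l₃ : ∀ x y k → y - k + (x + k) ≡ y + x
        l₃ = solve-∀
      m∉ : m ∉ A
      m∉ h = i+1≰i {U p} (≤-trans (row-right h Vm) (subst (_≤ U p) (sym Um) (≤U {suc k} {w} ew)))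
      Vw : V w + + 1 + + 1 ≤ V p
      Vw with V p ℤP.≤? V w + + 1
      ... | no h = ≰⇒+1≤ h
      ... | yes h = ⊥-elim (m∉ (subst (_∈ A) (parity-VU w m (sym Um) (subst (λ t → V w ≤ t + + 1) (sym Vm) (lw′ (V w) (V p) lw)) (subst (_≤ V w + + 1) (sym Vm) h)) w∈))
        where
        lw′ : ∀ w p → w + + 1 ≤ p → w ≤ p + + 1
        lw′ w p h = lin1 2 h (solve (w ∷ p ∷ []))
      below₂ : lf (dn q) ∉ A
      below₂ h = let e₁ , e₂ = UV-dnlf q in l (V q) (subst (V q ≤_) e₂ (lowest h e₁))
        where
        l : ∀ v → v ≤ v - + 2 → ⊥
        l v h = 1≰0 (lin1 1 h (solve (v ∷ [])))
      Ud : U (dn (dn q)) ≡ U w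
      Ud = trans (U-dn (dn q)) (trans (cong (_- + 1) (U-dn q)) (trans (cong (λ t → t - + 1 - + 1) Uq) (l′ (U w))))
        where
        l′ : ∀ u → u + + 2 - + 1 - + 1 ≡ u
        l′ = solve-∀
      below₁ : dn (dn q) ∉ A
      below₁ h with V p ℤP.≤? V (dn (dn q))
      ... | yes k′ = one-sided {A} {m} {dn (dn q)} {w} T m∉ h (trans Ud (sym Um)) (subst (_≤ V (dn (dn q))) (sym Vm) k′) w∈ (sym Um)
                      (subst (V w ≤_) (sym Vm) (l (V w) (V p) lw))
        where
        l : ∀ w p → w + + 1 ≤ p → w ≤ p
        l w p h = lin1 1 h (solve (w ∷ p ∷ []))
      ... | no k′ = m∉ (subst (_∈ A) (parity-VU (dn (dn q)) m (trans Ud (sym Um))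
                      (subst (λ t → V (dn (dn q)) ≤ t + + 1) (sym Vm) (l (V (dn (dn q))) (V p) (≰⇒+1≤ k′)))
                      (subst₂ (λ s t → s ≤ t + + 1) (sym Vm) (sym Vd) (l″ (V p) (V q) (above q∈ Uq)))) h)
        where
        Vd : V (dn (dn q)) ≡ V q - + 1 - + 1
        Vd = trans (V-dn (dn q)) (cong (_- + 1) (V-dn q))
        l : ∀ w p → w + + 1 ≤ p → w ≤ p + + 1
        l w p h = lin1 2 h (solve (w ∷ p ∷ []))
        l″ : ∀ p q → p + + 1 ≤ q → p ≤ q - + 1 - + 1 + + 1
        l″ p q h = lin1 0 h (solve (p ∷ q ∷ []))

    step : ∀ k w → w ∈ A → Low (suc k) w → (∀ {r} → r ∈ A → ¬ Low k r) → ⊥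
    step k w w∈ low none =
      let t , t∈ , e = column T {w} {east} {U w + + 2} w∈ (ℤP.i≤i+j (U w) (+ 2)) east∈
              (≤-trans (subst (U w + + 2 ≤_) U₂ (ℤP.i≤i+j (U w + + 2) (+ (k ℕ.+ k)))) east≥)
          q , q∈ , e′ , lowest = minOn U V t∈
      in jump k w q w∈ low none q∈ (trans e′ e) lowest
      where
      U₂ : U w + + 2 + + (k ℕ.+ k) ≡ U p
      U₂ = trans (ℤP.+-assoc (U w) (+ 2) (+ (k ℕ.+ k))) (trans (cong (λ n → U w + + n) (cong suc (sym (ℕP.+-suc k k)))) (proj₁ low))

    low⇒⊥ : ∀ k w → w ∈ A → Low k w → ⊥
    low⇒⊥ zero w w∈ (e , h) = i+1≰i {V w} (≤-trans h (≤-trans (ℤP.i≤i+j (V p) (+ 1)) (col-above w∈ (trans (sym (ℤP.+-identityʳ (U w))) e))))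
    low⇒⊥ (suc k) w w∈ l with Any.any? (λ r → (U r + + (k ℕ.+ k) ℤP.≟ U p) ×-dec (V r + + 1 ℤP.≤? V p)) A
    ... | yes h = let r , r∈ , lr = find h in low⇒⊥ k r r∈ lr
    ... | no h = step k w w∈ l (λ r∈ lr → h (lose r∈ lr))

    lower : ∀ {r} → r ∈ A → U r ≤ U p → V r ≤ V p → V r + + 1 ≤ V p
    lower r∈ hu hv = ≢⇒< hv (λ e → i+1≰i {U p} (≤-trans (row-right r∈ e) hu))

  no-south : ∀ {w} → w ∈ A → U w ≤ U p → V w ≤ V p → ⊥
  no-south {w} w∈ hu hv = start (halve ∣ U p - U w ∣)
    where
    d : U w + + ∣ U p - U w ∣ ≡ U p
    d = trans (cong (λ t → U w + t) (ℤP.0≤i⇒+∣i∣≡i (ℤP.i≤j⇒0≤j-i hu))) (l (U w) (U p))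
      where
      l : ∀ a b → a + (b - a) ≡ b
      l = solve-∀
    lw : V w + + 1 ≤ V p
    lw = lower w∈ hu hv
    plus : ∀ {n} k → U n ≡ U w + + 1 → U w + + suc (k ℕ.+ k) ≡ U p → U n + + (k ℕ.+ k) ≡ U p
    plus k e e′ = trans (cong (_+ + (k ℕ.+ k)) e) (trans (ℤP.+-assoc (U w) (+ 1) (+ (k ℕ.+ k))) e′)
    minus : ∀ {n} k → U n ≡ U w - + 1 → U w + + suc (k ℕ.+ k) ≡ U p → U n + + (suc k ℕ.+ suc k) ≡ U p
    minus k e e′ = trans (cong₂ (λ a b → a + + suc b) e (ℕP.+-suc k k)) (trans (l (U w) (+ (k ℕ.+ k))) e′)
      where
      l : ∀ u k → u - + 1 + (+ 2 + k) ≡ u + (+ 1 + k)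
      l = solve-∀
    fin : ∀ {n} j → n ∈ A → n ∈ nbrs w → U n + + (j ℕ.+ j) ≡ U p → ⊥
    fin {n} j n∈ nn e = low⇒⊥ j n n∈ (e , lower n∈ (≤U {j} {n} e) (≤-trans (nbV≤ nn) lw))
    -- A diagonal of the other parity is handled through a neighbour of `w` in `A`, which exists by
    -- tightness and is again below the level of `p`.
    odd : ∀ k → U w + + suc (k ℕ.+ k) ≡ U p → ∀ {n} → n ∈ nbrs w → n ∈ A → ⊥
    odd k e nn@(here refl) n∈ = fin {rt w} (suc k) n∈ nn (minus {rt w} k (U-rt w) e)
    odd k e nn@(there (here refl)) n∈ = fin {lf w} k n∈ nn (plus {lf w} k (U-lf w) e)
    odd k e nn@(there (there (here refl))) n∈ = fin {up w} k n∈ nn (plus {up w} k (U-up w) e)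
    odd k e nn@(there (there (there (here refl)))) n∈ = fin {dn w} (suc k) n∈ nn (minus {dn w} k (U-dn w) e)
    start : ∃[ k ] (∣ U p - U w ∣ ≡ k ℕ.+ k ⊎ ∣ U p - U w ∣ ≡ suc (k ℕ.+ k)) → ⊥
    start (k , inj₁ e) = low⇒⊥ k w w∈ (trans (cong (λ t → U w + + t) (sym e)) d , lw)
    start (k , inj₂ e) = let n , nn , n∈ = Nb⁻ (tight⇒Nb T w∈) in odd k (trans (cong (λ t → U w + + t) (sym e)) d) nn n∈

one-sided-above : ∀ {A p t} → TightSet A → p ∉ A → t ∈ A → U t ≡ U p → V p ≤ V t → ∀ {r} → r ∈ A → U r ≡ U p → V p + + 1 ≤ V r
one-sided-above {A} {p} {t} T p∉ t∈ et ht {r} r∈ er with V r ℤP.≤? V p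
... | no h = ≰⇒+1≤ h
... | yes h = ⊥-elim (one-sided {A} {p} {t} {r} T p∉ t∈ et ht r∈ er h)

∉-flip : ∀ {A p} → p ∉ A → swapUV p ∉ map swapUV A
∉-flip {A} {p} n h = n (subst (_∈ A) (gf flipA p) (∈-image⁻ flipA h))

one-sided-right : ∀ {A p t} → TightSet A → p ∉ A → t ∈ A → V t ≡ V p → U p ≤ U t → ∀ {r} → r ∈ A → V r ≡ V p → U p + + 1 ≤ U r
one-sided-right {A} {p} {t} T p∉ t∈ et ht {r} r∈ er = subst₂ (λ a b → a + + 1 ≤ b) (V-swap p) (V-swap r)
  (one-sided-above {map swapUV A} {swapUV p} {swapUV t} (tight-flip A T) (∉-flip p∉) (∈-map⁺ swapUV t∈)
    (trans (U-swap t) (trans et (sym (U-swap p)))) (subst₂ _≤_ (sym (V-swap p)) (sym (V-swap t)) ht)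
    {swapUV r} (∈-map⁺ swapUV r∈) (trans (U-swap r) (trans er (sym (U-swap p)))))

-- The diagonal V = V p meets `A` on one side of `p` only. On the side of larger U, `no-south`
-- applies to `s`; otherwise the sign of U is reversed and `w` takes the role of `s`.
below⇒⊥ : ∀ {A p s w} → TightSet A → p ∉ A → (∀ {r} → r ∈ A → U r ≡ U p → V p + + 1 ≤ V r) →
          (∃[ t ] t ∈ A × V t ≡ V p) → s ∈ A → U s ≤ U p → V s ≤ V p → w ∈ A → U p ≤ U w → V w ≤ V p → ⊥
below⇒⊥ {A} {p} {s} {w} T p∉ above (t , t∈ , et) s∈ us vs w∈ uw vw with U p ℤP.≤? U t
... | yes h = no-south {A} {p} T above (one-sided-right T p∉ t∈ et h) {w} w∈ uw s∈ us vs
... | no h = no-south {A′} {p′} (tight-swap A T)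
      (λ {r} r∈ e → subst₂ (λ a b → a + + 1 ≤ b) (sym (V-swapA p)) (V-swapA r) (above (∈-image⁻ swapA r∈)
          (trans (U-swapA r) (trans (cong -_ (trans e (U-swapA p))) (ℤP.neg-involutive (U p))))))
      (one-sided-right {A′} {p′} {f swapA t} (tight-swap A T) (λ k → p∉ (∈-image⁻ swapA k)) (∈-map⁺ (f swapA) t∈)
          (trans (V-swapA t) (trans et (sym (V-swapA p))))
          (subst₂ _≤_ (sym (U-swapA p)) (sym (U-swapA t)) (ℤP.neg-mono-≤ (ℤP.<⇒≤ (ℤP.≰⇒> h)))))
      {f swapA s} (∈-map⁺ (f swapA) s∈) (subst₂ _≤_ (sym (U-swapA p)) (sym (U-swapA s)) (ℤP.neg-mono-≤ us))
      (∈-map⁺ (f swapA) w∈) (subst₂ _≤_ (sym (U-swapA w)) (sym (U-swapA p)) (ℤP.neg-mono-≤ uw))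
      (subst₂ _≤_ (sym (V-swapA w)) (sym (V-swapA p)) vw)
  where
  A′ = map (f swapA) A
  p′ = f swapA p

flipV : Point → Point
flipV p = f flipA (f swapA (f flipA p))

U-flipV : ∀ p → U (flipV p) ≡ U p
U-flipV p = trans (U-swap (f swapA (f flipA p))) (trans (V-swapA (f flipA p)) (V-swap p))

V-flipV : ∀ p → V (flipV p) ≡ - V p
V-flipV p = trans (V-swap (f swapA (f flipA p))) (trans (U-swapA (f flipA p)) (cong -_ (U-swap p)))

-- There are no gaps, so both diagonals through `p` meet `A`. On U = U p the set lies on one side of
-- `p`; if it lies below, the sign of V is reversed and `e`, `n` replace `s`, `w`.
not-surrounded : ∀ {A p s w n e} → TightSet A → p ∉ A →
  s ∈ A → U s ≤ U p → V s ≤ V p → w ∈ A → U p ≤ U w → V w ≤ V p →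
  n ∈ A → U p ≤ U n → V p ≤ V n → e ∈ A → U e ≤ U p → V p ≤ V e → ⊥
not-surrounded {A} {p} {s} {w} {n} {e} T p∉ s∈ us vs w∈ uw vw n∈ un vn e∈ ue ve = go (column T s∈ us w∈ uw) (row T s∈ vs n∈ vn)
  where
  A₁ A₂ A₃ : List Point
  A₁ = map (f flipA) A
  A₂ = map (f swapA) A₁
  A₃ = map (f flipA) A₂
  ∈₃ : ∀ {r} → r ∈ A → flipV r ∈ A₃
  ∈₃ h = ∈-map⁺ (f flipA) (∈-map⁺ (f swapA) (∈-map⁺ (f flipA) h))
  ∈₃⁻ : ∀ {r} → r ∈ A₃ → flipV r ∈ A
  ∈₃⁻ h = ∈-image⁻ flipA (∈-image⁻ swapA (∈-image⁻ flipA h))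
  invol : ∀ r → flipV (flipV r) ≡ r
  invol (x , y) = cong₂ _,_ (ℤP.neg-involutive x) (ℤP.neg-involutive y)
  T₃ : TightSet A₃
  T₃ = tight-flip A₂ (tight-swap A₁ (tight-flip A T))
  p∉₃ : flipV p ∉ A₃
  p∉₃ h = p∉ (subst (_∈ A) (invol p) (∈₃⁻ h))
  negV : ∀ q r → V q ≤ V r → V (flipV r) ≤ V (flipV q)
  negV q r h = subst₂ _≤_ (sym (V-flipV r)) (sym (V-flipV q)) (ℤP.neg-mono-≤ h)
  sameU : ∀ q r → U q ≤ U r → U (flipV q) ≤ U (flipV r)
  sameU q r h = subst₂ _≤_ (sym (U-flipV q)) (sym (U-flipV r)) h
  go : (∃[ t ] t ∈ A × U t ≡ U p) → (∃[ t ] t ∈ A × V t ≡ V p) → ⊥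
  go (t , t∈ , et) (t′ , t′∈ , et′) with V p ℤP.≤? V t
  ... | yes h = below⇒⊥ T p∉ (one-sided-above T p∉ t∈ et h) (t′ , t′∈ , et′) s∈ us vs w∈ uw vw
  ... | no h = below⇒⊥ {A₃} {flipV p} {flipV e} {flipV n} T₃ p∉₃
      (one-sided-above {A₃} {flipV p} {flipV t} T₃ p∉₃ (∈₃ t∈) (trans (U-flipV t) (trans et (sym (U-flipV p))))
        (negV t p (ℤP.<⇒≤ (ℤP.≰⇒> h))))
      (flipV t′ , ∈₃ t′∈ , trans (V-flipV t′) (trans (cong -_ et′) (sym (V-flipV p))))
      (∈₃ e∈) (sameU e p ue) (negV p e ve) (∈₃ n∈) (sameU p n un) (negV p n vn)

-- Cones

data Dir : Set where
  north south west east : Dir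

idA : Automorphism
idA = record { f = id ; g = id ; gf = λ _ → refl ; fg = λ _ → refl ; adj = λ _ _ → mk⇔ id id }

-- Turns the quadrant of the given direction into the north one, so that all four are expressed by
-- `NCone`.
frame : Dir → Automorphism
frame north = idA
frame east = swapA
frame west = mirrorUD
frame south = swapA ⊙ mirrorUD

NCone : Point → Point → Set
NCone p q = U p ≤ U q × V p ≤ V q

Missed : List Point → Point → Dir → Set
Missed A p δ = ∀ q → q ∈ A → ¬ NCone (f (frame δ) p) (f (frame δ) q)

Free : List Point → Point → Set
Free A p = ∃[ δ ] Missed A p δ

NCone? : ∀ p q → Dec (NCone p q)
NCone? p q = (U p ℤP.≤? U q) ×-dec (V p ℤP.≤? V q)

cone-north : ∀ {p q} → NCone (f (frame north) p) (f (frame north) q) → U p ≤ U q × V p ≤ V q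
cone-north h = h

cone-east : ∀ {p q} → NCone (f (frame east) p) (f (frame east) q) → U q ≤ U p × V p ≤ V q
cone-east {p} {q} (h , k) = ℤP.neg-cancel-≤ (subst₂ _≤_ (U-swapA p) (U-swapA q) h) , subst₂ _≤_ (V-swapA p) (V-swapA q) k

cone-west : ∀ {p q} → NCone (f (frame west) p) (f (frame west) q) → U p ≤ U q × V q ≤ V p
cone-west {p} {q} (h , k) = subst₂ _≤_ (U-flipV p) (U-flipV q) h , ℤP.neg-cancel-≤ (subst₂ _≤_ (V-flipV p) (V-flipV q) k)

cone-south : ∀ {p q} → NCone (f (frame south) p) (f (frame south) q) → U q ≤ U p × V q ≤ V p
cone-south {p} {q} h = let a , b = cone-east {flipV p} {flipV q} h in
  subst₂ _≤_ (U-flipV q) (U-flipV p) a , ℤP.neg-cancel-≤ (subst₂ _≤_ (V-flipV p) (V-flipV q) b)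

hit? : ∀ A p δ → (∃[ q ] q ∈ A × NCone (f (frame δ) p) (f (frame δ) q)) ⊎ Missed A p δ
hit? A p δ with Any.any? (λ q → NCone? (f (frame δ) p) (f (frame δ) q)) A
... | yes h = inj₁ (find h)
... | no h = inj₂ (λ _ q∈ k → h (lose q∈ k))

free-or : ∀ A p → (∀ {s w n e} → s ∈ A → U s ≤ U p → V s ≤ V p → w ∈ A → U p ≤ U w → V w ≤ V p →
            n ∈ A → U p ≤ U n → V p ≤ V n → e ∈ A → U e ≤ U p → V p ≤ V e → ⊥) → Free A p
free-or A p no-four with hit? A p north | hit? A p east | hit? A p west | hit? A p south
... | inj₂ m | _ | _ | _ = north , m
... | inj₁ _ | inj₂ m | _ | _ = east , m
... | inj₁ _ | inj₁ _ | inj₂ m | _ = west , m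
... | inj₁ _ | inj₁ _ | inj₁ _ | inj₂ m = south , m
... | inj₁ (n , n∈ , hn) | inj₁ (e , e∈ , he) | inj₁ (w , w∈ , hw) | inj₁ (s , s∈ , hs) =
  let ue , ve = cone-east {p} {e} he
      uw , vw = cone-west {p} {w} hw
      us , vs = cone-south {p} {s} hs
  in ⊥-elim (no-four s∈ us vs w∈ uw vw n∈ (proj₁ hn) (proj₂ hn) e∈ ue ve)

tight⇒free : ∀ {A p} → TightSet A → p ∉ A → Free A p
tight⇒free {A} {p} T p∉ = free-or A p (not-surrounded T p∉)

small⇒free : ∀ {A p} → Small A → p ∉ A → Free A p
small⇒free {A} {p} (full , _) p∉ = free-or A p λ s∈ us vs w∈ uw vw n∈ un vn e∈ ue ve →
  p∉ (full (((_ , s∈ , us) , (_ , w∈ , uw)) , ((_ , s∈ , vs) , (_ , n∈ , vn))))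

NCone-trans : ∀ {p q r} → NCone p q → NCone q r → NCone p r
NCone-trans (a , b) (c , d) = ≤-trans a c , ≤-trans b d

NCone-up : ∀ p → NCone p (up p)
NCone-up p = subst (U p ≤_) (sym (U-up p)) (ℤP.i≤i+j (U p) (+ 1)) , subst (V p ≤_) (sym (V-up p)) (ℤP.i≤i+j (V p) (+ 1))

NCone-rtup : ∀ p → NCone p (rt (up p))
NCone-rtup (x , y) = lin0 0 (l₁ x y) , lin0 2 (l₂ x y)
  where
  l₁ : ∀ x y → y + + 1 - (x + + 1) - (y - x) ≡ + 0
  l₁ = solve-∀
  l₂ : ∀ x y → y + + 1 + (x + + 1) - (y + x) ≡ + 2
  l₂ = solve-∀

NCone-lfup : ∀ p → NCone p (lf (up p))
NCone-lfup (x , y) = lin0 2 (l₁ x y) , lin0 0 (l₂ x y)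
  where
  l₁ : ∀ x y → y + + 1 - (x - + 1) - (y - x) ≡ + 2
  l₁ = solve-∀
  l₂ : ∀ x y → y + + 1 + (x - + 1) - (y + x) ≡ + 0
  l₂ = solve-∀

-- With `p` a highest point of `S` in the cone, the other neighbours of `up p` lie higher in the
-- same cone and hence outside `S`; so `up p` leaves the boundary and pays for `p`.
peelNorth : ∀ S q → q ∈ S → ∃[ p ] p ∈ S × NCone q p × bsize (S ∖ (p ∷ [])) ℕ.≤ bsize S
peelNorth S q q∈ =
  let p , p∈ , m = argmax proj₂ (∈-filter⁺ (NCone? q) q∈ (≤-refl , ≤-refl))
      p∈S , c = ∈-filter⁻ (NCone? q) {xs = S} p∈
  in p , p∈S , c , go p p∈S (λ {r} r∈ k → m (∈-filter⁺ (NCone? q) r∈ (NCone-trans {q} {p} {r} c k)))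
  where
  go : ∀ p → p ∈ S → (∀ {r} → r ∈ S → NCone p r → proj₂ r ≤ proj₂ p) → bsize (S ∖ (p ∷ [])) ℕ.≤ bsize S
  go p@(x , y) p∈ m = peel S p (up p) p∈ (there (there (here refl))) (λ h → i+1≰i (m h (NCone-up p))) nb
    where
    two : y + + 1 + + 1 ≤ y → ⊥
    two h = 1≰0 (lin1 1 h (solve (y ∷ [])))
    nb : ∀ {r} → r ∈ nbrs (up p) → r ∉ S ⊎ r ≡ p
    nb (here refl) = inj₁ λ h → i+1≰i (m h (NCone-rtup p))
    nb (there (here refl)) = inj₁ λ h → i+1≰i (m h (NCone-lfup p))
    nb (there (there (here refl))) = inj₁ λ h → two (m h (NCone-trans {p} {up p} {up (up p)} (NCone-up p) (NCone-up (up p))))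
    nb (there (there (there (here refl)))) = inj₂ (dn-up p)

peelAlong : ∀ φ S q → q ∈ S → ∃[ p ] p ∈ S × NCone (f φ q) (f φ p) × bsize (S ∖ (p ∷ [])) ℕ.≤ bsize S
peelAlong φ S q q∈ =
  let p , p∈ , c , b = peelNorth (map (f φ) S) (f φ q) (∈-map⁺ (f φ) q∈)
  in g φ p , ∈-image⁻ φ p∈ , subst (NCone (f φ q)) (sym (fg φ p)) c , ℕP.≤-trans (ℕP.≤-reflexive (eq p)) (ℕP.≤-trans b (ℕP.≤-reflexive (bsize-image φ S)))
  where
  eq : ∀ p → bsize (S ∖ (g φ p ∷ [])) ≡ bsize (map (f φ) S ∖ (p ∷ []))
  eq p = trans (sym (bsize-image φ (S ∖ (g φ p ∷ [])))) (bsize-cong {map (f φ) (S ∖ (g φ p ∷ []))} {map (f φ) S ∖ (p ∷ [])} to from)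
    where
    to : map (f φ) (S ∖ (g φ p ∷ [])) ⊆ map (f φ) S ∖ (p ∷ [])
    to h = let a , b = ∈-∖⁻ {S} {g φ p ∷ []} (∈-image⁻ φ h) in ∈-∖⁺ (∈-image⁺ φ a) (λ { (here refl) → b (here refl) })
    from : map (f φ) S ∖ (p ∷ []) ⊆ map (f φ) (S ∖ (g φ p ∷ []))
    from {r} h = let a , b = ∈-∖⁻ {map (f φ) S} {p ∷ []} h in ∈-image⁺ φ (∈-∖⁺ (∈-image⁻ φ a) (λ { (here e) → b (here (f-inj (inv φ) e)) }))

carve : ∀ n A S → card S ℕ.≤ n → A ⊆ S → (∀ {p} → p ∉ A → Free A p) → bsize A ℕ.≤ bsize S
carve n A S c A⊆S free = go n c (Any.any? (λ q → ¬? (q ∈? A)) S)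
  where
  go : ∀ n → card S ℕ.≤ n → Dec (Any (_∉ A) S) → bsize A ℕ.≤ bsize S
  go n c (no h) = ℕP.≤-reflexive (bsize-cong {A} {S} A⊆S (λ {p} p∈ → decidable-stable (p ∈? A) (λ k → h (lose p∈ k))))
  go zero c (yes h) = let q , q∈ , _ = find h in ⊥-elim (card≡0⇒∉ {S} c q∈)
  go (suc n) c (yes h) =
    let q , q∈ , q∉ = find h
        δ , miss = free q∉
        p , p∈ , cone , b = peelAlong (frame δ) S q q∈
    in ℕP.≤-trans (carve n A (S ∖ (p ∷ []))
         (ℕ.s≤s⁻¹ (ℕP.≤-trans (ℕP.≤-reflexive (trans (ℕP.+-comm 1 (card (S ∖ (p ∷ [])))) (card-∖-point S p p∈))) c))
         (λ r∈ → ∈-∖⁺ (A⊆S r∈) (λ { (here refl) → miss _ r∈ cone })) free) b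

U-⊞ : ∀ p q → U (p ⊞ q) ≡ U p + U q
U-⊞ (x , y) (a , b) = l x y a b
  where
  l : ∀ x y a b → y + b - (x + a) ≡ y - x + (b - a)
  l = solve-∀

V-⊞ : ∀ p q → V (p ⊞ q) ≡ V p + V q
V-⊞ (x , y) (a , b) = l x y a b
  where
  l : ∀ x y a b → y + b + (x + a) ≡ y + x + (b + a)
  l = solve-∀

free⇒cones : ∀ A → (∀ {p} → p ∉ A → Free A p) → ComplUnionOfCones A
free⇒cones A free = I , K , isCone , λ p → mk⇔
    (λ p∉ → let δ , m = free p∉ in (p , δ , m) , (≤-refl , ≤-refl))
    (λ { ((q , δ , m) , c) p∈ → m p p∈ c })
  where
  I : Set
  I = Σ Point λ p → Σ Dir λ δ → Missed A p δ
  K : I → Point → Set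
  K (p , δ , _) q = NCone (f (frame δ) p) (f (frame δ) q)
  isCone : ∀ i → IsCone (K i)
  isCone (p , δ , _) = φ , λ q → mk⇔ (to q) (from q)
    where
    w : Point
    w = f (frame δ) p
    φ : Automorphism
    φ = inv (frame δ) ⊙ shift w
    back : ∀ z → z ≡ g (shift w) z ⊞ w
    back z = sym (fg (shift w) z)
    0≤ : ∀ {a b c} → a ≤ b → b ≡ c + a → + 0 ≤ c
    0≤ {a} {c = c} h refl = lin1 0 h (solve (a ∷ c ∷ []))
    ≤+ : ∀ {a c} → + 0 ≤ c → a ≤ c + a
    ≤+ {a} {c} h = lin1 0 h (solve (a ∷ c ∷ []))
    to : ∀ q → NCone w (f (frame δ) q) → ∃[ z ] (Cone₀ z × f φ z ≡ q)
    to q (h , k) =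
      let z = g (shift w) (f (frame δ) q)
      in z , (0≤ {c = U z} h (trans (cong U (back (f (frame δ) q))) (U-⊞ z w)) , 0≤ {c = V z} k (trans (cong V (back (f (frame δ) q))) (V-⊞ z w)))
         , fg φ q
    from : ∀ q → ∃[ z ] (Cone₀ z × f φ z ≡ q) → NCone w (f (frame δ) q)
    from q (z , (h , k) , e) =
      subst (U w ≤_) (sym (trans (cong U eq) (U-⊞ z w))) (≤+ h) , subst (V w ≤_) (sym (trans (cong V eq) (V-⊞ z w))) (≤+ k)
      where
      eq : f (frame δ) q ≡ z ⊞ w
      eq = trans (cong (f (frame δ)) (sym e)) (fg (frame δ) (z ⊞ w))

-- Paths, balls and cones given by arbitrary automorphisms

data Reach : ℕ → Point → Point → Set where
  stop : ∀ {n p} → Reach n p p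
  hop  : ∀ {n p q r} → q ∈ nbrs p → Reach n q r → Reach (suc n) p r

reach-aut : ∀ φ {n p q} → Reach n p q → Reach n (f φ p) (f φ q)
reach-aut φ stop = stop
reach-aut φ (hop h k) = hop (aut-nbrs φ h) (reach-aut φ k)

-- The ball of the graph metric in diagonal coordinates, since |x| + |y| is the maximum of |y - x|
-- and |y + x|. `Reach` describes the same ball in a form that automorphisms preserve.
Ball : ℕ → Point → Point → Set
Ball n p q = (U q ≤ U p + + n × U p ≤ U q + + n) × (V q ≤ V p + + n × V p ≤ V q + + n)

reach⇒ball : ∀ {n p q} → Reach n p q → Ball n p q
reach⇒ball {n} {p} stop = (ℤP.i≤i+j (U p) (+ n) , ℤP.i≤i+j (U p) (+ n)) , (ℤP.i≤i+j (V p) (+ n) , ℤP.i≤i+j (V p) (+ n))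
reach⇒ball {suc n} {p} {r} (hop {q = q} h k) =
  let (a , b) , (c , d) = reach⇒ball k in
  (l₁ (U p) (U q) (U r) (+ n) a (nbU≤ h) , l₂ (U p) (U q) (U r) (+ n) b (nbU≤ (nbrs-sym h)))
  , (l₁ (V p) (V q) (V r) (+ n) c (nbV≤ h) , l₂ (V p) (V q) (V r) (+ n) d (nbV≤ (nbrs-sym h)))
  where
  l₁ : ∀ p q r n → r ≤ q + n → q ≤ p + + 1 → r ≤ p + (+ 1 + n)
  l₁ p q r n h k = lin2 0 h k (solve (p ∷ q ∷ r ∷ n ∷ []))
  l₂ : ∀ p q r n → q ≤ r + n → p ≤ q + + 1 → p ≤ r + (+ 1 + n)
  l₂ p q r n h k = lin2 0 h k (solve (p ∷ q ∷ r ∷ n ∷ []))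

iter : (Point → Point) → ℕ → Point → Point
iter s zero p = p
iter s (suc k) p = iter s k (s p)

walk : (s : Point → Point) → (∀ p → s p ∈ nbrs p) → ∀ k {m p r} → Reach m (iter s k p) r → Reach (k ℕ.+ m) p r
walk s h zero k = k
walk s h (suc n) {p = p} k = hop (h p) (walk s h n k)

reach-mono : ∀ {m n p q} → m ℕ.≤ n → Reach m p q → Reach n p q
reach-mono h stop = stop
reach-mono (s≤s h) (hop a b) = hop a (reach-mono h b)

iter-rt : ∀ k x y → iter rt k (x , y) ≡ (x + + k , y)
iter-rt zero x y = cong (_, y) (sym (ℤP.+-identityʳ x))
iter-rt (suc k) x y = trans (iter-rt k (x + + 1) y) (cong (_, y) (ℤP.+-assoc x (+ 1) (+ k)))

iter-up : ∀ k x y → iter up k (x , y) ≡ (x , y + + k)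
iter-up zero x y = cong (x ,_) (sym (ℤP.+-identityʳ y))
iter-up (suc k) x y = trans (iter-up k x (y + + 1)) (cong (x ,_) (ℤP.+-assoc y (+ 1) (+ k)))

x-1-k : ∀ x k → x - + 1 - k ≡ x - (+ 1 + k)
x-1-k = solve-∀

iter-lf : ∀ k x y → iter lf k (x , y) ≡ (x - + k , y)
iter-lf zero x y = cong (_, y) (sym (ℤP.+-identityʳ x))
iter-lf (suc k) x y = trans (iter-lf k (x - + 1) y) (cong (_, y) (x-1-k x (+ k)))

iter-dn : ∀ k x y → iter dn k (x , y) ≡ (x , y - + k)
iter-dn zero x y = cong (x ,_) (sym (ℤP.+-identityʳ y))
iter-dn (suc k) x y = trans (iter-dn k x (y - + 1)) (cong (x ,_) (x-1-k y (+ k)))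

offset : ∀ x x′ → (∃[ k ] x′ ≡ x + + k) ⊎ (∃[ k ] x′ ≡ x - + k)
offset x x′ with ℤP.≤-total x x′
... | inj₁ h = inj₁ (∣ x′ - x ∣ , trans (l x x′) (cong (λ t → x + t) (sym (ℤP.0≤i⇒+∣i∣≡i (ℤP.i≤j⇒0≤j-i h)))))
  where
  l : ∀ x x′ → x′ ≡ x + (x′ - x)
  l = solve-∀
... | inj₂ h = inj₂ (∣ x - x′ ∣ , trans (l x x′) (cong (λ t → x - t) (sym (ℤP.0≤i⇒+∣i∣≡i (ℤP.i≤j⇒0≤j-i h)))))
  where
  l : ∀ x x′ → x′ ≡ x - (x - x′)
  l = solve-∀

ball⇒reach : ∀ n p q → Ball n p q → Reach n p q
ball⇒reach n (x , y) (x′ , y′) ((u₁ , u₂) , (v₁ , v₂)) with offset x x′ | offset y y′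
... | inj₁ (k , refl) | inj₁ (j , refl) = reach-mono (ℤP.drop‿+≤+ (lin1 0 v₁ (l x y (+ k) (+ j) (+ n))))
    (walk rt (λ _ → here refl) k (walk up (λ _ → there (there (here refl))) j
      (subst (Reach 0 _) (trans (cong (iter up j) (iter-rt k x y)) (iter-up j (x + + k) y)) stop)))
  where
  l : ∀ x y k j n → n - (k + (j + + 0)) ≡ y + x + n - (y + j + (x + k)) + + 0
  l = solve-∀
... | inj₁ (k , refl) | inj₂ (j , refl) = reach-mono (ℤP.drop‿+≤+ (lin1 0 u₂ (l x y (+ k) (+ j) (+ n))))
    (walk rt (λ _ → here refl) k (walk dn (λ _ → there (there (there (here refl)))) j
      (subst (Reach 0 _) (trans (cong (iter dn j) (iter-rt k x y)) (iter-dn j (x + + k) y)) stop)))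
  where
  l : ∀ x y k j n → n - (k + (j + + 0)) ≡ y - j - (x + k) + n - (y - x) + + 0
  l = solve-∀
... | inj₂ (k , refl) | inj₁ (j , refl) = reach-mono (ℤP.drop‿+≤+ (lin1 0 u₁ (l x y (+ k) (+ j) (+ n))))
    (walk lf (λ _ → there (here refl)) k (walk up (λ _ → there (there (here refl))) j
      (subst (Reach 0 _) (trans (cong (iter up j) (iter-lf k x y)) (iter-up j (x - + k) y)) stop)))
  where
  l : ∀ x y k j n → n - (k + (j + + 0)) ≡ y - x + n - (y + j - (x - k)) + + 0
  l = solve-∀
... | inj₂ (k , refl) | inj₂ (j , refl) = reach-mono (ℤP.drop‿+≤+ (lin1 0 v₂ (l x y (+ k) (+ j) (+ n))))
    (walk lf (λ _ → there (here refl)) k (walk dn (λ _ → there (there (there (here refl)))) j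
      (subst (Reach 0 _) (trans (cong (iter dn j) (iter-lf k x y)) (iter-dn j (x - + k) y)) stop)))
  where
  l : ∀ x y k j n → n - (k + (j + + 0)) ≡ y - j + (x - k) + n - (y + x) + + 0
  l = solve-∀

ball-cover : ∀ A p → ∃[ n ] (∀ {r} → r ∈ A → Ball n p r)
ball-cover [] p = 0 , λ ()
ball-cover (a ∷ A) p =
  let n , h = ball-cover A p
      m = ∣ U a - U p ∣ ℕ.+ ∣ V a - V p ∣
  in n ℕ.+ m , λ { (here refl) → weaken p a (ℕP.m≤n+m m n) (self a) ; {r} (there k) → weaken p r (ℕP.m≤m+n n m) (h k) }
  where
  weaken : ∀ {m n} p q → m ℕ.≤ n → Ball m p q → Ball n p q
  weaken {m} {n} p q h ((a , b) , (c , d)) =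
    (≤-trans a (w (U p)) , ≤-trans b (w (U q))) , (≤-trans c (w (V p)) , ≤-trans d (w (V q)))
    where
    w : ∀ i → i + + m ≤ i + + n
    w i = ℤP.+-monoʳ-≤ i (+≤+ h)
  ≤abs : ∀ i → i ≤ + ∣ i ∣
  ≤abs (+ n) = ≤-refl
  ≤abs -[1+ n ] = -≤+
  d₁ : ∀ a b → a ≤ b + + ∣ a - b ∣
  d₁ a b = lin1 0 (≤abs (a - b)) (l a b (+ ∣ a - b ∣))
    where
    l : ∀ a b t → b + t - a ≡ t - (a - b) + + 0
    l = solve-∀
  d₂ : ∀ a b → b ≤ a + + ∣ a - b ∣
  d₂ a b = subst (λ t → b ≤ a + + t) (trans (cong ∣_∣ (l a b)) (ℤP.∣-i∣≡∣i∣ (a - b))) (d₁ b a)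
    where
    l : ∀ a b → b - a ≡ - (a - b)
    l = solve-∀
  self : ∀ a → Ball (∣ U a - U p ∣ ℕ.+ ∣ V a - V p ∣) p a
  self a = (≤-trans (d₁ (U a) (U p)) (w₁ (U p)) , ≤-trans (d₂ (U a) (U p)) (w₁ (U a)))
         , (≤-trans (d₁ (V a) (V p)) (w₂ (V p)) , ≤-trans (d₂ (V a) (V p)) (w₂ (V a)))
    where
    w₁ : ∀ i → i + + ∣ U a - U p ∣ ≤ i + + (∣ U a - U p ∣ ℕ.+ ∣ V a - V p ∣)
    w₁ i = ℤP.+-monoʳ-≤ i (+≤+ (ℕP.m≤m+n _ _))
    w₂ : ∀ i → i + + ∣ V a - V p ∣ ≤ i + + (∣ U a - U p ∣ ℕ.+ ∣ V a - V p ∣)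
    w₂ i = ℤP.+-monoʳ-≤ i (+≤+ (ℕP.m≤n+m _ _))

-- A cone through p contains arbitrarily large balls through p, and a ball through p that is
-- larger than A ∪ {p} covers the part of A in one of the four quadrants at p.
cones⇒free : ∀ A → ComplUnionOfCones A → ∀ {p} → p ∉ A → Free A p
cones⇒free A (I , K , isCone , cover) {p} p∉ = choose (ℤP.≤-total (U p) (U C)) (ℤP.≤-total (V p) (V C))
  where
  i : I
  i = proj₁ (Equivalence.to (cover p) p∉)
  φ : Automorphism
  φ = proj₁ (isCone i)
  apex = Equivalence.to (proj₂ (isCone i) p) (proj₂ (Equivalence.to (cover p) p∉))
  q : Point
  q = proj₁ apex
  n : ℕ
  n = proj₁ (ball-cover A p)
  near : ∀ {r} → r ∈ A → Ball n p r
  near = proj₂ (ball-cover A p)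
  c C : Point
  -- Going `n` steps up inside the standard cone gives a centre whose ball of radius `n` stays in
  -- the cone while still containing `q`, the preimage of `p`.
  c = iter up n q
  C = f φ c
  U-iter : ∀ k q → U (iter up k q) ≡ U q + + k × V (iter up k q) ≡ V q + + k
  U-iter k (x , y) = trans (cong U (iter-up k x y)) (l₁ x y (+ k)) , trans (cong V (iter-up k x y)) (l₂ x y (+ k))
    where
    l₁ : ∀ x y k → y + k - x ≡ y - x + k
    l₁ = solve-∀
    l₂ : ∀ x y k → y + k + x ≡ y + x + k
    l₂ = solve-∀
  Cp : Ball n p C
  Cp = subst (λ t → Ball n t C) (proj₂ (proj₂ apex)) (reach⇒ball (reach-aut φ up-path))
    where
    up-path : Reach n q c
    up-path = subst (λ t → Reach t q c) (ℕP.+-identityʳ n) (walk up (λ _ → there (there (here refl))) n stop)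
  inside : ∀ {r} → Ball n C r → r ∉ A
  inside {r} b = Equivalence.from (cover r) (i , Equivalence.from (proj₂ (isCone i) r) (g φ r , cone , fg φ r))
    where
    b′ : Ball n c (g φ r)
    b′ = subst (λ t → Ball n t (g φ r)) (gf φ c) (reach⇒ball (reach-aut (inv φ) (ball⇒reach n C r b)))
    l : ∀ a b → + 0 ≤ a → a + + n ≤ b + + n → + 0 ≤ b
    l a b h k = lin2 0 h k (lem a b (+ n))
      where
      lem : ∀ a b n → b - + 0 ≡ (a - + 0) + (b + n - (a + n)) + + 0
      lem = solve-∀
    cone : Cone₀ (g φ r)
    cone = let (h , k) = proj₁ (proj₂ apex) in
      l (U q) (U (g φ r)) h (subst (_≤ U (g φ r) + + n) (proj₁ (U-iter n q)) (proj₂ (proj₁ b′)))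
      , l (V q) (V (g φ r)) k (subst (_≤ V (g φ r) + + n) (proj₂ (U-iter n q)) (proj₂ (proj₂ b′)))
  mono : ∀ {a b} → a ≤ b → a + + n ≤ b + + n
  mono h = ℤP.+-monoˡ-≤ (+ n) h
  choose : U p ≤ U C ⊎ U C ≤ U p → V p ≤ V C ⊎ V C ≤ V p → Free A p
  choose (inj₁ hu) (inj₁ hv) = north , λ r r∈ k →
    let a , b = cone-north {p} {r} k
        (u₁ , u₂) , (v₁ , v₂) = near r∈
        (w₁ , w₂) , (z₁ , z₂) = Cp
    in inside {r} ((≤-trans u₁ (mono hu) , ≤-trans w₁ (mono a)) , (≤-trans v₁ (mono hv) , ≤-trans z₁ (mono b))) r∈
  choose (inj₁ hu) (inj₂ hv) = west , λ r r∈ k →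
    let a , b = cone-west {p} {r} k
        (u₁ , u₂) , (v₁ , v₂) = near r∈
        (w₁ , w₂) , (z₁ , z₂) = Cp
    in inside {r} ((≤-trans u₁ (mono hu) , ≤-trans w₁ (mono a)) , (≤-trans b z₂ , ≤-trans hv v₂)) r∈
  choose (inj₂ hu) (inj₁ hv) = east , λ r r∈ k →
    let a , b = cone-east {p} {r} k
        (u₁ , u₂) , (v₁ , v₂) = near r∈
        (w₁ , w₂) , (z₁ , z₂) = Cp
    in inside {r} ((≤-trans a w₂ , ≤-trans hu u₂) , (≤-trans v₁ (mono hv) , ≤-trans z₁ (mono b))) r∈
  choose (inj₂ hu) (inj₂ hv) = south , λ r r∈ k →
    let a , b = cone-south {p} {r} k
        (u₁ , u₂) , (v₁ , v₂) = near r∈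
        (w₁ , w₂) , (z₁ , z₂) = Cp
    in inside {r} ((≤-trans a w₂ , ≤-trans hu u₂) , (≤-trans b z₂ , ≤-trans hv v₂)) r∈

-- Minimal sets up to translation, and the excess

gapless-bound : ∀ {A a c P Q} → Gapless A a c P Q → suc P ℕ.+ (3 ℕ.+ Q) ℕ.≤ bsize A
gapless-bound {A} {a} {c} {P} {Q} G = ℕP.≤-trans (ℕP.+-monoʳ-≤ (suc P) (ℕP.≤-reflexive (sym (ℕP.+-identityʳ (3 ℕ.+ Q)))))
  (boundary-count A a c P Q cols rows 1≤Q [] (λ ()))
  where open Gapless G

-- In the gapless case the lower bound for the boundary dominates both extents `P` and `Q`; the
-- summand 2 takes care of the small sets.
minimal-ball : ∀ A {o r} → Minimal A → o ∈ A → r ∈ A → Ball (bsize A ℕ.+ 2) o r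
minimal-ball A {o} {r} m o∈ r∈ = go (structure A o∈ m)
  where
  n : ℕ
  n = bsize A ℕ.+ 2
  small : ∀ {a} b → a ≤ b + + 2 → a ≤ b + + n
  small b h = ≤-trans h (ℤP.+-monoʳ-≤ b (+≤+ (ℕP.m≤n+m 2 (bsize A))))
  span : ∀ {a u w P} → P ℕ.≤ n → a ≤ u → w ≤ a + + P → w ≤ u + + n
  span {a} {u} {w} {P} h k l = ≤-trans l (≤-trans (ℤP.+-monoˡ-≤ (+ P) k) (ℤP.+-monoʳ-≤ u (+≤+ h)))
  go : (∃[ a ] ∃[ c ] ∃[ P ] ∃[ Q ] Gapless A a c P Q) ⊎ Small A → Ball n o r
  go (inj₂ (_ , diam)) =
    let h₁ , h₂ = diam r∈ o∈
        h₃ , h₄ = diam o∈ r∈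
    in (small (U o) h₁ , small (U r) h₃) , (small (V o) h₂ , small (V r) h₄)
  go (inj₁ (a , c , P , Q , G)) =
    let (u₁ , u₂) , (v₁ , v₂) = within o∈
        (u₃ , u₄) , (v₃ , v₄) = within r∈
    in (span P≤ u₁ u₄ , span P≤ u₃ u₂) , (span Q≤ v₁ v₄ , span Q≤ v₃ v₂)
    where
    open Gapless G
    P≤ : P ℕ.≤ n
    P≤ = ℕP.≤-trans (ℕP.≤-trans (ℕP.n≤1+n P) (ℕP.m≤m+n (suc P) (3 ℕ.+ Q))) (ℕP.≤-trans (gapless-bound G) (ℕP.m≤m+n (bsize A) 2))
    Q≤ : Q ℕ.≤ n
    Q≤ = ℕP.≤-trans (ℕP.≤-trans (ℕP.m≤n+m Q 3) (ℕP.m≤n+m (3 ℕ.+ Q) (suc P))) (ℕP.≤-trans (gapless-bound G) (ℕP.m≤m+n (bsize A) 2))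

-- Deciding the existence of sets with small boundary

window : ℕ → Point → List Point
window zero p = p ∷ []
window (suc n) p = p ∷ concatMap (window n) (nbrs p)

reach⇒window : ∀ {n p q} → Reach n p q → q ∈ window n p
reach⇒window {zero} stop = here refl
reach⇒window {suc n} stop = here refl
reach⇒window {suc n} (hop h k) = there (∈-concatMap⁺ (window n) (lose h (reach⇒window k)))

search : ∀ W j (P : List Point → Set) → (∀ L → Dec (P L)) → Dec (∃[ L ] length L ≡ j × L ⊆ W × P L)
search W zero P P? with P? []
... | yes h = yes ([] , refl , (λ ()) , h)
... | no h = no λ { ([] , _ , _ , k) → h k }
search W (suc j) P P? with Any.any? (λ x → search W j (λ L → P (x ∷ L)) (λ L → P? (x ∷ L))) W
... | yes h = let x , x∈ , L , e , L⊆ , k = find h in yes (x ∷ L , cong suc e , (λ { (here refl) → x∈ ; (there y) → L⊆ y }) , k)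
... | no h = no λ { (x ∷ L , e , L⊆ , k) → h (lose (L⊆ (here refl)) (L , ℕP.suc-injective e , (λ y → L⊆ (there y)) , k)) }

Smaller : ℕ → ℕ → Set
Smaller j s = ∃[ C ] card C ≡ j × bsize C ℕ.< s

-- A set of least boundary is minimal, so up to translation it lies in a ball of radius s + 2.
smaller? : ∀ j s → Dec (Smaller j s)
smaller? j s with search (window (s ℕ.+ 2) (+ 0 , + 0)) j (λ L → card L ≡ j × bsize L ℕ.< s) (λ L → (card L ℕP.≟ j) ×-dec (bsize L ℕP.<? s))
... | yes (L , _ , _ , c , b) = yes (L , c , b)
... | no none = no λ (C , c , b) → absurd (bsize C) C ℕP.≤-refl c b
  where
  W : List Point
  W = window (s ℕ.+ 2) (+ 0 , + 0)
  fits : ∀ C → card C ≡ j → bsize C ℕ.< s → C ⊆ W → ⊥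
  fits C c b C⊆ = none (dedup C , c , (λ h → C⊆ (∈-dedup⁻ h))
    , trans (card-cong {dedup C} {C} ∈-dedup⁻ ∈-dedup⁺) c
    , subst (ℕ._< s) (sym (bsize-cong {dedup C} {C} ∈-dedup⁻ ∈-dedup⁺)) b)
  minimal-absurd : ∀ C → Minimal C → card C ≡ j → bsize C ℕ.< s → ⊥
  minimal-absurd [] m c b = fits [] c b (λ ())
  minimal-absurd C@(o ∷ _) m c b = fits C′ (trans (card-image φ C) c) (subst (ℕ._< s) (sym (bsize-image φ C)) b)
    (λ {r} r∈ → reach⇒window (reach-mono (ℕP.+-monoˡ-≤ 2 (ℕP.≤-trans (ℕP.≤-reflexive (bsize-image φ C)) (ℕP.<⇒≤ b)))
      (ball⇒reach (bsize C′ ℕ.+ 2) (+ 0 , + 0) r (minimal-ball C′ {+ 0 , + 0} {r} (Minimal-image φ C m) origin∈ r∈))))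
    where
    φ = inv (shift o)
    C′ = map (f φ) C
    origin∈ : (+ 0 , + 0) ∈ C′
    origin∈ = ∈-image⁺ φ (subst (_∈ C) (0⊞ o) (here refl))
  -- Induction on the boundary size: a better competitor of the same cardinality is refuted already,
  -- so `C` is minimal and the failed search excludes it.
  absurd : ∀ n C → bsize C ℕ.≤ n → card C ≡ j → bsize C ℕ.< s → ⊥
  absurd zero C h c b = minimal-absurd C (λ _ _ → ℕP.≤-trans h z≤n) c b
  absurd (suc n) C h c b = minimal-absurd C least c b
    where
    least : Minimal C
    least C′ c′ with bsize C ℕP.≤? bsize C′
    ... | yes k = k
    ... | no k = ⊥-elim (absurd n C′ (ℕ.s≤s⁻¹ (ℕP.≤-trans (ℕP.≰⇒> k) h)) (trans c′ c) (ℕP.<-trans (ℕP.≰⇒> k) b))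

threshold : ∀ s m j → Smaller j s → ¬ Smaller (j ℕ.+ m) s → ∃[ k ] Smaller k s × ¬ Smaller (suc k) s × suc k ℕ.≤ j ℕ.+ m
threshold s zero j d n = ⊥-elim (n (subst (λ t → Smaller t s) (sym (ℕP.+-identityʳ j)) d))
threshold s (suc m) j d n with smaller? (suc j) s
... | no h = j , d , h , subst (suc j ℕ.≤_) (sym (ℕP.+-suc j m)) (s≤s (ℕP.m≤m+n j m))
... | yes h = let k , d′ , n′ , le = threshold s m (suc j) h (λ t → n (subst (λ x → Smaller x s) (sym (ℕP.+-suc j m)) t))
              in k , d′ , n′ , subst (suc k ℕ.≤_) (sym (ℕP.+-suc j m)) le

bsize-pos : ∀ A {p} → p ∈ A → 1 ℕ.≤ bsize A
bsize-pos A {p} p∈ with argmax proj₂ p∈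
... | q@(x , y) , q∈ , m = card-pos {boundary A} {up q} (∂⁺ (λ h → i+1≰i (m h)) (Nb-up q∈))

-- The maximum is attained at the smallest cardinality for which the boundary cannot be pushed below
-- `bsize A`. Trimming `A` to that cardinality gives a minimal set realising it; being no larger
-- than `A`, it yields N ≤ E.
excess : ∀ A S {p} → p ∈ A → Minimal A → bsize A ≡ bsize S → ∀ N → card S ≡ N ℕ.+ card A → ∃[ E ] (IsExc S E × + N ≤ E)
excess A S p∈ m e N cS =
  -- The search starts from the empty set, whose boundary is empty, and ends at `card A`, where
  -- minimality of `A` rules out a smaller boundary.
  let k , (C₁ , c₁ , b₁) , none , le = threshold s (card A) 0 ([] , refl , bsize-pos A p∈)
        (λ (C , c , b) → ℕP.<-irrefl refl (ℕP.<-≤-trans b (m C c)))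
      C , _ , c , b = trim A (suc k) le
      least : ∀ C′ → card C′ ≡ suc k → s ℕ.≤ bsize C′
      least C′ c′ = ℕP.≮⇒≥ (λ lt → none (C′ , c′ , lt))
      bC : bsize C ≡ s
      bC = ℕP.≤-antisym b (least C c)
      minC : Minimal C
      minC C′ c′ = ℕP.≤-trans b (least C′ (trans c′ c))
      above : ∀ C′ → Minimal C′ → bsize C′ ≡ bsize S → card C ℕ.≤ card C′
      above C′ m′ b′ = subst (ℕ._≤ card C′) (sym c) (ℕP.≰⇒> (λ h → ℕP.<-irrefl refl
        (ℕP.≤-<-trans (minimal-≤ C′ C₁ m′ (subst (card C′ ℕ.≤_) (sym c₁) h)) (ℕP.<-≤-trans b₁ (ℕP.≤-reflexive (trans e (sym b′)))))))
  in + card S - + card C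
     , ((C , minC , trans bC e , l₁ (+ card S) (+ card C))
       , λ C′ m′ b′ → lin1 0 (+≤+ (above C′ m′ b′)) (l₂ (+ card S) (+ card C) (+ card C′)))
     , lin1 0 (+≤+ (subst (ℕ._≤ card A) (sym c) le)) (trans (cong (λ t → + t - + card C - + N) cS) (l₃ (+ N) (+ card A) (+ card C)))
  where
  s : ℕ
  s = bsize A
  l₁ : ∀ a c → a ≡ a - c + c
  l₁ = solve-∀
  l₂ : ∀ a c c′ → a - c - (a - c′) ≡ c′ - c + + 0
  l₂ = solve-∀
  l₃ : ∀ n a c → n + a - c - n ≡ a - c + + 0
  l₃ = solve-∀

excess⇒minimal : ∀ A S {E} N → bsize A ℕ.≤ bsize S → card S ≡ N ℕ.+ card A → IsExc S E → + N ≤ E → Minimal A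
excess⇒minimal A S {E} N b cS ((C , mC , bC , eC) , _) N≤E C′ c′ =
  ℕP.≤-trans b (ℕP.≤-trans (ℕP.≤-reflexive (sym bC)) (minimal-≤ C C′ mC (subst (card C ℕ.≤_) (sym c′) C≤A)))
  where
  l : ∀ n a e c → n + a ≡ e + c → n ≤ e → c ≤ a
  l n a e c h k = lin1 0 k (trans (l₁ n a e c) (trans (cong (λ t → t - (n + c)) h) (l₂ n e c)))
    where
    l₁ : ∀ n a e c → a - c ≡ n + a - (n + c)
    l₁ = solve-∀
    l₂ : ∀ n e c → e + c - (n + c) ≡ e - n + + 0
    l₂ = solve-∀
  C≤A : card C ℕ.≤ card A
  C≤A = ℤP.drop‿+≤+ (l (+ N) (+ card A) E (+ card C) (trans (cong +_ (sym cS)) eC) N≤E)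

-- The enclosing box and the equivalences

nonempty : ∀ A → ¬ (A ≡ []) → ∃[ p ] p ∈ A
nonempty [] h = ⊥-elim (h refl)
nonempty (p ∷ A) h = p , here refl

-- `IsEncBox` fixes the box only as a set of points, and by parity different bounds can describe the
-- same set. The extremes of U and V on `A` are recovered by comparison with the box that they span.
enc⇒hull : ∀ A {q} → q ∈ A → ∀ {a b c d} → IsEncBox A a b c d → ∀ {p} → InBox a b c d p → Hull A p
enc⇒hull A q∈ {a} {b} {c} {d} (_ , least) {p} h =
  let a′ , P , inU , (r₁ , r₁∈ , e₁) , (r₂ , r₂∈ , e₂) = range U A q∈
      c′ , Q , inV , (r₃ , r₃∈ , e₃) , (r₄ , r₄∈ , e₄) = range V A q∈
      (h₁ , h₂) , (h₃ , h₄) = least a′ (a′ + + P) c′ (c′ + + Q) (λ r r∈ → inU r∈ , inV r∈) p h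
  in ((r₁ , r₁∈ , subst (_≤ U p) (sym e₁) h₁) , (r₂ , r₂∈ , subst (U p ≤_) (sym e₂) h₂))
   , ((r₃ , r₃∈ , subst (_≤ V p) (sym e₃) h₃) , (r₄ , r₄∈ , subst (V p ≤_) (sym e₄) h₄))

hull⇒enc : ∀ A {a b c d} → IsEncBox A a b c d → ∀ {p} → Hull A p → InBox a b c d p
hull⇒enc A (inside , _) (((r₁ , r₁∈ , h₁) , (r₂ , r₂∈ , h₂)) , ((r₃ , r₃∈ , h₃) , (r₄ , r₄∈ , h₄))) =
  (≤-trans (proj₁ (proj₁ (inside r₁ r₁∈))) h₁ , ≤-trans h₂ (proj₂ (proj₁ (inside r₂ r₂∈))))
  , (≤-trans (proj₁ (proj₂ (inside r₃ r₃∈))) h₃ , ≤-trans h₄ (proj₂ (proj₂ (inside r₄ r₄∈))))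

module Enclosing (A S : List Point) (A⊆S : A ⊆ S) (S⇒hull : ∀ {p} → p ∈ S → Hull A p) (hull⇒S : ∀ {p} → Hull A p → p ∈ S) where

  gapless-enc : ∀ {a c P Q} → Gapless A a c P Q → bsize S ℕ.≤ suc P ℕ.+ (3 ℕ.+ Q)
  gapless-enc {a} {c} {P} {Q} G = box-bsize S a c P Q
    (λ h → let ((_ , r₁∈ , h₁) , (_ , r₂∈ , h₂)) , ((_ , r₃∈ , h₃) , (_ , r₄∈ , h₄)) = S⇒hull h in
      (≤-trans (proj₁ (proj₁ (within r₁∈))) h₁ , ≤-trans h₂ (proj₂ (proj₁ (within r₂∈))))
      , (≤-trans (proj₁ (proj₂ (within r₃∈))) h₃ , ≤-trans h₄ (proj₂ (proj₂ (within r₄∈)))))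
    (λ {p} ((h₁ , h₂) , (h₃ , h₄)) → hull⇒S {p}
      ( ((let r , r∈ , e = cols 0 z≤n in r , r∈ , subst (_≤ U p) (sym (trans e (ℤP.+-identityʳ a))) h₁)
      , (let r , r∈ , e = cols P ℕP.≤-refl in r , r∈ , subst (U p ≤_) (sym e) h₂))
      , ((let r , r∈ , e = rows 0 z≤n in r , r∈ , subst (_≤ V p) (sym (trans e (ℤP.+-identityʳ c))) h₃)
      , (let r , r∈ , e = rows Q ℕP.≤-refl in r , r∈ , subst (V p ≤_) (sym e) h₄))))
    where open Gapless G

  minimal⇒bsize : ∀ {p} → p ∈ A → Minimal A → bsize A ≡ bsize S
  minimal⇒bsize p∈ m = ℕP.≤-antisym (minimal-≤ A S m (card-mono A⊆S)) (go (structure A p∈ m))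
    where
    go : (∃[ a ] ∃[ c ] ∃[ P ] ∃[ Q ] Gapless A a c P Q) ⊎ Small A → bsize S ℕ.≤ bsize A
    go (inj₁ (_ , _ , _ , _ , G)) = ℕP.≤-trans (gapless-enc G) (gapless-bound G)
    go (inj₂ (full , _)) = ℕP.≤-reflexive (bsize-cong {S} {A} (λ h → full (S⇒hull h)) A⊆S)

  -- The box has at least as many points as `A`, so its boundary bounds that of a minimal `A` from
  -- above; this makes a gapless minimal set tight.
  minimal⇒free : ∀ {p} → p ∈ A → Minimal A → ∀ {q} → q ∉ A → Free A q
  minimal⇒free p∈ m q∉ = go (structure A p∈ m)
    where
    go : (∃[ a ] ∃[ c ] ∃[ P ] ∃[ Q ] Gapless A a c P Q) ⊎ Small A → Free A _
    go (inj₂ small) = small⇒free small q∉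
    go (inj₁ (a , c , P , Q , G)) = tight⇒free (a , c , P , Q , record
      { gapless = G ; bound = ℕP.≤-trans (minimal-≤ A S m (card-mono A⊆S)) (gapless-enc G) }) q∉

theorem7p6 : (A : List Point) → ¬ (A ≡ []) →
    (a b c d : ℤ) → IsEncBox A a b c d →
    (encA : List Point) → Enumerates encA (InBox a b c d) →
    let N = card (filter (λ u → ¬? (u ∈? A)) encA) in
    (Minimal A ⇔ (bsize A ≡ bsize encA × ∃[ E ] (IsExc encA E × + N Data.Integer.≤ E)))
    × (Minimal A ⇔ (ComplUnionOfCones A × ∃[ E ] (IsExc encA E × + N Data.Integer.≤ E)))
theorem7p6 A A≢[] a b c d enc encA enum =
    mk⇔ (λ m → minimal⇒bsize p∈ m , exc m)
        (λ (e , E , x , N≤E) → excess⇒minimal A encA N (ℕP.≤-reflexive e) cardS x N≤E)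
  , mk⇔ (λ m → free⇒cones A (minimal⇒free p∈ m) , exc m)
        (λ (cones , E , x , N≤E) → excess⇒minimal A encA N
           (carve (card encA) A encA ℕP.≤-refl A⊆ (cones⇒free A cones)) cardS x N≤E)
  where
  N : ℕ
  N = card (encA ∖ A)
  p∈ = proj₂ (nonempty A A≢[])
  A⊆ : A ⊆ encA
  A⊆ {p} h = Equivalence.from (enum p) (proj₁ enc p h)
  open Enclosing A encA A⊆ (λ {p} h → enc⇒hull A p∈ {a} {b} {c} {d} enc {p} (Equivalence.to (enum p) h))
                           (λ {p} h → Equivalence.from (enum p) (hull⇒enc A {a} {b} {c} {d} enc {p} h))
  cardS : card encA ≡ N ℕ.+ card A
  cardS = sym (card-∖ encA A A⊆)
  exc : Minimal A → ∃[ E ] (IsExc encA E × + N ≤ E)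
  exc m = excess A encA p∈ m (minimal⇒bsize p∈ m) N cardS
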